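{- There exists an algorithm that, given a tropical curve $\Gamma$ and a divisor $D$ on $\Gamma$, computes (in finite time on every input) the rank $r_\Gamma(D)$ of $D$.
   Context: Computational model: since edge lengths and positions of points may be irrational, the algorithm is allowed to perform real arithmetic operations (and comparisons) with infinite precision. The input consists of the underlying finite multigraph, the edge lengths in $(0,\infty]$, and the divisor given as a finite list of points (each described by an edge and a position on it, possibly $\infty$) with integer coefficients. A tropical curve $\Gamma$ is a finite connected multigraph (loops and parallel edges allowed) in which each edge is assigned a positive length, where edges incident with vertices of degree one are allowed to have infinite length. Each edge of finite length is identified with a closed interval of that length, the end points of the interval being identified with the end vertices of the edge; each edge of infinite length is identified with the interval $[0,\infty]$, with $\infty$ identified with the vertex of degree one. The points corresponding to $\infty$ are called unbounded ends; they are points of $\Gamma$. $\mathrm{Div}(\Gamma)$ is the free abelian group on the set of all points of $\Gamma$; a divisor $D=\sum_v D(v)(v)$ is effective ($D\ge0$) if $D(v)\ge 0$ for all $v$, and $\deg(D)=\sum_v D(v)$. A rational function on $\Gamma$ is a continuous function $f:\Gamma\to\mathbb R\cup\{\pm\infty\}$ which is piecewise linear with finitely many pieces and integer slopes on every edge, and such that the only points $v$ with $f(v)=\pm\infty$ are unbounded ends. For a point $v$, $\mathrm{ord}_v(f)$ is the sum of the outgoing slopes of $f$ over all segments emanating from $v$ (so at an unbounded end, $\mathrm{ord}_v(f)$ is minus the slope of $f$ towards $\infty$ near that end), and $\mathrm{div}(f)=\sum_v\mathrm{ord}_v(f)(v)$. Divisors $D,D'$ are equivalent, $D\sim D'$,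 if $D=D'+\mathrm{div}(f)$ for some rational function $f$. Put $|D|=\{E\in\mathrm{Div}(\Gamma):E\ge0,\ E\sim D\}$. The rank of $D$ is $$r_\Gamma(D)=\min\{\deg(E):E\in\mathrm{Div}(\Gamma),\ E\ge0,\ |D-E|=\emptyset\}-1.$$ -}

module Defs where

open import Algebra.Bundles using (CommutativeRing)
open import Algebra.Structures using (IsCommutativeRing)
open import Data.Fin using (Fin; toℕ)
import Data.Fin.Properties as Fin
open import Data.Integer as ℤ using (ℤ; +_; -[1+_]; 0ℤ; 1ℤ)
open import Data.List using (List; []; _∷_; _++_; map; foldr; filter; length; tabulate; concat)
open import Data.List.Membership.Propositional using (_∈_)
open import Data.List.Relation.Unary.All as All using (All; []; _∷_)
open import Data.Nat as ℕ using (ℕ; zero; suc; NonZero)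
open import Data.Product using (∃; ∃-syntax; _×_; _,_; proj₁; proj₂)
open import Data.Product.Properties using () renaming (≡-dec to ×-≡-dec)
open import Data.Sum using (_⊎_; inj₁; inj₂)
open import Data.Sum.Properties using () renaming (≡-dec to ⊎-≡-dec)
open import Data.Unit using (⊤; tt)
open import Relation.Binary.Construct.Closure.Equivalence using (EqClosure)
open import Relation.Binary.Construct.Closure.Transitive using (TransClosure; [_]; _∷_)
open import Relation.Binary.Definitions using (DecidableEquality)
open import Relation.Binary.PropositionalEquality using (_≡_; _≢_; refl)
open import Relation.Binary.Structures using (IsStrictTotalOrder)
open import Relation.Nullary using (¬_; Dec; yes; no)
open import Relation.Nullary.Construct.Add.Extrema using (_±; ⊥±; ⊤±) renaming ([_] to [_]±)
open import Relation.Nullary.Construct.Add.Point using (≡-dec)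
open import Relation.Nullary.Construct.Add.Supremum using (_⁺; ⊤⁺; [_])
import Algebra.Definitions.RawMonoid as RawMonoidDefinitions
import Relation.Binary.Construct.Add.Supremum.NonStrict as NonStrict
import Relation.Binary.Construct.Add.Supremum.Strict as Strict
import Relation.Binary.Construct.StrictToNonStrict as StrictToNonStrict

------------------------------------------------------------------------
-- The real numbers

-- ℝ, axiomatised as a Dedekind-complete ordered field.  The trichotomy
-- contained in IsStrictTotalOrder is the exact comparison of reals.  The
-- value of 0# ⁻¹ is left unspecified.

record Reals : Set₁ where
  infix  8 _⁻¹ -_
  infixl 7 _*_
  infixl 6 _+_
  infix  4 _<_
  field
    Carrier             : Set
    _+_ _*_             : Carrier → Carrier → Carrier
    -_ _⁻¹              : Carrier → Carrier
    0# 1#               : Carrier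
    _<_                 : Carrier → Carrier → Set
    isCommutativeRing   : IsCommutativeRing _≡_ _+_ _*_ -_ 0# 1#
    0≢1                 : 0# ≢ 1#
    *-inverseʳ          : ∀ x → x ≢ 0# → x * x ⁻¹ ≡ 1#
    isStrictTotalOrder  : IsStrictTotalOrder _≡_ _<_
    +-monoˡ-<           : ∀ {x y} z → x < y → x + z < y + z
    *-pos               : ∀ {x y} → 0# < x → 0# < y → 0# < x * y

  open IsStrictTotalOrder isStrictTotalOrder public using (_≟_; _<?_; compare)
  open StrictToNonStrict _≡_ _<_ public using (_≤_)

  UpperBound : (Carrier → Set) → Carrier → Set
  UpperBound P b = ∀ x → P x → x ≤ b

  field
    complete : ∀ (P : Carrier → Set) → ∃ P → ∃ (UpperBound P) →
               ∃[ s ] UpperBound P s × (∀ b → UpperBound P b → s ≤ b)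

  commutativeRing : CommutativeRing _ _
  commutativeRing = record { isCommutativeRing = isCommutativeRing }

  open RawMonoidDefinitions (CommutativeRing.+-rawMonoid commutativeRing) public
    using () renaming (_×_ to _ℕ·_)

  _·_ : ℤ → Carrier → Carrier
  (+ n)    · x = n ℕ· x
  -[1+ n ] · x = - (suc n ℕ· x)

  open Strict _<_ public using (_<⁺_)
  open NonStrict _≤_ public using (_≤⁺_)

  <⁺⇒≤⁺ : ∀ {x y} → x <⁺ y → x ≤⁺ y
  <⁺⇒≤⁺ Strict.[ x<y ]  = NonStrict.[ inj₁ x<y ]
  <⁺⇒≤⁺ Strict.[ x ]<⊤⁺ = _ NonStrict.≤⊤⁺

  ≤⁺-refl : ∀ x → x ≤⁺ x
  ≤⁺-refl [ x ] = NonStrict.[ inj₂ refl ]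
  ≤⁺-refl ⊤⁺    = _ NonStrict.≤⊤⁺

------------------------------------------------------------------------
-- Algorithms with exact real arithmetic

-- Gödel's system T with lists, extended by a type of reals.  The syntax
-- does not mention any particular model of the reals: real data can only
-- be processed by arithmetic and comparison, and the only real constants
-- are 0 and 1.

infixr 7 _⊗_
infixr 6 _⊕_
infixr 5 _⇒_

data Ty : Set where
  unit nat real : Ty
  _⊗_ _⊕_ _⇒_   : Ty → Ty → Ty
  list          : Ty → Ty

bool int : Ty
bool = unit ⊕ unit
int  = nat ⊕ nat

data Term (Δ : List Ty) : Ty → Set where
  var       : ∀ {σ} → σ ∈ Δ → Term Δ σ
  lam       : ∀ {σ τ} → Term (σ ∷ Δ) τ → Term Δ (σ ⇒ τ)
  app       : ∀ {σ τ} → Term Δ (σ ⇒ τ) → Term Δ σ → Term Δ τ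
  unit      : Term Δ unit
  pair      : ∀ {σ τ} → Term Δ σ → Term Δ τ → Term Δ (σ ⊗ τ)
  fst       : ∀ {σ τ} → Term Δ (σ ⊗ τ) → Term Δ σ
  snd       : ∀ {σ τ} → Term Δ (σ ⊗ τ) → Term Δ τ
  inl       : ∀ {σ τ} → Term Δ σ → Term Δ (σ ⊕ τ)
  inr       : ∀ {σ τ} → Term Δ τ → Term Δ (σ ⊕ τ)
  case      : ∀ {σ τ υ} → Term Δ (σ ⊕ τ) →
              Term (σ ∷ Δ) υ → Term (τ ∷ Δ) υ → Term Δ υ
  zero      : Term Δ nat
  suc       : Term Δ nat → Term Δ nat
  natrec    : ∀ {σ} → Term Δ σ → Term Δ (nat ⇒ σ ⇒ σ) → Term Δ nat → Term Δ σ
  nil       : ∀ {σ} → Term Δ (list σ)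
  cons      : ∀ {σ} → Term Δ σ → Term Δ (list σ) → Term Δ (list σ)
  fold      : ∀ {σ τ} → Term Δ τ → Term Δ (σ ⇒ τ ⇒ τ) → Term Δ (list σ) → Term Δ τ
  0ᴿ 1ᴿ     : Term Δ real
  add mul   : Term Δ real → Term Δ real → Term Δ real
  neg recip : Term Δ real → Term Δ real
  less      : Term Δ real → Term Δ real → Term Δ bool

-- System T alone is total, so unbounded computation is provided by
-- iterating a transition function on states until it delivers an output
-- (Kleene normal form).

record Algorithm (input output : Ty) : Set where
  field
    state : Ty
    start : Term [] (input ⇒ state)
    step  : Term [] (state ⇒ state ⊕ output)

module _ (ℝ : Reals) where
  open Reals ℝ

  ⟦_⟧ : Ty → Set
  ⟦ unit ⟧   = ⊤
  ⟦ nat ⟧    = ℕ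
  ⟦ real ⟧   = Carrier
  ⟦ σ ⊗ τ ⟧  = ⟦ σ ⟧ × ⟦ τ ⟧
  ⟦ σ ⊕ τ ⟧  = ⟦ σ ⟧ ⊎ ⟦ τ ⟧
  ⟦ σ ⇒ τ ⟧  = ⟦ σ ⟧ → ⟦ τ ⟧
  ⟦ list σ ⟧ = List ⟦ σ ⟧

  primrec : ∀ {A : Set} → A → (ℕ → A → A) → ℕ → A
  primrec z s zero    = z
  primrec z s (suc n) = s n (primrec z s n)

  -- `inj₁ tt` is true.
  fromDec : ∀ {P : Set} → Dec P → ⟦ bool ⟧
  fromDec (yes _) = inj₁ tt
  fromDec (no  _) = inj₂ tt

  mutual
    eval : ∀ {Δ σ} → Term Δ σ → All ⟦_⟧ Δ → ⟦ σ ⟧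
    eval (var x)        ρ = All.lookup ρ x
    eval (lam t)        ρ = λ v → eval t (v ∷ ρ)
    eval (app t u)      ρ = eval t ρ (eval u ρ)
    eval unit           ρ = tt
    eval (pair t u)     ρ = eval t ρ , eval u ρ
    eval (fst t)        ρ = proj₁ (eval t ρ)
    eval (snd t)        ρ = proj₂ (eval t ρ)
    eval (inl t)        ρ = inj₁ (eval t ρ)
    eval (inr t)        ρ = inj₂ (eval t ρ)
    eval (case t u v)   ρ = branch u v ρ (eval t ρ)
    eval zero           ρ = zero
    eval (suc t)        ρ = suc (eval t ρ)
    eval (natrec z s t) ρ = primrec (eval z ρ) (eval s ρ) (eval t ρ)
    eval nil            ρ = []
    eval (cons t u)     ρ = eval t ρ ∷ eval u ρ
    eval (fold z s t)   ρ = foldr (eval s ρ) (eval z ρ) (eval t ρ)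
    eval 0ᴿ             ρ = 0#
    eval 1ᴿ             ρ = 1#
    eval (add t u)      ρ = eval t ρ + eval u ρ
    eval (mul t u)      ρ = eval t ρ * eval u ρ
    eval (neg t)        ρ = - eval t ρ
    eval (recip t)      ρ = eval t ρ ⁻¹
    eval (less t u)     ρ = fromDec (eval t ρ <? eval u ρ)

    branch : ∀ {Δ σ τ υ} → Term (σ ∷ Δ) υ → Term (τ ∷ Δ) υ → All ⟦_⟧ Δ →
             ⟦ σ ⊕ τ ⟧ → ⟦ υ ⟧
    branch u v ρ (inj₁ x) = eval u (x ∷ ρ)
    branch u v ρ (inj₂ y) = eval v (y ∷ ρ)

  module _ {input output : Ty} (A : Algorithm input output) where
    open Algorithm A

    data RunsTo (s : ⟦ state ⟧) (o : ⟦ output ⟧) : Set where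
      halt : eval step [] s ≡ inj₂ o → RunsTo s o
      next : ∀ {s′} → eval step [] s ≡ inj₁ s′ → RunsTo s′ o → RunsTo s o

    -- In particular, A halts on x.
    Computes : ⟦ input ⟧ → ⟦ output ⟧ → Set
    Computes x o = RunsTo (eval start [] x) o

------------------------------------------------------------------------
-- Tropical curves

-- The edge e is the interval [0, len e], glued so that 0 is src e and
-- len e is tgt e.  Thus an edge of infinite length is oriented towards
-- the vertex of degree one that is its unbounded end.

module _ (ℝ : Reals) where
  open Reals ℝ

  record TropicalCurve : Set where
    field
      #vertices #edges : ℕ

    Vertex : Set
    Vertex = Fin #vertices

    Edge : Set
    Edge = Fin #edges

    field
      src tgt : Edge → Vertex
      len     : Edge → Carrier ⁺
      len-pos : ∀ e → [ 0# ] <⁺ len e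

    Adjacent : Vertex → Vertex → Set
    Adjacent u v = ∃[ e ] src e ≡ u × tgt e ≡ v

    -- The number of half-edges at v; a loop counts twice.
    valency : Vertex → ℕ
    valency v = length (filter (Fin._≟ v) (tabulate src ++ tabulate tgt))

    field
      nonempty  : NonZero #vertices
      connected : ∀ u v → EqClosure Adjacent u v
      infinite  : ∀ e → len e ≡ ⊤⁺ → valency (tgt e) ≡ 1

module _ {ℝ : Reals} (Γ : TropicalCurve ℝ) where
  open Reals ℝ
  open TropicalCurve Γ

  record Position (e : Edge) : Set where
    constructor position
    field
      coord      : Carrier ⁺
      .0≤coord   : [ 0# ] ≤⁺ coord
      .coord≤len : coord ≤⁺ len e

  open Position

  origin terminus : ∀ e → Position e
  origin   e = position [ 0# ] NonStrict.[ inj₂ refl ] (<⁺⇒≤⁺ (len-pos e))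
  terminus e = position (len e) (<⁺⇒≤⁺ (len-pos e)) (≤⁺-refl (len e))

  -- Descriptions of points of Γ.  Several descriptions may denote the
  -- same point: the points of Γ are these modulo _≈_ below.  (`vertex` is
  -- needed for the curve consisting of a single vertex.)
  data Point : Set where
    vertex : Vertex → Point
    on     : ∀ e → Position e → Point

  locate : Point → Vertex ⊎ (Edge × Carrier ⁺)
  locate (vertex v) = inj₁ v
  locate (on e x) with ≡-dec _≟_ (coord x) [ 0# ] | ≡-dec _≟_ (coord x) (len e)
  ... | yes _ | _     = inj₁ (src e)
  ... | no  _ | yes _ = inj₁ (tgt e)
  ... | no  _ | no  _ = inj₂ (e , coord x)

  infix 4 _≈_ _≈?_

  _≈_ : Point → Point → Set
  p ≈ q = locate p ≡ locate q

  _≈?_ : ∀ p q → Dec (p ≈ q)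
  p ≈? q = ⊎-≡-dec Fin._≟_ (×-≡-dec Fin._≟_ (≡-dec _≟_)) (locate p) (locate q)

  UnboundedEnd : Point → Set
  UnboundedEnd p = ∃[ e ] len e ≡ ⊤⁺ × p ≈ on e (terminus e)

  ----------------------------------------------------------------------
  -- Divisors

  -- Finite formal sums; two of them are the same element of Div(Γ) when
  -- all their coefficients agree.
  Divisor : Set
  Divisor = List (ℤ × Point)

  sumℤ : List ℤ → ℤ
  sumℤ = foldr ℤ._+_ 0ℤ

  coeff : Divisor → Point → ℤ
  coeff D p = sumℤ (map proj₁ (filter (λ (_ , q) → q ≈? p) D))

  deg : Divisor → ℤ
  deg D = sumℤ (map proj₁ D)

  infix  4 _≐_ _∼_
  infixl 6 _⊞_ _⊟_

  _≐_ : Divisor → Divisor → Set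
  D ≐ D′ = ∀ p → coeff D p ≡ coeff D′ p

  _⊞_ _⊟_ : Divisor → Divisor → Divisor
  D ⊞ E = D ++ E
  D ⊟ E = D ++ map (λ (k , p) → ℤ.- k , p) E

  Effective : Divisor → Set
  Effective D = ∀ p → 0ℤ ℤ.≤ coeff D p

  ----------------------------------------------------------------------
  -- Rational functions

  -- The value at t of the affine function of slope s with value c at a,
  -- extended to t = ∞ by its limit.
  affine : (a c : Carrier) → ℤ → Carrier ⁺ → Carrier ±
  affine a c s          [ t ] = [ c + s · (t + - a) ]±
  affine a c (+ zero)   ⊤⁺    = [ c ]±
  affine a c (+ suc _)  ⊤⁺    = ⊤±
  affine a c (-[1+ _ ]) ⊤⁺    = ⊥±

  record Piece (f : Point → Carrier ±) (e : Edge) (x y : Position e) : Set where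
    field
      slope  : ℤ
      a c    : Carrier
      x≡a    : coord x ≡ [ a ]
      x<y    : coord x <⁺ coord y
      linear : ∀ z → coord x ≤⁺ coord z → coord z ≤⁺ coord y →
               f (on e z) ≡ affine a c slope (coord z)

  -- Pieces contain both of their ends, including ∞, so continuity within
  -- an edge is implied by `pieces`, and continuity at the vertices by
  -- `respects`.
  record RationalFunction : Set where
    field
      value    : Point → Carrier ±
      respects : ∀ {p q} → p ≈ q → value p ≡ value q
      finite   : ∀ p → ¬ UnboundedEnd p → ∃[ c ] value p ≡ [ c ]±
      pieces   : ∀ e → TransClosure (Piece value e) (origin e) (terminus e)

  -- A piece of slope s from x to y has outgoing slope s at x and - s at y.
  pieceDiv : ∀ {f e x y} → Piece f e x y → Divisor
  pieceDiv {e = e} {x} {y} P = (slope , on e x) ∷ (ℤ.- slope , on e y) ∷ []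
    where open Piece P

  piecesDiv : ∀ {f e x y} → TransClosure (Piece f e) x y → Divisor
  piecesDiv [ P ]    = pieceDiv P
  piecesDiv (P ∷ Ps) = pieceDiv P ⊞ piecesDiv Ps

  div : RationalFunction → Divisor
  div f = concat (tabulate (λ e → piecesDiv (RationalFunction.pieces f e)))

  _∼_ : Divisor → Divisor → Set
  D ∼ D′ = ∃[ f ] D ≐ D′ ⊞ div f

  ----------------------------------------------------------------------
  -- Rank

  ∣_∣ : Divisor → Divisor → Set
  ∣ D ∣ E = Effective E × E ∼ D

  IsMinimum : (ℤ → Set) → ℤ → Set
  IsMinimum P m = P m × (∀ k → P k → m ℤ.≤ k)

  IsRank : Divisor → ℤ → Set
  IsRank D r = ∃[ m ] IsMinimum Degrees m × r ≡ m ℤ.- 1ℤ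
    where
    Degrees : ℤ → Set
    Degrees k = ∃[ E ] Effective E × ¬ ∃ ∣ D ⊟ E ∣ × deg E ≡ k

------------------------------------------------------------------------
-- Presentation of the input and output to an algorithm

extended point curve divisor : Ty
extended = real ⊕ unit                        -- `inr` is ∞
point    = nat ⊕ (nat ⊗ extended)             -- vertex, or edge and position
curve    = nat ⊗ list (nat ⊗ nat ⊗ extended)  -- #vertices, (src, tgt, len) of edges
divisor  = list (int ⊗ point)

module _ {ℝ : Reals} where
  open Reals ℝ

  encodeℤ : ℤ → ⟦_⟧ ℝ int
  encodeℤ (+ n)    = inj₁ n
  encodeℤ -[1+ n ] = inj₂ n

  encodeExtended : Carrier ⁺ → ⟦_⟧ ℝ extended
  encodeExtended [ t ] = inj₁ t
  encodeExtended ⊤⁺    = inj₂ tt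

  module _ (Γ : TropicalCurve ℝ) where
    open TropicalCurve Γ

    encodeCurve : ⟦_⟧ ℝ curve
    encodeCurve =
      #vertices , tabulate (λ e → toℕ (src e) , toℕ (tgt e) , encodeExtended (len e))

    encodePoint : Point Γ → ⟦_⟧ ℝ point
    encodePoint (vertex v) = inj₁ (toℕ v)
    encodePoint (on e x)   = inj₂ (toℕ e , encodeExtended (Position.coord x))

    encodeDivisor : Divisor Γ → ⟦_⟧ ℝ divisor
    encodeDivisor = map (λ (k , p) → encodeℤ k , encodePoint p)

{-# OPTIONS --safe #-}

-- Integrating a rational function along each edge and balancing its slopes
-- at each vertex shows that a divisor G is principal if and only if a system
-- of equations in integers (one slope per edge) and reals (one height per
-- vertex) is solvable; rays impose no condition on the heights.  Cutting the
-- graph at the level sets of the heights bounds the slopes by a multiple of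
-- the total multiplicity of G, so that only finitely many slopes have to be
-- tried.  An effective divisor of degree k is a choice of k vertices or edges
-- together with k positions.  Hence, for given k, the existence of an
-- effective E of degree k such that no effective F of degree deg D - k makes
-- F - D + E principal is a finite Boolean combination, with two blocks of real
-- quantifiers, of linear inequalities.  It is decided by cylindrical
-- decomposition: the truth value depends only on the signs of finitely many
-- affine forms, and on a line these take only finitely many sign patterns, all
-- of them attained at roots, at means of two roots, or one unit beyond a root.
-- The least such k is one more than the rank.

module Submission where

open import Algebra.Bundles using (CommutativeRing)
import Algebra.Properties.CommutativeMonoid.Sum as MonoidSum
import Algebra.Properties.Ring as RingProperties
import Algebra.Properties.Semiring.Mult as SMult
import Algebra.Properties.Semiring.Sum as SemiringSum
import Algebra.Solver.Ring
open import Algebra.Solver.Ring.AlmostCommutativeRing using (_-Raw-AlmostCommutative⟶_; fromCommutativeRing)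
open import Data.Empty using (⊥-elim)
open import Data.Fin as Fin using (Fin; zero; suc; toℕ; fromℕ<)
import Data.Fin.Properties as Fin
open import Data.Integer as ℤ using (ℤ; -[1+_]; 0ℤ; 1ℤ) renaming (+_ to pos)
import Data.Integer.Properties as ℤ
open import Data.Integer.Tactic.RingSolver using (solve-∀)
open import Data.List
  using (List; []; _∷_; _++_; map; foldr; filter; length; tabulate; concat; concatMap; replicate; initLast; _∷ʳ′_)
open import Data.List.Properties
  using (filter-++; length-++; ++-assoc; ++-identityʳ; map-++; map-tabulate; length-map; length-tabulate; length-replicate)
open import Data.List.Membership.Propositional using (_∈_; find)
open import Data.List.Membership.Propositional.Properties
  using (∈-++⁺ˡ; ∈-++⁺ʳ; ∈-++⁻; ∈-map⁺; ∈-map⁻; ∈-concatMap⁺; ∈-concatMap⁻; ∈-tabulate⁺; ∈-tabulate⁻)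
open import Data.List.Relation.Unary.All as All using (All; []; _∷_)
import Data.List.Relation.Unary.All.Properties as All
open import Data.List.Relation.Unary.Any as Any using (here; there)
open import Data.Maybe using (Maybe; just; nothing)
open import Data.Nat as ℕ using (ℕ; zero; suc)
import Data.Nat.Properties as ℕ
open import Data.Product using (∃; ∃-syntax; Σ-syntax; _×_; _,_; proj₁; proj₂)
open import Data.Sum using (_⊎_; inj₁; inj₂; [_,_]′)
open import Data.Unit using (⊤; tt)
open import Function using (_∘_)
open import Relation.Binary.Construct.Closure.Transitive using (TransClosure; _∷_) renaming ([_] to [_]ᵀ)
import Relation.Binary.Construct.Add.Supremum.NonStrict as NonStrict
import Relation.Binary.Construct.Add.Supremum.Strict as Strict
import Relation.Binary.Construct.StrictToNonStrict as StrictToNonStrict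
open import Relation.Binary.Definitions using (tri<; tri≈; tri>)
open import Relation.Binary.PropositionalEquality hiding ([_])
open import Relation.Binary.Structures using (IsStrictTotalOrder)
open import Relation.Nullary using (¬_; Dec; yes; no)
open import Relation.Nullary.Construct.Add.Extrema using (_±; ⊥±; ⊤±) renaming ([_] to [_]±; [_]-injective to []±-injective)
open import Relation.Nullary.Construct.Add.Point using (≡-dec)
open import Relation.Nullary.Construct.Add.Supremum using (_⁺; ⊤⁺; [_])
open import Relation.Nullary.Decidable using (recompute; _×-dec_)
open import Defs

-- Ordered fields

-- The obstacle is the mixture of integers and reals: elimination of real quantifiers does not cover
-- a quantifier over integer slopes. A slope bound that depends on the multiplicities alone, not on
-- positions or lengths, turns that quantifier into a finite disjunction inside the real ones; once
-- the slopes are numbers, everything left is affine in heights and positions. So that positions may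
-- run over closed intervals without case distinctions, a point that reaches an end of its edge
-- keeps the edge as its place, and coinciding descriptions are shown to be interchangeable. Forms
-- are functions of system T without visible coefficients. Elimination must know where a predicate
-- can change its truth value, hence every predicate carries a finite list of forms whose signs
-- determine it, and eliminating a variable must produce such a list again. It consists of affine
-- forms because each coefficient is a constant, never a function of the remaining variables. The
-- search over degrees ends since `D - E` has negative degree as soon as the degree of `E` exceeds
-- that of `D`.

module OrderedField (ℝ : Reals) where
  open Reals ℝ public
  open CommutativeRing commutativeRing public
    using (+-assoc; +-comm; +-identityˡ; +-identityʳ; *-assoc; *-comm; *-identityˡ; *-identityʳ;
           zeroˡ; zeroʳ; -‿inverseʳ; semiring; ring)
  open IsStrictTotalOrder isStrictTotalOrder public
    using () renaming (trans to <-trans; irrefl to <-irrefl; asym to <-asym)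
  private
    module M = SMult semiring
    module RP = RingProperties ring

  -- As a ring homomorphism it lets the ring solver work with integer coefficients.
  ι : ℤ → Carrier
  ι z = z · 1#

  ι-⊖ : ∀ m n → ι (m ℤ.⊖ n) ≡ (m ℕ· 1#) + - (n ℕ· 1#)
  ι-⊖ m zero = sym (trans (cong ((m ℕ· 1#) +_) RP.-0#≈0#) (+-identityʳ _))
  ι-⊖ zero (suc n) = sym (+-identityˡ _)
  ι-⊖ (suc m) (suc n) = begin
    ι (suc m ℤ.⊖ suc n)  ≡⟨ cong ι (ℤ.[1+m]⊖[1+n]≡m⊖n m n) ⟩
    ι (m ℤ.⊖ n)  ≡⟨ ι-⊖ m n ⟩
    a + - b  ≡⟨ cong (_+ - b) (sym (+-identityʳ a)) ⟩
    (a + 0#) + - b  ≡⟨ cong (λ z → (a + z) + - b) (sym (-‿inverseʳ 1#)) ⟩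
    (a + (1# + - 1#)) + - b  ≡⟨ cong (_+ - b) (sym (+-assoc a 1# (- 1#))) ⟩
    ((a + 1#) + - 1#) + - b  ≡⟨ +-assoc _ _ _ ⟩
    (a + 1#) + (- 1# + - b)  ≡⟨ cong₂ _+_ (+-comm a 1#) (RP.-‿+-comm 1# b) ⟩
    (1# + a) + - (1# + b)  ∎
    where open ≡-Reasoning
          a = m ℕ· 1#
          b = n ℕ· 1#

  ι-+ : ∀ x y → ι (x ℤ.+ y) ≡ ι x + ι y
  ι-+ (pos m)    (pos n)    = M.×-homo-+ 1# m n
  ι-+ (pos m)    -[1+ n ] = ι-⊖ m (suc n)
  ι-+ -[1+ m ] (pos n)    = trans (ι-⊖ n (suc m)) (+-comm _ _)
  ι-+ -[1+ m ] -[1+ n ] = begin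
    - (suc (suc (m ℕ.+ n)) ℕ· 1#)  ≡⟨ cong (λ k → - (k ℕ· 1#)) (sym (ℕ.+-suc (suc m) n)) ⟩
    - ((suc m ℕ.+ suc n) ℕ· 1#)  ≡⟨ cong -_ (M.×-homo-+ 1# (suc m) (suc n)) ⟩
    - (suc m ℕ· 1# + suc n ℕ· 1#)  ≡⟨ sym (RP.-‿+-comm _ _) ⟩
    - (suc m ℕ· 1#) + - (suc n ℕ· 1#)  ∎
    where open ≡-Reasoning

  ι-neg : ∀ x → ι (ℤ.- x) ≡ - ι x
  ι-neg (pos zero)    = sym RP.-0#≈0#
  ι-neg (pos (suc n)) = refl
  ι-neg -[1+ n ]    = sym (RP.-‿involutive _)

  -- Turns the repeated addition in `affine` into a product that the ring solver understands.
  ·≡ι* : ∀ s x → s · x ≡ ι s * x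
  ·≡ι* (pos n)    x = trans (cong (n ℕ·_) (sym (*-identityˡ x))) (sym (M.×-assoc-* n 1# x))
  ·≡ι* -[1+ n ] x = trans (cong -_ (·≡ι* (pos (suc n)) x)) (RP.-‿distribˡ-* _ _)

  ι-pos* : ∀ m y → ι (pos m ℤ.* y) ≡ ι (pos m) * ι y
  ι-pos* m (pos n) = trans (cong ι (sym (ℤ.pos-* m n))) (M.×1-homo-* m n)
  ι-pos* m -[1+ n ] = begin
    ι (pos m ℤ.* -[1+ n ])  ≡⟨ cong ι (sym (ℤ.neg-distribʳ-* (pos m) (pos (suc n)))) ⟩
    ι (ℤ.- (pos m ℤ.* pos (suc n)))  ≡⟨ ι-neg (pos m ℤ.* pos (suc n)) ⟩
    - ι (pos m ℤ.* pos (suc n))  ≡⟨ cong -_ (ι-pos* m (pos (suc n))) ⟩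
    - (ι (pos m) * ι (pos (suc n)))  ≡⟨ RP.-‿distribʳ-* _ _ ⟩
    ι (pos m) * ι -[1+ n ]  ∎
    where open ≡-Reasoning

  ι-* : ∀ x y → ι (x ℤ.* y) ≡ ι x * ι y
  ι-* (pos m)  y = ι-pos* m y
  ι-* -[1+ m ] y = begin
    ι (-[1+ m ] ℤ.* y)  ≡⟨ cong ι (sym (ℤ.neg-distribˡ-* (pos (suc m)) y)) ⟩
    ι (ℤ.- (pos (suc m) ℤ.* y))  ≡⟨ ι-neg (pos (suc m) ℤ.* y) ⟩
    - ι (pos (suc m) ℤ.* y)  ≡⟨ cong -_ (ι-pos* (suc m) y) ⟩
    - (ι (pos (suc m)) * ι y)  ≡⟨ RP.-‿distribˡ-* _ _ ⟩
    ι -[1+ m ] * ι y  ∎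
    where open ≡-Reasoning

  ι-1 : ι 1ℤ ≡ 1#
  ι-1 = +-identityʳ 1#

  private
    morphism : ℤ.+-*-rawRing -Raw-AlmostCommutative⟶ fromCommutativeRing commutativeRing
    morphism = record
      { ⟦_⟧ = ι ; +-homo = ι-+ ; *-homo = ι-* ; -‿homo = ι-neg ; 0-homo = refl ; 1-homo = ι-1 }

    coeff≟ : ∀ x y → Maybe (ι x ≡ ι y)
    coeff≟ x y with x ℤ.≟ y
    ... | yes p = just (cong ι p)
    ... | no  _ = nothing

  module Solver = Algebra.Solver.Ring ℤ.+-*-rawRing (fromCommutativeRing commutativeRing) morphism coeff≟
  open Solver public using (solve; _:=_; _:+_; _:*_; :-_; _:-_; con)

  infixl 6 _-_
  _-_ : Carrier → Carrier → Carrier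
  x - y = x + - y

  -- Written exactly as `samplesᵀ` computes it, so that the two agree by definition.
  ½ : Carrier
  ½ = (1# + 1#) ⁻¹

  private
    variable
      x y z w : Carrier

  0<-sub : x < y → 0# < y - x
  0<-sub {x} {y} p = subst (_< y - x) (-‿inverseʳ x) (+-monoˡ-< (- x) p)

  sub-0< : 0# < y - x → x < y
  sub-0< {y} {x} p = subst₂ _<_ (+-identityˡ x) (solve 2 (λ x y → (y :- x) :+ x := y) refl x y) (+-monoˡ-< x p)

  0<-+ : 0# < x → 0# < y → 0# < x + y
  0<-+ {x} {y} p q = <-trans q (subst (_< x + y) (+-identityˡ y) (+-monoˡ-< y p))

  <⇒≤ : x < y → x ≤ y
  <⇒≤ = inj₁

  ≤-refl : x ≤ x
  ≤-refl = inj₂ refl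

  ≤-trans : x ≤ y → y ≤ z → x ≤ z
  ≤-trans (inj₁ p)    (inj₁ q)    = inj₁ (<-trans p q)
  ≤-trans (inj₂ refl) q           = q
  ≤-trans (inj₁ p)    (inj₂ refl) = inj₁ p

  ≤-<-trans : x ≤ y → y < z → x < z
  ≤-<-trans (inj₁ p)    q = <-trans p q
  ≤-<-trans (inj₂ refl) q = q

  <-≤-trans : x < y → y ≤ z → x < z
  <-≤-trans p (inj₁ q)    = <-trans p q
  <-≤-trans p (inj₂ refl) = p

  <⇒≱ : x < y → ¬ y ≤ x
  <⇒≱ p q = <-irrefl refl (<-≤-trans p q)

  ≮⇒≥ : ¬ x < y → y ≤ x
  ≮⇒≥ {x} {y} ¬p with compare x y
  ... | tri< p _ _ = ⊥-elim (¬p p)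
  ... | tri≈ _ q _ = inj₂ (sym q)
  ... | tri> _ _ q = inj₁ q

  ≤-antisym : x ≤ y → y ≤ x → x ≡ y
  ≤-antisym (inj₂ p) _ = p
  ≤-antisym (inj₁ p) q = ⊥-elim (<⇒≱ p q)

  _≤?_ : ∀ x y → Dec (x ≤ y)
  _≤?_ = StrictToNonStrict.decidable′ _≡_ _<_ compare

  0≤-sub : x ≤ y → 0# ≤ y - x
  0≤-sub (inj₁ p)    = inj₁ (0<-sub p)
  0≤-sub (inj₂ refl) = inj₂ (sym (-‿inverseʳ _))

  sub-0≤ : 0# ≤ y - x → x ≤ y
  sub-0≤ (inj₁ p) = inj₁ (sub-0< p)
  sub-0≤ {y} {x} (inj₂ p) = inj₂ (begin
    x  ≡⟨ solve 2 (λ x y → x := y :- (y :- x)) refl x y ⟩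
    y - (y - x)  ≡⟨ cong (λ z → y - z) (sym p) ⟩
    y - 0#  ≡⟨ solve 1 (λ y → y :- con 0ℤ := y) refl y ⟩
    y  ∎)
    where open ≡-Reasoning

  0<-+-≤ : 0# < x → 0# ≤ y → 0# < x + y
  0<-+-≤ p (inj₁ q) = 0<-+ p q
  0<-+-≤ {x} p (inj₂ refl) = subst (0# <_) (sym (+-identityʳ x)) p

  0≤-+ : 0# ≤ x → 0# ≤ y → 0# ≤ x + y
  0≤-+ (inj₁ p) q = inj₁ (0<-+-≤ p q)
  0≤-+ {y = y} (inj₂ refl) q = subst (0# ≤_) (sym (+-identityˡ y)) q

  0≤-* : 0# ≤ x → 0# ≤ y → 0# ≤ x * y
  0≤-* (inj₁ p) (inj₁ q) = inj₁ (*-pos p q)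
  0≤-* {y = y} (inj₂ refl) _ = inj₂ (sym (zeroˡ y))
  0≤-* {x} _ (inj₂ refl) = inj₂ (sym (zeroʳ x))

  <0⇒0<- : x < 0# → 0# < - x
  <0⇒0<- {x} p = subst (0# <_) (+-identityˡ (- x)) (0<-sub p)

  0<-⇒<0 : 0# < - x → x < 0#
  0<-⇒<0 {x} p = sub-0< (subst (0# <_) (sym (+-identityˡ (- x))) p)

  +-mono-≤ : x ≤ y → z ≤ w → x + z ≤ y + w
  +-mono-≤ {x} {y} {z} {w} p q = sub-0≤ (subst (0# ≤_)
    (solve 4 (λ x y z w → (y :- x) :+ (w :- z) := (y :+ w) :- (x :+ z)) refl x y z w) (0≤-+ (0≤-sub p) (0≤-sub q)))

  neg-cancel-≤ : - x ≤ - y → y ≤ x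
  neg-cancel-≤ {x} {y} p = sub-0≤ (subst (0# ≤_) (solve 2 (λ x y → :- y :- :- x := x :- y) refl x y) (0≤-sub p))

  0<1 : 0# < 1#
  0<1 with compare 0# 1#
  ... | tri< p _ _ = p
  ... | tri≈ _ q _ = ⊥-elim (0≢1 q)
  -- The solver reads `con 1ℤ` as `ι 1ℤ`, which equals `1#` only propositionally; hence the
  -- rewriting by `ι-1`.
  ... | tri> _ _ q = subst (0# <_) (trans (solve 0 ((:- con 1ℤ) :* (:- con 1ℤ) := con 1ℤ) refl) ι-1)
                       (subst (λ u → 0# < (- u) * (- u)) (sym ι-1) (*-pos (<0⇒0<- q) (<0⇒0<- q)))

  0<ι-suc : ∀ n → 0# < ι (pos (suc n))
  0<ι-suc zero    = subst (0# <_) (sym ι-1) 0<1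
  0<ι-suc (suc n) = 0<-+ 0<1 (0<ι-suc n)

  ι-mono-≤ : ∀ {i j} → i ℤ.≤ j → ι i ≤ ι j
  ι-mono-≤ {i} {j} p = sub-0≤ (subst (0# ≤_) eq (0≤ι (j ℤ.- i) (ℤ.i≤j⇒0≤j-i p)))
    where
    0≤ι : ∀ k → 0ℤ ℤ.≤ k → 0# ≤ ι k
    0≤ι (pos zero)    _ = ≤-refl
    0≤ι (pos (suc n)) _ = <⇒≤ (0<ι-suc n)
    eq : ι (j ℤ.- i) ≡ ι j - ι i
    eq = trans (ι-+ j (ℤ.- i)) (cong (λ u → ι j + u) (ι-neg i))

  ι-mono-< : ∀ {i j} → i ℤ.< j → ι i < ι j
  ι-mono-< {i} {j} p = <-≤-trans (subst₂ _<_ (+-identityˡ _) (sym (ι-+ 1ℤ i)) (+-monoˡ-< (ι i) (subst (0# <_) (sym ι-1) 0<1)))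
                         (ι-mono-≤ (ℤ.i<j⇒suc[i]≤j p))

  ι-injective : ∀ {i j} → ι i ≡ ι j → i ≡ j
  ι-injective {i} {j} p with i ℤ.≟ j
  ... | yes q = q
  ... | no i≢j with i ℤ.<? j
  ...   | yes q = ⊥-elim (<-irrefl p (ι-mono-< q))
  ...   | no ¬q = ⊥-elim (<-irrefl (sym p) (ι-mono-< (ℤ.≤∧≢⇒< (ℤ.≮⇒≥ ¬q) (i≢j ∘ sym))))

  2ᴿ≢0 : 1# + 1# ≢ 0#
  2ᴿ≢0 p = <-irrefl (sym p) (0<-+ 0<1 0<1)

  half : ∀ x → (x + x) * ½ ≡ x
  half x = begin
    (x + x) * ½  ≡⟨ cong₂ (λ u v → (u + v) * ½) (sym (*-identityʳ x)) (sym (*-identityʳ x)) ⟩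
    (x * 1# + x * 1#) * ½  ≡⟨ solve 3 (λ x u h → (x :* u :+ x :* u) :* h := x :* ((u :+ u) :* h)) refl x 1# ½ ⟩
    x * ((1# + 1#) * ½)  ≡⟨ cong (x *_) (*-inverseʳ _ 2ᴿ≢0) ⟩
    x * 1#  ≡⟨ *-identityʳ x ⟩
    x  ∎
    where open ≡-Reasoning

  0<½ : 0# < ½
  0<½ with compare 0# ½
  ... | tri< p _ _ = p
  ... | tri≈ _ q _ = ⊥-elim (0≢1 (trans (sym (zeroʳ _)) (trans (cong ((1# + 1#) *_) q) (*-inverseʳ _ 2ᴿ≢0))))
  ... | tri> _ _ q = ⊥-elim (<-asym 0<1 (0<-⇒<0 (subst (0# <_) eq (*-pos (0<-+ 0<1 0<1) (<0⇒0<- q)))))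
    where
    eq : (1# + 1#) * - ½ ≡ - 1#
    eq = trans (solve 2 (λ u h → u :* (:- h) := :- (u :* h)) refl (1# + 1#) ½) (cong -_ (*-inverseʳ _ 2ᴿ≢0))

  <-mean : x < y → x < (x + y) * ½
  <-mean {x} {y} p = sub-0< (subst (0# <_) (begin
    (y - x) * ½  ≡⟨ solve 3 (λ x y h → (y :- x) :* h := (x :+ y) :* h :- (x :+ x) :* h) refl x y ½ ⟩
    (x + y) * ½ - (x + x) * ½  ≡⟨ cong (λ u → (x + y) * ½ - u) (half x) ⟩
    (x + y) * ½ - x  ∎) (*-pos (0<-sub p) 0<½))
    where open ≡-Reasoning

  mean-< : x < y → (x + y) * ½ < y
  mean-< {x} {y} p = sub-0< (subst (0# <_) (begin
    (y - x) * ½  ≡⟨ solve 3 (λ x y h → (y :- x) :* h := (y :+ y) :* h :- (x :+ y) :* h) refl x y ½ ⟩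
    (y + y) * ½ - (x + y) * ½  ≡⟨ cong (λ u → u - (x + y) * ½) (half y) ⟩
    y - (x + y) * ½  ∎) (*-pos (0<-sub p) 0<½))
    where open ≡-Reasoning

  -- Signs of reals

  data Sign : Set where
    ⊖ ⓪ ⊕ : Sign

  sign : Carrier → Sign
  sign x with compare x 0#
  ... | tri< _ _ _ = ⊖
  ... | tri≈ _ _ _ = ⓪
  ... | tri> _ _ _ = ⊕

  sign-⊕ : 0# < x → sign x ≡ ⊕
  sign-⊕ {x} p with compare x 0#
  ... | tri< q _ _ = ⊥-elim (<-asym p q)
  ... | tri≈ _ q _ = ⊥-elim (<-irrefl (sym q) p)
  ... | tri> _ _ _ = refl

  sign-⊖ : x < 0# → sign x ≡ ⊖
  sign-⊖ {x} p with compare x 0#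
  ... | tri< _ _ _ = refl
  ... | tri≈ _ q _ = ⊥-elim (<-irrefl q p)
  ... | tri> _ _ q = ⊥-elim (<-asym p q)

  sign-⓪ : x ≡ 0# → sign x ≡ ⓪
  sign-⓪ {x} p with compare x 0#
  ... | tri< q _ _ = ⊥-elim (<-irrefl p q)
  ... | tri≈ _ _ _ = refl
  ... | tri> _ _ q = ⊥-elim (<-irrefl (sym p) q)

  data SignView (x : Carrier) : Sign → Set where
    negative : x < 0# → SignView x ⊖
    null     : x ≡ 0# → SignView x ⓪
    positive : 0# < x → SignView x ⊕

  signView : ∀ x → SignView x (sign x)
  signView x with compare x 0#
  ... | tri< p _ _ = negative p
  ... | tri≈ _ p _ = null p
  ... | tri> _ _ p = positive p

  ⊕-sign : sign x ≡ ⊕ → 0# < x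
  ⊕-sign {x} p with sign x | signView x
  ⊕-sign refl | .⊕ | positive q = q

  ⊖-sign : sign x ≡ ⊖ → x < 0#
  ⊖-sign {x} p with sign x | signView x
  ⊖-sign refl | .⊖ | negative q = q

  ⓪-sign : sign x ≡ ⓪ → x ≡ 0#
  ⓪-sign {x} p with sign x | signView x
  ⓪-sign refl | .⓪ | null q = q

  infixl 7 _·ₛ_
  _·ₛ_ : Sign → Sign → Sign
  ⓪ ·ₛ t = ⓪
  ⊕ ·ₛ t = t
  ⊖ ·ₛ ⊖ = ⊕
  ⊖ ·ₛ ⓪ = ⓪
  ⊖ ·ₛ ⊕ = ⊖

  sign-* : ∀ x y → sign (x * y) ≡ sign x ·ₛ sign y
  sign-* x y with sign x | signView x | sign y | signView y
  ... | _ | null refl  | _ | _          = sign-⓪ (zeroˡ y)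
  ... | _ | positive p | _ | positive q = sign-⊕ (*-pos p q)
  ... | _ | positive p | _ | null refl  = sign-⓪ (zeroʳ x)
  ... | _ | positive p | _ | negative q = sign-⊖ (0<-⇒<0 (subst (0# <_)
    (solve 2 (λ x y → x :* (:- y) := :- (x :* y)) refl x y) (*-pos p (<0⇒0<- q))))
  ... | _ | negative p | _ | positive q = sign-⊖ (0<-⇒<0 (subst (0# <_)
    (solve 2 (λ x y → (:- x) :* y := :- (x :* y)) refl x y) (*-pos (<0⇒0<- p) q)))
  ... | _ | negative p | _ | null refl  = sign-⓪ (zeroʳ x)
  ... | _ | negative p | _ | negative q = sign-⊕ (subst (0# <_)
    (solve 2 (λ x y → (:- x) :* (:- y) := x :* y) refl x y) (*-pos (<0⇒0<- p) (<0⇒0<- q)))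

  -- With a negated key it finds a minimum. It yields the roots nearest to a given number and the
  -- next breakpoint on an edge.
  maximum-by : ∀ {A : Set} {P : A → Set} (P? : ∀ a → Dec (P a)) (key : A → Carrier) (xs : List A) →
               (∀ a → a ∈ xs → ¬ P a) ⊎ (∃[ m ] m ∈ xs × P m × ∀ a → a ∈ xs → P a → key a ≤ key m)
  maximum-by P? key [] = inj₁ λ _ ()
  maximum-by P? key (x ∷ xs) with P? x | maximum-by P? key xs
  ... | no ¬p | inj₁ none = inj₁ λ { _ (here refl) → ¬p ; a (there a∈) → none a a∈ }
  ... | no ¬p | inj₂ (m , m∈ , q , max) =
    inj₂ (m , there m∈ , q , λ { _ (here refl) p → ⊥-elim (¬p p) ; a (there a∈) p → max a a∈ p })
  ... | yes p | inj₁ none =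
    inj₂ (x , here refl , p , λ { _ (here refl) _ → ≤-refl ; a (there a∈) q → ⊥-elim (none a a∈ q) })
  ... | yes p | inj₂ (m , m∈ , q , max) with key x ≤? key m
  ...   | yes x≤m = inj₂ (m , there m∈ , q , λ { _ (here refl) _ → x≤m ; a (there a∈) p → max a a∈ p })
  ...   | no x≰m  = inj₂ (x , here refl , p , λ
    { _ (here refl) _ → ≤-refl ; a (there a∈) p → ≤-trans (max a a∈ p) (≮⇒≥ (x≰m ∘ <⇒≤)) })

-- Deciding linear formulas by computation trees in system T

private
  variable
    Δ : List Ty
    σ τ : Ty

v0 : Term (σ ∷ Δ) σ
v0 = var (here refl)

v1 : ∀ {σ₀} → Term (σ₀ ∷ σ ∷ Δ) σ
v1 = var (there (here refl))

v2 : ∀ {σ₀ σ₁} → Term (σ₀ ∷ σ₁ ∷ σ ∷ Δ) σ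
v2 = var (there (there (here refl)))

v3 : ∀ {σ₀ σ₁ σ₂} → Term (σ₀ ∷ σ₁ ∷ σ₂ ∷ σ ∷ Δ) σ
v3 = var (there (there (there (here refl))))

v4 : ∀ {σ₀ σ₁ σ₂ σ₃} → Term (σ₀ ∷ σ₁ ∷ σ₂ ∷ σ₃ ∷ σ ∷ Δ) σ
v4 = var (there (there (there (there (here refl)))))

v5 : ∀ {σ₀ σ₁ σ₂ σ₃ σ₄} → Term (σ₀ ∷ σ₁ ∷ σ₂ ∷ σ₃ ∷ σ₄ ∷ σ ∷ Δ) σ
v5 = var (there (there (there (there (there (here refl))))))

v6 : ∀ {σ₀ σ₁ σ₂ σ₃ σ₄ σ₅} → Term (σ₀ ∷ σ₁ ∷ σ₂ ∷ σ₃ ∷ σ₄ ∷ σ₅ ∷ σ ∷ Δ) σ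
v6 = var (there (there (there (there (there (there (here refl)))))))

infixl 5 _$_
_$_ : Term Δ (σ ⇒ τ) → Term Δ σ → Term Δ τ
_$_ = app

-- An environment lists the values of the variables, the most recently bound one first. A predicate
-- pairs its decision procedure with forms whose signs determine the outcome: without them `existsᴾ`
-- would not know which points to try.
env form pred : Ty
env  = list real
form = env ⇒ real
pred = list form ⊗ (env ⇒ bool)

notᵀ : Term Δ (bool ⇒ bool)
notᵀ = lam (case v0 (inr unit) (inl unit))

andᵀ : Term Δ (bool ⇒ bool ⇒ bool)
andᵀ = lam (lam (case v1 v1 (inr unit)))

appendᵀ : Term Δ (list σ ⇒ list σ ⇒ list σ)
appendᵀ = lam (lam (fold v0 (lam (lam (cons v1 v0))) v1))

mapᵀ : Term Δ (list σ ⇒ (σ ⇒ τ) ⇒ list τ)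
mapᵀ = lam (lam (fold nil (lam (lam (cons (v2 $ v1) v0))) v1))

bindᵀ : Term Δ (list σ ⇒ (σ ⇒ list τ) ⇒ list τ)
bindᵀ = lam (lam (fold nil (lam (lam (appendᵀ $ (v2 $ v1) $ v0))) v1))

anyᵀ : Term Δ (list σ ⇒ (σ ⇒ bool) ⇒ bool)
anyᵀ = lam (lam (fold (inr unit) (lam (lam (case (v2 $ v1) (inl unit) v1))) v1))

-- For an affine form, evaluation at 0 and 1 reveals the leading coefficient. Where it is 0 the root
-- is an unspecified number; since every sample is tested, one more of them does no harm.
slopeᵀ rootᵀ : Term Δ (form ⇒ form)
slopeᵀ = lam (lam (add (v1 $ cons 1ᴿ v0) (neg (v1 $ cons 0ᴿ v0))))
rootᵀ  = lam (lam (mul (neg (v1 $ cons 0ᴿ v0)) (recip (slopeᵀ $ v1 $ v0))))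

-- Restricting to the hyperplane where the leading variable is 0 and
-- eliminating the leading variable from each pair of forms.
projectᵀ : Term Δ (list form ⇒ list form)
projectᵀ = lam (bindᵀ $ v0 $ lam (cons (lam (v1 $ cons 0ᴿ v0))
  (mapᵀ $ v1 $ lam (lam (add (mul (slopeᵀ $ v2 $ v0) (v1 $ cons 0ᴿ v0))
                             (neg (mul (slopeᵀ $ v1 $ v0) (v2 $ cons 0ᴿ v0))))))))

-- A point in each of the intervals into which the roots of the forms
-- divide the line.
samplesᵀ : Term Δ (list form ⇒ env ⇒ list real)
samplesᵀ = lam (lam (cons 0ᴿ (bindᵀ $ v1 $ lam
  (cons (add (rootᵀ $ v0 $ v1) 1ᴿ) (cons (add (rootᵀ $ v0 $ v1) (neg 1ᴿ))
    (mapᵀ $ v2 $ lam (mul (add (rootᵀ $ v1 $ v2) (rootᵀ $ v0 $ v2)) (recip (add 1ᴿ 1ᴿ)))))))))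

-- Opaque, so that the meaning of a compound formula can be computed one
-- connective at a time instead of unfolding into a single decision tree.
opaque
  nonnegᴾ zeroᴾ : Term Δ (form ⇒ pred)
  nonnegᴾ = lam (pair (cons v0 nil) (lam (notᵀ $ less (v1 $ v0) 0ᴿ)))

  trueᴾ : Term Δ pred
  trueᴾ = pair nil (lam (inl unit))

  notᴾ : Term Δ (pred ⇒ pred)
  notᴾ = lam (pair (fst v0) (lam (notᵀ $ (snd v1 $ v0))))

  andᴾ : Term Δ (pred ⇒ pred ⇒ pred)
  andᴾ = lam (lam (pair (appendᵀ $ fst v1 $ fst v0) (lam (andᵀ $ (snd v2 $ v0) $ (snd v1 $ v0)))))

  zeroᴾ = lam (andᴾ $ (nonnegᴾ $ v0) $ (nonnegᴾ $ lam (neg (v1 $ v0))))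

  allᴾ anyᴾ : Term Δ (list σ ⇒ (σ ⇒ pred) ⇒ pred)
  allᴾ = lam (lam (fold trueᴾ (lam (lam (andᴾ $ (v2 $ v1) $ v0))) v1))
  anyᴾ = lam (lam (notᴾ $ (allᴾ $ v1 $ lam (notᴾ $ (v1 $ v0)))))

  existsᴾ : Term Δ (pred ⇒ pred)
  existsᴾ = lam (pair (projectᵀ $ fst v0)
                      (lam (anyᵀ $ (samplesᵀ $ fst v1 $ v0) $ lam (snd v2 $ cons v0 v1))))

  existsⁿᴾ : Term Δ (nat ⇒ pred ⇒ pred)
  existsⁿᴾ = lam (lam (natrec v0 (lam existsᴾ) v1))

-- Correctness of the decision procedure

module Decision (ℝ : Reals) where
  open OrderedField ℝ

  Bool Env Form Pred : Set
  Bool = ⟦_⟧ ℝ bool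
  Env  = ⟦_⟧ ℝ env
  Form = ⟦_⟧ ℝ form
  Pred = ⟦_⟧ ℝ pred

  data Reflects (P : Set) : Bool → Set where
    true  : P → Reflects P (inj₁ tt)
    false : ¬ P → Reflects P (inj₂ tt)

  reflects-map : ∀ {P Q b} → (P → Q) → (Q → P) → Reflects P b → Reflects Q b
  reflects-map f g (true p)   = true (f p)
  reflects-map f g (false ¬p) = false (¬p ∘ g)

  -- Reduces the sign-invariance of a decision procedure to the equivalence of propositions.
  reflects-unique : ∀ {P b c} → Reflects P b → Reflects P c → b ≡ c
  reflects-unique (true _)   (true _)   = refl
  reflects-unique (true p)   (false ¬p) = ⊥-elim (¬p p)
  reflects-unique (false ¬p) (true p)   = ⊥-elim (¬p p)
  reflects-unique (false _)  (false _)  = refl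

  append-++ : ∀ {A : Set} (xs ys : List A) → foldr _∷_ ys xs ≡ xs ++ ys
  append-++ []       ys = refl
  append-++ (x ∷ xs) ys = cong (x ∷_) (append-++ xs ys)

  map-map : ∀ {A B : Set} (f : A → B) xs → foldr (λ x r → f x ∷ r) [] xs ≡ map f xs
  map-map f []       = refl
  map-map f (x ∷ xs) = cong (f x ∷_) (map-map f xs)

  bind-concatMap : ∀ {A B : Set} (f : A → List B) xs → foldr (λ x r → foldr _∷_ r (f x)) [] xs ≡ concatMap f xs
  bind-concatMap f []       = refl
  bind-concatMap f (x ∷ xs) = trans (append-++ (f x) _) (cong (f x ++_) (bind-concatMap f xs))

  -- A closed term that is stuck at a case distinction retains the
  -- environment in which it was evaluated; the lemmas about such terms
  -- therefore have to hold in every environment ρ.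
  not-reflects : ∀ {Δ} {ρ : All (⟦_⟧ ℝ) Δ} {P b} → Reflects P b → Reflects (¬ P) (eval ℝ notᵀ ρ b)
  not-reflects (true p)   = false (λ ¬p → ¬p p)
  not-reflects (false ¬p) = true ¬p

  and-reflects : ∀ {Δ} {ρ : All (⟦_⟧ ℝ) Δ} {P Q b c} → Reflects P b → Reflects Q c → Reflects (P × Q) (eval ℝ andᵀ ρ b c)
  and-reflects (true p)   (true q)   = true (p , q)
  and-reflects (true _)   (false ¬q) = false (¬q ∘ proj₂)
  and-reflects (false ¬p) _          = false (¬p ∘ proj₁)

  any-reflects : ∀ {Δ} {ρ : All (⟦_⟧ ℝ) Δ} σ (xs : List (⟦_⟧ ℝ σ)) {f : ⟦_⟧ ℝ σ → Bool} {P : ⟦_⟧ ℝ σ → Set} →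
                 (∀ x → Reflects (P x) (f x)) → Reflects (∃[ x ] x ∈ xs × P x) (eval ℝ (anyᵀ {σ = σ}) ρ xs f)
  any-reflects {Δ} {ρ} σ xs {f} {P} h = go xs
    where
    go : ∀ ys → Reflects (∃[ x ] x ∈ ys × P x)
           (foldr (eval ℝ {(σ ⇒ bool) ∷ list σ ∷ Δ} {σ ⇒ bool ⇒ bool} (lam (lam (case (v2 $ v1) (inl unit) v1))) (f ∷ xs ∷ ρ)) (inj₂ tt) ys)
    go [] = false λ ()
    go (x ∷ ys) with f x | h x
    ... | _ | true p   = true (x , here refl , p)
    ... | _ | false ¬p = reflects-map (λ (y , y∈ , q) → y , there y∈ , q)
                           (λ { (y , here refl , q) → ⊥-elim (¬p q) ; (y , there y∈ , q) → y , y∈ , q })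
                           (go ys)

  -- Elimination of one real variable

  slope root : Form → Form
  slope = eval ℝ slopeᵀ []
  root  = eval ℝ rootᵀ []

  project : List Form → List Form
  project = eval ℝ projectᵀ []

  samples : List Form → Env → List Carrier
  samples = eval ℝ samplesᵀ []

  -- The difference of the two roots multiplied by both slopes: it orders the roots without a
  -- division.
  resultant : Form → Form → Form
  resultant f g y = slope f y * g (0# ∷ y) - slope g y * f (0# ∷ y)

  project-concatMap : ∀ L → project L ≡ concatMap (λ f → (λ y → f (0# ∷ y)) ∷ map (resultant f) L) L
  project-concatMap L = trans (bind-concatMap _ L) (cong concat (eq L))
    where
    eq : ∀ M → map (λ f → (λ y → f (0# ∷ y)) ∷ foldr (λ g r → resultant f g ∷ r) [] L) M
             ≡ map (λ f → (λ y → f (0# ∷ y)) ∷ map (resultant f) L) M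
    eq []      = refl
    eq (f ∷ M) = cong₂ _∷_ (cong ((λ y → f (0# ∷ y)) ∷_) (map-map (resultant f) L)) (eq M)

  restrict∈project : ∀ {f L} → f ∈ L → (λ y → f (0# ∷ y)) ∈ project L
  restrict∈project {L = L} f∈ = subst (_ ∈_) (sym (project-concatMap L))
    (∈-concatMap⁺ _ (Any.map (λ { refl → here refl }) f∈))

  resultant∈project : ∀ {f g L} → f ∈ L → g ∈ L → resultant f g ∈ project L
  resultant∈project {L = L} f∈ g∈ = subst (_ ∈_) (sym (project-concatMap L))
    (∈-concatMap⁺ _ (Any.map (λ { refl → there (∈-map⁺ _ g∈) }) f∈))

  ∈project⁻ : ∀ {h L} → h ∈ project L →
              (∃[ f ] f ∈ L × h ≡ (λ y → f (0# ∷ y))) ⊎ (∃[ f ] ∃[ g ] f ∈ L × g ∈ L × h ≡ resultant f g)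
  ∈project⁻ {h} {L} h∈ with find (∈-concatMap⁻ _ {xs = L} (subst (h ∈_) (project-concatMap L) h∈))
  ... | f , f∈ , here refl = inj₁ (f , f∈ , refl)
  ... | f , f∈ , there h∈′ with ∈-map⁻ (resultant f) h∈′
  ...   | g , g∈ , refl = inj₂ (f , g , f∈ , g∈ , refl)

  sampleBlock : List Form → Env → Form → List Carrier
  sampleBlock L y f = root f y + 1# ∷ root f y - 1# ∷ map (λ g → (root f y + root g y) * ½) L

  samples-concatMap : ∀ L y → samples L y ≡ 0# ∷ concatMap (sampleBlock L y) L
  samples-concatMap L y = cong (0# ∷_) (trans (bind-concatMap _ L) (cong concat (eq L)))
    where
    eq : ∀ M → map (λ f → root f y + 1# ∷ root f y - 1# ∷ foldr (λ g r → (root f y + root g y) * ½ ∷ r) [] L) M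
             ≡ map (sampleBlock L y) M
    eq []      = refl
    eq (f ∷ M) = cong₂ _∷_ (cong (λ z → root f y + 1# ∷ root f y - 1# ∷ z) (map-map (λ g → (root f y + root g y) * ½) L)) (eq M)

  Sample : List Form → Env → Carrier → Set
  Sample L y x = x ∈ samples L y

  block⊆samples : ∀ {L y f x} → f ∈ L → x ∈ sampleBlock L y f → Sample L y x
  block⊆samples {L} {y} {x = x} f∈ x∈ = subst (λ xs → x ∈ xs) (sym (samples-concatMap L y))
    (there (∈-concatMap⁺ _ (Any.map (λ { refl → x∈ }) f∈)))

  -- The coefficient `a` is chosen before `y`. Slopes are therefore constants, which is what makes
  -- resultants affine again.
  Affine : ℕ → Form → Set
  Affine zero    f = ⊤
  Affine (suc n) f = (∃[ a ] ∀ x y → f (x ∷ y) ≡ f (0# ∷ y) + a * x) × Affine n (λ y → f (0# ∷ y))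

  slope-const : ∀ {f a} → (∀ x y → f (x ∷ y) ≡ f (0# ∷ y) + a * x) → ∀ y → slope f y ≡ a
  slope-const {f} {a} h y = begin
    f (1# ∷ y) - f (0# ∷ y)  ≡⟨ cong (_- f (0# ∷ y)) (h 1# y) ⟩
    (f (0# ∷ y) + a * 1#) - f (0# ∷ y)  ≡⟨ solve 2 (λ u v → (u :+ v) :- u := v) refl _ _ ⟩
    a * 1#  ≡⟨ *-identityʳ a ⟩
    a  ∎
    where open ≡-Reasoning

  ·ₛ-cancelˡ : ∀ {s t u} → s ≢ ⓪ → s ·ₛ t ≡ s ·ₛ u → t ≡ u
  ·ₛ-cancelˡ {⓪} h _ = ⊥-elim (h refl)
  ·ₛ-cancelˡ {⊕} h p = p
  ·ₛ-cancelˡ {⊖} {⊖} {⊖} h p = refl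
  ·ₛ-cancelˡ {⊖} {⓪} {⓪} h p = refl
  ·ₛ-cancelˡ {⊖} {⊕} {⊕} h p = refl

  -- Two points of the parameter space with the same signs of the projected
  -- forms see the roots in the same order.
  module _ (L : List Form) (y y′ : Env)
           (affine : ∀ {f} → f ∈ L → ∃[ a ] ∀ x y → f (x ∷ y) ≡ f (0# ∷ y) + a * x)
           (same : ∀ {g} → g ∈ project L → sign (g y) ≡ sign (g y′)) where

    private
      coefficient : ∀ {f} → f ∈ L → Carrier
      coefficient f∈ = proj₁ (affine f∈)

      HasRoot : Form → Set
      HasRoot f = slope f y ≢ 0#

      slope-y : ∀ {f} (f∈ : f ∈ L) → slope f y ≡ coefficient f∈
      slope-y {f} f∈ = slope-const {f} (proj₂ (affine f∈)) y

      slope-y′ : ∀ {f} (f∈ : f ∈ L) → slope f y′ ≡ coefficient f∈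
      slope-y′ {f} f∈ = slope-const {f} (proj₂ (affine f∈)) y′

      coefficient≢0 : ∀ {f} (f∈ : f ∈ L) → HasRoot f → coefficient f∈ ≢ 0#
      coefficient≢0 f∈ h = h ∘ trans (slope-y f∈)

      slope*root : ∀ {f} a z → slope f z ≡ a → a ≢ 0# → a * root f z ≡ - f (0# ∷ z)
      slope*root {f} a z refl a≢0 = begin
        a * (- f (0# ∷ z) * a ⁻¹)  ≡⟨ solve 3 (λ a b c → a :* (b :* c) := b :* (a :* c)) refl a _ (a ⁻¹) ⟩
        - f (0# ∷ z) * (a * a ⁻¹)  ≡⟨ cong (- f (0# ∷ z) *_) (*-inverseʳ a a≢0) ⟩
        - f (0# ∷ z) * 1#  ≡⟨ *-identityʳ _ ⟩
        - f (0# ∷ z)  ∎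
        where open ≡-Reasoning

      resultant-root : ∀ {f g} a b z → slope f z ≡ a → slope g z ≡ b → a ≢ 0# → b ≢ 0# →
                       (a * b) * (root f z - root g z) ≡ resultant f g z
      resultant-root {f} {g} a b z p q a≢0 b≢0 = begin
        (a * b) * (root f z - root g z)
          ≡⟨ solve 4 (λ a b r s → (a :* b) :* (r :- s) := b :* (a :* r) :- a :* (b :* s)) refl a b _ _ ⟩
        b * (a * root f z) - a * (b * root g z)
          ≡⟨ cong₂ (λ u v → b * u - a * v) (slope*root {f} a z p a≢0) (slope*root {g} b z q b≢0) ⟩
        b * (- f (0# ∷ z)) - a * (- g (0# ∷ z))
          ≡⟨ solve 4 (λ a b u v → b :* (:- u) :- a :* (:- v) := a :* v :- b :* u) refl a b _ _ ⟩
        a * g (0# ∷ z) - b * f (0# ∷ z)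
          ≡⟨ cong₂ (λ u v → u * g (0# ∷ z) - v * f (0# ∷ z)) (sym p) (sym q) ⟩
        resultant f g z ∎
        where open ≡-Reasoning

      sign≢⓪ : ∀ {x} → x ≢ 0# → sign x ≢ ⓪
      sign≢⓪ h p = h (⓪-sign p)

      -- The resultant is the difference of the roots times both leading coefficients. These are
      -- nonzero and the same over `y` and `y′`, so their signs cancel.
      roots-order : ∀ {f g} → f ∈ L → g ∈ L → HasRoot f → HasRoot g →
                    sign (root f y - root g y) ≡ sign (root f y′ - root g y′)
      roots-order {f} {g} f∈ g∈ hf hg = ·ₛ-cancelˡ (sign≢⓪ a≢0) (·ₛ-cancelˡ (sign≢⓪ b≢0) (begin
        sign b ·ₛ (sign a ·ₛ sign (root f y - root g y))  ≡⟨ expand y ⟩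
        sign (b * (a * (root f y - root g y)))  ≡⟨ cong sign (rearrange y) ⟩
        sign ((a * b) * (root f y - root g y))
          ≡⟨ cong sign (resultant-root {f} {g} a b y (slope-y f∈) (slope-y g∈) a≢0 b≢0) ⟩
        sign (resultant f g y)  ≡⟨ same (resultant∈project f∈ g∈) ⟩
        sign (resultant f g y′)  ≡⟨ cong sign (sym (resultant-root {f} {g} a b y′ (slope-y′ f∈) (slope-y′ g∈) a≢0 b≢0)) ⟩
        sign ((a * b) * (root f y′ - root g y′))  ≡⟨ cong sign (sym (rearrange y′)) ⟩
        sign (b * (a * (root f y′ - root g y′)))  ≡⟨ sym (expand y′) ⟩
        sign b ·ₛ (sign a ·ₛ sign (root f y′ - root g y′))  ∎))
        where
        open ≡-Reasoning
        a = coefficient f∈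
        b = coefficient g∈
        a≢0 : a ≢ 0#
        a≢0 = coefficient≢0 f∈ hf
        b≢0 : b ≢ 0#
        b≢0 = coefficient≢0 g∈ hg
        expand : ∀ z → sign b ·ₛ (sign a ·ₛ sign (root f z - root g z)) ≡ sign (b * (a * (root f z - root g z)))
        expand z = trans (cong (sign b ·ₛ_) (sym (sign-* a _))) (sym (sign-* b _))
        rearrange : ∀ z → b * (a * (root f z - root g z)) ≡ (a * b) * (root f z - root g z)
        rearrange z = solve 3 (λ a b r → b :* (a :* r) := (a :* b) :* r) refl a b _

      roots-< : ∀ {f g} → f ∈ L → g ∈ L → HasRoot f → HasRoot g → root f y < root g y → root f y′ < root g y′
      roots-< f∈ g∈ hf hg p = sub-0< (⊕-sign (trans (sym (roots-order g∈ f∈ hg hf)) (sign-⊕ (0<-sub p))))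

      roots-≤ : ∀ {f g} → f ∈ L → g ∈ L → HasRoot f → HasRoot g → root f y ≤ root g y → root f y′ ≤ root g y′
      roots-≤ f∈ g∈ hf hg p = ≮⇒≥ λ q → <⇒≱ (sub-0< (⊕-sign
        (trans (roots-order f∈ g∈ hf hg) (sign-⊕ (0<-sub q))))) p

    Aligned : Carrier → Carrier → Set
    Aligned x x′ = ∀ {f} → f ∈ L → HasRoot f → sign (x - root f y) ≡ sign (x′ - root f y′)

    private
      mean∈samples : ∀ {f g} → f ∈ L → g ∈ L → Sample L y′ ((root f y′ + root g y′) * ½)
      mean∈samples f∈ g∈ = block⊆samples f∈ (there (there (∈-map⁺ _ g∈)))

      HasRoot? : ∀ f → Dec (HasRoot f)
      HasRoot? f with slope f y ≟ 0#
      ... | yes p = no λ h → h p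
      ... | no h  = yes h

      sign-above : ∀ {u v} → v < u → sign (u - v) ≡ ⊕
      sign-above p = sign-⊕ (0<-sub p)

      sign-below : ∀ {u v} → u < v → sign (u - v) ≡ ⊖
      sign-below {u} {v} p = sign-⊖ (0<-⇒<0 (subst (0# <_) (solve 2 (λ u v → v :- u := :- (u :- v)) refl u v) (0<-sub p)))

      x<x+1 : ∀ {x} → x < x + 1#
      x<x+1 {x} = sub-0< (subst (0# <_) (solve 2 (λ x o → o := (x :+ o) :- x) refl x 1#) 0<1)

      x-1<x : ∀ {x} → x - 1# < x
      x-1<x {x} = sub-0< (subst (0# <_) (solve 2 (λ x o → o := x :- (x :- o)) refl x 1#) 0<1)

      module _ (x : Carrier) where
        Below Above At : Form → Set
        Below f = HasRoot f × root f y < x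
        Above f = HasRoot f × x < root f y
        At f    = HasRoot f × root f y ≡ x

        _×?_ : ∀ {P Q : Set} → Dec P → Dec Q → Dec (P × Q)
        yes p ×? yes q = yes (p , q)
        no ¬p ×? _     = no (¬p ∘ proj₁)
        yes _ ×? no ¬q = no (¬q ∘ proj₂)

        align : ∀ x′ → (∀ f → f ∈ L → ¬ At f) →
                (∀ f → f ∈ L → Below f → root f y′ < x′) → (∀ f → f ∈ L → Above f → x′ < root f y′) → Aligned x x′
        align x′ none below above {f} f∈ h with compare (root f y) x
        ... | tri< p _ _ = trans (sign-above p) (sym (sign-above (below f f∈ (h , p))))
        ... | tri≈ _ p _ = ⊥-elim (none f f∈ (h , p))
        ... | tri> _ _ p = trans (sign-below p) (sym (sign-below (above f f∈ (h , p))))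

    -- Either `x` is a root over `y`, and `x′` is the corresponding root over `y′`, or `x` lies in a
    -- gap between roots. A gap is determined by the greatest root below and the least root above,
    -- as far as they exist, and by `roots-order` the same roots bound the corresponding gap over
    -- `y′`.
    aligned-sample : ∀ x → ∃[ x′ ] Sample L y′ x′ × Aligned x x′
    aligned-sample x with maximum-by (λ f → _×?_ x (HasRoot? f) (root f y ≟ x)) (λ f → root f y) L
    -- The mean of a root with itself: roots need no samples of their own.
    ... | inj₂ (f , f∈ , (hf , refl) , _) = (root f y′ + root f y′) * ½ , mean∈samples f∈ f∈ , λ {g} g∈ hg →
            trans (roots-order f∈ g∈ hf hg) (cong (λ u → sign (u - root g y′)) (sym (half (root f y′))))
    ... | inj₁ none
        with maximum-by (λ f → _×?_ x (HasRoot? f) (root f y <? x)) (λ f → root f y) L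
           | maximum-by (λ f → _×?_ x (HasRoot? f) (x <? root f y)) (λ f → - root f y) L
    ... | inj₁ noLo | inj₁ noHi = 0# , here refl ,
            align x 0# none (λ f f∈ b → ⊥-elim (noLo f f∈ b)) (λ f f∈ b → ⊥-elim (noHi f f∈ b))
    ... | inj₂ (l , l∈ , (hl , l<x) , max) | inj₁ noHi =
            root l y′ + 1# , block⊆samples l∈ (here refl) ,
            align x _ none (λ f f∈ b → ≤-<-trans (roots-≤ f∈ l∈ (proj₁ b) hl (max f f∈ b)) x<x+1)
                           (λ f f∈ b → ⊥-elim (noHi f f∈ b))
    ... | inj₁ noLo | inj₂ (u , u∈ , (hu , x<u) , min) =
            root u y′ - 1# , block⊆samples u∈ (there (here refl)) ,
            align x _ none (λ f f∈ b → ⊥-elim (noLo f f∈ b))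
                           (λ f f∈ b → <-≤-trans x-1<x (roots-≤ u∈ f∈ hu (proj₁ b) (neg-cancel-≤ (min f f∈ b))))
    ... | inj₂ (l , l∈ , (hl , l<x) , max) | inj₂ (u , u∈ , (hu , x<u) , min) =
            (root l y′ + root u y′) * ½ , mean∈samples l∈ u∈ ,
            align x _ none (λ f f∈ b → ≤-<-trans (roots-≤ f∈ l∈ (proj₁ b) hl (max f f∈ b)) (<-mean l<u))
                           (λ f f∈ b → <-≤-trans (mean-< l<u) (roots-≤ u∈ f∈ hu (proj₁ b) (neg-cancel-≤ (min f f∈ b))))
      where
      l<u : root l y′ < root u y′
      l<u = roots-< l∈ u∈ hl hu (<-trans l<x x<u)

    -- A form of slope 0 does not depend on the leading variable, so its sign is that of its
    -- restriction, a projected form. Any other form is its coefficient times the difference between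
    -- the variable and its root.
    aligned⇒same : ∀ {x x′} → Aligned x x′ → ∀ {f} → f ∈ L → sign (f (x ∷ y)) ≡ sign (f (x′ ∷ y′))
    aligned⇒same {x} {x′} al {f} f∈ with slope f y ≟ 0#
    ... | yes p = trans (cong sign (flat x y)) (trans (same (restrict∈project f∈)) (cong sign (sym (flat x′ y′))))
      where
      flat : ∀ x z → f (x ∷ z) ≡ f (0# ∷ z)
      flat x z = trans (proj₂ (affine f∈) x z) (trans (cong (λ a → f (0# ∷ z) + a * x) (trans (sym (slope-y f∈)) p))
                   (solve 2 (λ u x → u :+ con 0ℤ :* x := u) refl _ x))
    ... | no h = trans (factor x y (slope-y f∈)) (trans (cong (sign a ·ₛ_) (al f∈ h)) (sym (factor x′ y′ (slope-y′ f∈))))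
      where
      a = coefficient f∈
      factor : ∀ x z → slope f z ≡ a → sign (f (x ∷ z)) ≡ sign a ·ₛ sign (x - root f z)
      factor x z p = trans (cong sign (begin
        f (x ∷ z)  ≡⟨ proj₂ (affine f∈) x z ⟩
        f (0# ∷ z) + a * x  ≡⟨ solve 2 (λ u v → u :+ v := v :- (:- u)) refl _ _ ⟩
        a * x - (- f (0# ∷ z))  ≡⟨ cong (λ u → a * x - u) (sym (slope*root {f} a z p (coefficient≢0 f∈ h))) ⟩
        a * x - a * root f z  ≡⟨ solve 3 (λ a x r → a :* x :- a :* r := a :* (x :- r)) refl a x _ ⟩
        a * (x - root f z)  ∎)) (sign-* a _)
        where open ≡-Reasoning

  -- Predicates determined by signs of affine forms

  Invariant : List Form → (Env → Bool) → Set
  Invariant L φ = ∀ y y′ → (∀ {f} → f ∈ L → sign (f y) ≡ sign (f y′)) → φ y ≡ φ y′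

  infix 3 _⊢_⇔_
  -- `reflects` is the correctness that is wanted in the end. The other two fields are the invariant
  -- that carries it through a quantifier: they supply the hypotheses of `aligned-sample` and
  -- transport the truth value along `aligned⇒same`.
  record _⊢_⇔_ (n : ℕ) (p : Pred) (P : Env → Set) : Set where
    constructor denotes
    field
      isAffine  : ∀ {f} → f ∈ proj₁ p → Affine n f
      invariant : Invariant (proj₁ p) (proj₂ p)
      reflects  : ∀ y → Reflects (P y) (proj₂ p y)

  open _⊢_⇔_ public

  opaque
    unfolding trueᴾ

    true-denotes : ∀ {Δ} {ρ : All (⟦_⟧ ℝ) Δ} {n} → n ⊢ eval ℝ trueᴾ ρ ⇔ (λ _ → ⊤)
    true-denotes = denotes (λ ()) (λ _ _ _ → refl) (λ _ → true tt)

  opaque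
    unfolding notᴾ

    not-denotes : ∀ {Δ} {ρ : All (⟦_⟧ ℝ) Δ} {n p P} → n ⊢ p ⇔ P → n ⊢ eval ℝ notᴾ ρ p ⇔ (λ y → ¬ P y)
    not-denotes d = denotes (isAffine d) (λ y y′ h → reflects-unique (not-reflects (reflects d y))
                                    (not-reflects (subst (Reflects _) (invariant d y y′ h) (reflects d y))))
                      (λ y → not-reflects (reflects d y))

  opaque
    unfolding andᴾ

    and-denotes : ∀ {Δ} {ρ : All (⟦_⟧ ℝ) Δ} {n p q P Q} → n ⊢ p ⇔ P → n ⊢ q ⇔ Q → n ⊢ eval ℝ andᴾ ρ p q ⇔ (λ y → P y × Q y)
    and-denotes {n = n} {p} {q} d e = denotes
      (λ f∈ → [ isAffine d , isAffine e ]′ (∈-++⁻ (proj₁ p) (subst (_ ∈_) (append-++ (proj₁ p) (proj₁ q)) f∈)))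
      (λ y y′ h → reflects-unique (and-reflects (reflects d y) (reflects e y)) (and-reflects
        (subst (Reflects _) (invariant d y y′ λ f∈ → h (subst (_ ∈_) (sym (append-++ (proj₁ p) (proj₁ q)))
                                                          (∈-++⁺ˡ f∈))) (reflects d y))
        (subst (Reflects _) (invariant e y y′ λ f∈ → h (subst (_ ∈_) (sym (append-++ (proj₁ p) (proj₁ q)))
                                                          (∈-++⁺ʳ (proj₁ p) f∈))) (reflects e y))))
      (λ y → and-reflects (reflects d y) (reflects e y))

  map-denotes : ∀ {n p P Q} → (∀ y → P y → Q y) → (∀ y → Q y → P y) → n ⊢ p ⇔ P → n ⊢ p ⇔ Q
  map-denotes f g d = denotes (isAffine d) (invariant d) (λ y → reflects-map (f y) (g y) (reflects d y))

  opaque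
    unfolding nonnegᴾ

    nonneg-denotes : ∀ {Δ} {ρ : All (⟦_⟧ ℝ) Δ} {n f} → Affine n f → n ⊢ eval ℝ nonnegᴾ ρ f ⇔ (λ y → 0# ≤ f y)
    nonneg-denotes {ρ = ρ} {n} {f} a = denotes (λ { (here refl) → a })
      (λ y y′ h → reflects-unique (decide y) (reflects-map (convert h) (convert (sym ∘ h)) (decide y′)))
      decide
      where
      decide : ∀ y → Reflects (0# ≤ f y) (proj₂ (eval ℝ nonnegᴾ ρ f) y)
      decide y with f y <? 0#
      ... | yes p = false (<⇒≱ p)
      ... | no ¬p = true (≮⇒≥ ¬p)
      convert : ∀ {y y′} → (∀ {g} → g ∈ f ∷ [] → sign (g y) ≡ sign (g y′)) → 0# ≤ f y′ → 0# ≤ f y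
      convert {y} h p = ≮⇒≥ λ q → <⇒≱ (⊖-sign (trans (sym (h (here refl))) (sign-⊖ q))) p

  Affine-cong : ∀ n {f g} → (∀ y → f y ≡ g y) → Affine n f → Affine n g
  Affine-cong zero    e _ = tt
  Affine-cong (suc n) e ((a , h) , r) =
    (a , λ x y → trans (sym (e (x ∷ y))) (trans (h x y) (cong (_+ a * x) (e (0# ∷ y))))) ,
    Affine-cong n (λ y → e (0# ∷ y)) r

  Affine-const : ∀ n c → Affine n (λ _ → c)
  Affine-const zero    c = tt
  Affine-const (suc n) c = (0# , λ x y → solve 2 (λ c x → c := c :+ con 0ℤ :* x) refl c x) , Affine-const n c

  Affine-+ : ∀ n {f g} → Affine n f → Affine n g → Affine n (λ y → f y + g y)
  Affine-+ zero    _ _ = tt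
  Affine-+ (suc n) ((a , h) , r) ((b , k) , s) =
    (a + b , λ x y → trans (cong₂ _+_ (h x y) (k x y))
      (solve 5 (λ u a v b x → (u :+ a :* x) :+ (v :+ b :* x) := (u :+ v) :+ (a :+ b) :* x) refl _ a _ b x)) ,
    Affine-+ n r s

  Affine-* : ∀ n c {f} → Affine n f → Affine n (λ y → c * f y)
  Affine-* zero    c _ = tt
  Affine-* (suc n) c ((a , h) , r) =
    (c * a , λ x y → trans (cong (c *_) (h x y))
      (solve 4 (λ c u a x → c :* (u :+ a :* x) := c :* u :+ (c :* a) :* x) refl c _ a x)) ,
    Affine-* n c r

  Affine-neg : ∀ n {f} → Affine n f → Affine n (λ y → - f y)
  Affine-neg n h = Affine-cong n (λ y → solve 1 (λ u → (:- con 1ℤ) :* u := :- u) refl _) (Affine-* n (- ι 1ℤ) h)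

  opaque
    unfolding zeroᴾ

    zero-denotes : ∀ {Δ} {ρ : All (⟦_⟧ ℝ) Δ} {n f} → Affine n f → n ⊢ eval ℝ zeroᴾ ρ f ⇔ (λ y → f y ≡ 0#)
    zero-denotes {n = n} {f} a = map-denotes
      (λ y (p , q) → ≤-antisym (neg-cancel-≤ (subst (_≤ - f y) (solve 0 (con 0ℤ := :- con 0ℤ) refl) q)) p)
      (λ y p → inj₂ (sym p) , inj₂ (trans (solve 0 (con 0ℤ := :- con 0ℤ) refl) (cong -_ (sym p))))
      (and-denotes (nonneg-denotes a) (nonneg-denotes (Affine-neg n a)))

  opaque
    unfolding allᴾ

    all-denotes : ∀ {Δ} {ρ : All (⟦_⟧ ℝ) Δ} {n} σ (xs : List (⟦_⟧ ℝ σ)) {p : ⟦_⟧ ℝ σ → Pred} {P : ⟦_⟧ ℝ σ → Env → Set} →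
                  (∀ x → x ∈ xs → n ⊢ p x ⇔ P x) →
                  n ⊢ eval ℝ (allᴾ {σ = σ}) ρ xs p ⇔ (λ y → ∀ x → x ∈ xs → P x y)
    all-denotes {Δ} {ρ} {n} σ xs {p} {P} h = go xs h
      where
      go : ∀ zs → (∀ x → x ∈ zs → n ⊢ p x ⇔ P x) →
           n ⊢ foldr (eval ℝ {(σ ⇒ pred) ∷ list σ ∷ Δ} {σ ⇒ pred ⇒ pred} (lam (lam (andᴾ $ (v2 $ v1) $ v0))) (p ∷ xs ∷ ρ))
                     (eval ℝ {(σ ⇒ pred) ∷ list σ ∷ Δ} trueᴾ (p ∷ xs ∷ ρ)) zs
             ⇔ (λ y → ∀ x → x ∈ zs → P x y)
      go []       h = map-denotes (λ _ _ _ ()) (λ _ _ → tt) (true-denotes {ρ = ρ})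
      go (x ∷ zs) h = map-denotes (λ { y (p , q) _ (here refl) → p ; y (p , q) z (there z∈) → q z z∈ })
        (λ y q → q x (here refl) , λ z z∈ → q z (there z∈))
        (and-denotes (h x (here refl)) (go zs λ z z∈ → h z (there z∈)))

  opaque
    unfolding anyᴾ

    -- `anyᴾ` is defined by De Morgan, so a witness has to be recovered from a negated universal
    -- statement. This is a search through a finite list whose disjuncts are decided.
    any-denotes : ∀ {Δ} {ρ : All (⟦_⟧ ℝ) Δ} {n} σ (xs : List (⟦_⟧ ℝ σ)) {p : ⟦_⟧ ℝ σ → Pred} {P : ⟦_⟧ ℝ σ → Env → Set} →
                  (∀ x → x ∈ xs → n ⊢ p x ⇔ P x) →
                  n ⊢ eval ℝ (anyᴾ {σ = σ}) ρ xs p ⇔ (λ y → ∃[ x ] x ∈ xs × P x y)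
    any-denotes {n = n} σ xs {p} {P} h = map-denotes
      (λ y ¬all → search xs (λ x∈ → reflects (h _ x∈) y) ¬all)
      (λ y (x , x∈ , q) all → all x x∈ q)
      (not-denotes (all-denotes {n = n} σ xs (λ x x∈ → not-denotes (h x x∈))))
      where
      search : ∀ {y} zs → (∀ {x} → x ∈ zs → Reflects (P x y) (proj₂ (p x) y)) →
               ¬ (∀ x → x ∈ zs → ¬ P x y) → ∃[ x ] x ∈ zs × P x y
      search []       _ ¬all = ⊥-elim (¬all λ _ ())
      search {y} (z ∷ zs) r ¬all with proj₂ (p z) y | r (here refl)
      ... | _ | true q   = z , here refl , q
      ... | _ | false ¬q with search zs (r ∘ there) (λ all → ¬all λ { _ (here refl) → ¬q ; x (there x∈) → all x x∈ })
      ...   | x , x∈ , q = x , there x∈ , q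

  opaque
    unfolding existsᴾ

    -- Everything follows from `transfer`, which moves a witness over `y` to a sample over `y′`. For
    -- `y′ = y` it says that the samples suffice; for two points with equal signs of the projected
    -- forms it gives invariance.
    exists-denotes : ∀ {Δ} {ρ : All (⟦_⟧ ℝ) Δ} {n p P} → suc n ⊢ p ⇔ P → n ⊢ eval ℝ existsᴾ ρ p ⇔ (λ y → ∃[ x ] P (x ∷ y))
    exists-denotes {Δ} {ρ} {n} {p@(L , φ)} {P} d = denotes affine′ invariant′ reflects′
      where
      affine₁ : ∀ {f} → f ∈ L → ∃[ a ] ∀ x y → f (x ∷ y) ≡ f (0# ∷ y) + a * x
      affine₁ = proj₁ ∘ isAffine d

      affine′ : ∀ {f} → f ∈ project L → Affine n f
      affine′ h∈ with ∈project⁻ {L = L} h∈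
      ... | inj₁ (f , f∈ , refl) = proj₂ (isAffine d f∈)
      ... | inj₂ (f , g , f∈ , g∈ , refl) = Affine-cong n
            (λ y → cong₂ (λ a b → a * g (0# ∷ y) - b * f (0# ∷ y))
                     (sym (slope-const {f} (proj₂ (affine₁ f∈)) y)) (sym (slope-const {g} (proj₂ (affine₁ g∈)) y)))
            (Affine-+ n (Affine-* n _ (proj₂ (isAffine d g∈))) (Affine-neg n (Affine-* n _ (proj₂ (isAffine d f∈)))))

      transfer : ∀ y y′ → (∀ {g} → g ∈ project L → sign (g y) ≡ sign (g y′)) →
                 (∃[ x ] P (x ∷ y)) → ∃[ x′ ] x′ ∈ samples L y′ × P (x′ ∷ y′)
      transfer y y′ same (x , q) with aligned-sample L y y′ affine₁ same x
      ... | x′ , x′∈ , al = x′ , x′∈ ,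
            holds (invariant d (x ∷ y) (x′ ∷ y′) (aligned⇒same L y y′ affine₁ same al)) (reflects d (x ∷ y)) (reflects d (x′ ∷ y′)) q
        where
        holds : ∀ {Q R b c} → b ≡ c → Reflects Q b → Reflects R c → Q → R
        holds refl (true _)   (true r) _ = r
        holds refl (false ¬q) _        q = ⊥-elim (¬q q)

      reflects′ : ∀ y → Reflects (∃[ x ] P (x ∷ y)) (proj₂ (eval ℝ existsᴾ ρ p) y)
      reflects′ y = reflects-map (λ (x , _ , q) → x , q) (transfer y y λ _ → refl)
                      (any-reflects real (samples L y) (λ x → reflects d (x ∷ y)))

      invariant′ : Invariant (project L) (proj₂ (eval ℝ existsᴾ ρ p))
      invariant′ y y′ same = reflects-unique (reflects′ y) (reflects-map
        (λ q → let (x , _ , r) = transfer y′ y (λ g∈ → sym (same g∈)) q in x , r)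
        (λ q → let (x , _ , r) = transfer y y′ same q in x , r) (reflects′ y′))

  opaque
    unfolding existsⁿᴾ

    -- Inner quantifiers put their variables in front, so the outermost one binds the last variable
    -- of the block; hence the induction splits `xs` at its end.
    existsⁿ-denotes : ∀ {Δ} {ρ : All (⟦_⟧ ℝ) Δ} {m} n {p P} → n ℕ.+ m ⊢ p ⇔ P →
                      m ⊢ eval ℝ existsⁿᴾ ρ n p ⇔ (λ y → ∃[ xs ] length xs ≡ n × P (xs ++ y))
    existsⁿ-denotes {Δ} {ρ} {m} n {p₀} = go n
      where
      step : ℕ → Pred → Pred
      step = eval ℝ {pred ∷ nat ∷ Δ} {nat ⇒ pred ⇒ pred} (lam existsᴾ) (p₀ ∷ n ∷ ρ)
      go : ∀ {m} k {p P} → k ℕ.+ m ⊢ p ⇔ P →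
           m ⊢ primrec ℝ {Pred} p step k ⇔ (λ y → ∃[ xs ] length xs ≡ k × P (xs ++ y))
      go zero    d = map-denotes (λ y q → [] , refl , q) (λ { y ([] , _ , q) → q }) d
      go {m} (suc k) {p} {P} d = map-denotes
        (λ { y (x , xs , refl , q) → xs ++ x ∷ [] , trans (length-++ xs) (ℕ.+-comm (length xs) 1) ,
                                     subst P (sym (++-assoc xs (x ∷ []) y)) q })
        (λ { y (xs , e , q) → split y xs e q })
        (exists-denotes (go {suc m} k (subst (λ j → j ⊢ p ⇔ P) (sym (ℕ.+-suc k m)) d)))
        where
        split : ∀ y xs → length xs ≡ suc k → P (xs ++ y) → ∃[ x ] ∃[ zs ] length zs ≡ k × P (zs ++ x ∷ y)
        split y xs e q with initLast xs
        split y .(zs ++ x ∷ []) e q | zs ∷ʳ′ x = x , zs ,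
          ℕ.suc-injective (trans (ℕ.+-comm 1 (length zs)) (trans (sym (length-++ zs)) e)) , subst P (++-assoc zs (x ∷ []) y) q

-- Divisors as systems of linear equations

module ℤSum = MonoidSum ℤ.+-0-commutativeMonoid
module ℤSum* = SemiringSum (CommutativeRing.semiring ℤ.+-*-commutativeRing)
open ℤSum using (sum; sum-cong-≗; ∑-distrib-+; ∑-comm)

δ : ∀ {n} → Fin n → Fin n → ℤ
δ i j with i Fin.≟ j
... | yes _ = 1ℤ
... | no  _ = 0ℤ

δ-refl : ∀ {n} (i : Fin n) → δ i i ≡ 1ℤ
δ-refl i with i Fin.≟ i
... | yes _  = refl
... | no i≢i = ⊥-elim (i≢i refl)

δ-≢ : ∀ {n} {i j : Fin n} → i ≢ j → δ i j ≡ 0ℤ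
δ-≢ {i = i} {j} i≢j with i Fin.≟ j
... | yes i≡j = ⊥-elim (i≢j i≡j)
... | no  _   = refl

sum-zero : ∀ {n} (f : Fin n → ℤ) → (∀ i → f i ≡ 0ℤ) → sum f ≡ 0ℤ
sum-zero {zero}  f h = refl
sum-zero {suc n} f h = cong₂ ℤ._+_ (h zero) (sum-zero (f ∘ suc) (h ∘ suc))

sum-single : ∀ {n} (f : Fin n → ℤ) i → (∀ j → j ≢ i → f j ≡ 0ℤ) → sum f ≡ f i
sum-single f zero    h = trans (cong (λ u → f zero ℤ.+ u) (sum-zero (f ∘ suc) λ j → h (suc j) λ ())) (ℤ.+-identityʳ _)
sum-single f (suc i) h = trans (cong₂ ℤ._+_ (h zero λ ()) (sum-single (f ∘ suc) i λ j j≢i → h (suc j) (j≢i ∘ Fin.suc-injective)))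
                           (ℤ.+-identityˡ _)

sum-δ : ∀ {n} (f : Fin n → ℤ) i → sum (λ j → f j ℤ.* δ i j) ≡ f i
sum-δ f i = trans (sum-single _ i λ j j≢i → trans (cong (λ u → f j ℤ.* u) (δ-≢ (j≢i ∘ sym))) (ℤ.*-zeroʳ (f j)))
                  (trans (cong (λ u → f i ℤ.* u) (δ-refl i)) (ℤ.*-identityʳ (f i)))

sum-nonneg : ∀ {n} (f : Fin n → ℤ) → (∀ i → 0ℤ ℤ.≤ f i) → 0ℤ ℤ.≤ sum f
sum-nonneg {zero}  f h = ℤ.≤-refl
sum-nonneg {suc n} f h = ℤ.+-mono-≤ (h zero) (sum-nonneg (f ∘ suc) (h ∘ suc))

term≤sum : ∀ {n} (f : Fin n → ℤ) → (∀ i → 0ℤ ℤ.≤ f i) → ∀ i → f i ℤ.≤ sum f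
term≤sum f h zero = subst (ℤ._≤ sum f) (ℤ.+-identityʳ (f zero)) (ℤ.+-monoʳ-≤ (f zero) (sum-nonneg (f ∘ suc) (h ∘ suc)))
term≤sum f h (suc i) = subst (ℤ._≤ sum f) (ℤ.+-identityˡ (f (suc i))) (ℤ.+-mono-≤ (h zero) (term≤sum (f ∘ suc) (h ∘ suc) i))

sum-neg : ∀ {n} (f : Fin n → ℤ) → sum (λ i → ℤ.- f i) ≡ ℤ.- sum f
sum-neg {zero}  f = refl
sum-neg {suc n} f = trans (cong (λ u → ℤ.- f zero ℤ.+ u) (sum-neg (f ∘ suc))) (sym (ℤ.neg-distrib-+ (f zero) _))

module _ {A : Set} {P : A → Set} (P? : ∀ a → Dec (P a)) where

  count≥1 : ∀ {n} (f : Fin n → A) i → P (f i) → 1 ℕ.≤ length (filter P? (tabulate f))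
  count≥1 f zero p with P? (f zero)
  ... | yes _ = ℕ.s≤s ℕ.z≤n
  ... | no ¬p = ⊥-elim (¬p p)
  count≥1 f (suc i) p with P? (f zero)
  ... | yes _ = ℕ.s≤s ℕ.z≤n
  ... | no _  = count≥1 (f ∘ suc) i p

  count≥2 : ∀ {n} (f : Fin n → A) i j → i ≢ j → P (f i) → P (f j) → 2 ℕ.≤ length (filter P? (tabulate f))
  count≥2 f zero zero i≢j p q = ⊥-elim (i≢j refl)
  count≥2 f zero (suc j) i≢j p q with P? (f zero)
  ... | yes _ = ℕ.s≤s (count≥1 (f ∘ suc) j q)
  ... | no ¬p = ⊥-elim (¬p p)
  count≥2 f (suc i) zero i≢j p q with P? (f zero)
  ... | yes _ = ℕ.s≤s (count≥1 (f ∘ suc) i p)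
  ... | no ¬p = ⊥-elim (¬p q)
  count≥2 f (suc i) (suc j) i≢j p q with P? (f zero)
  ... | yes _ = ℕ.m≤n⇒m≤1+n (count≥2 (f ∘ suc) i j (i≢j ∘ cong suc) p q)
  ... | no _  = count≥2 (f ∘ suc) i j (i≢j ∘ cong suc) p q

module Solvability {ℝ : Reals} (Γ : TropicalCurve ℝ) where
  open OrderedField ℝ
  open TropicalCurve Γ

  module _ {e : Edge} (e-infinite : len e ≡ ⊤⁺) where
    private
      v = tgt e
      #src = length (filter (Fin._≟ v) (tabulate src))
      #tgt = length (filter (Fin._≟ v) (tabulate tgt))

      valency≡ : #src ℕ.+ #tgt ≡ 1
      valency≡ = trans (sym (trans (cong length (filter-++ (Fin._≟ v) (tabulate src) (tabulate tgt))) (length-++ (filter (Fin._≟ v) (tabulate src)))))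
                       (infinite e e-infinite)

      1≤#tgt : 1 ℕ.≤ #tgt
      1≤#tgt = count≥1 (Fin._≟ v) tgt e refl

      2≰valency : ¬ 2 ℕ.≤ #src ℕ.+ #tgt
      2≰valency p = ℕ.1+n≰n (subst (2 ℕ.≤_) valency≡ p)

    -- A second half-edge at an unbounded end would raise its valency to two.
    src≢end : ∀ e′ → src e′ ≢ tgt e
    src≢end e′ p = 2≰valency (ℕ.+-mono-≤ (count≥1 (Fin._≟ v) src e′ p) 1≤#tgt)

    tgt-end : ∀ e′ → tgt e′ ≡ tgt e → e′ ≡ e
    tgt-end e′ p with e′ Fin.≟ e
    ... | yes q = q
    ... | no ¬q = ⊥-elim (2≰valency (ℕ.≤-trans (count≥2 (Fin._≟ v) tgt e′ e ¬q p refl) (ℕ.m≤n+m #tgt #src)))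

  -- The position of a location at a vertex, or on an edge of infinite
  -- length, is irrelevant.
  Location : Set
  Location = (Vertex ⊎ Edge) × Carrier

  Chain : Set
  Chain = List (ℤ × Location)

  atVertex : Vertex → Location → ℤ
  atVertex v (inj₁ u , _) = δ u v
  atVertex v (inj₂ _ , _) = 0ℤ

  onEdge : Edge → Location → ℤ
  onEdge e (inj₁ _ , _) = 0ℤ
  onEdge e (inj₂ d , _) = δ d e

  fromEnd : Carrier ⁺ → Carrier → Carrier
  fromEnd [ ℓ ] t = ℓ - t
  fromEnd ⊤⁺    t = 0#

  -- The additional rise at the far end of the edge caused by a unit increase of the slope at this
  -- position. On a ray it is 0, as heights are not constrained there.
  lever : Edge → Location → Carrier
  lever e (p , t) = ι (onEdge e (p , t)) * fromEnd (len e) t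

  ⟨_,_⟩ : (Location → ℤ) → Chain → ℤ
  ⟨ w , G ⟩ = foldr (λ (m , l) r → m ℤ.* w l ℤ.+ r) 0ℤ G

  charge : Edge → Chain → ℤ
  charge e = ⟨ onEdge e ,_⟩

  moment : Edge → Chain → Carrier
  moment e = foldr (λ (m , l) r → ι m * lever e l + r) 0#

  -- The slope at the far end of `e` is the initial slope plus the charge; seen from the target, the
  -- outgoing slope is its negative.
  outflow : (Edge → ℤ) → Chain → Vertex → ℤ
  outflow s G v = sum (λ e → δ (src e) v ℤ.* s e ℤ.- δ (tgt e) v ℤ.* (s e ℤ.+ charge e G))

  -- A slope that starts as `s` and grows by `m` at each position `t` gives the total rise `s * ℓ`
  -- plus the sum of all `m * (ℓ - t)`. For a ray, whose end may have an infinite value, the end is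
  -- by convention given the height of the other vertex.
  EdgeEquation : Edge → Carrier ⁺ → ℤ → (Vertex → Carrier) → Chain → Set
  EdgeEquation e [ ℓ ] s h G = h (tgt e) - h (src e) ≡ ι s * ℓ + moment e G
  EdgeEquation e ⊤⁺    s h G = h (tgt e) - h (src e) ≡ 0#

  -- A function h on the vertices extends to a rational function with
  -- divisor G and with initial slope s e on the edge e, not counting the
  -- contribution of points located on e at position 0.
  record Solution (G : Chain) (s : Edge → ℤ) (h : Vertex → Carrier) : Set where
    field
      edges    : ∀ e → EdgeEquation e (len e) (s e) h G
      vertices : ∀ v → outflow s G v ≡ ⟨ atVertex v , G ⟩

  Solvable : Chain → Set
  Solvable G = ∃[ s ] ∃[ h ] Solution G s h

  ⟨⟩-++ : ∀ w G H → ⟨ w , G ++ H ⟩ ≡ ⟨ w , G ⟩ ℤ.+ ⟨ w , H ⟩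
  ⟨⟩-++ w []            H = sym (ℤ.+-identityˡ _)
  ⟨⟩-++ w ((m , l) ∷ G) H = trans (cong (λ u → m ℤ.* w l ℤ.+ u) (⟨⟩-++ w G H)) (sym (ℤ.+-assoc (m ℤ.* w l) _ _))

  moment-++ : ∀ e G H → moment e (G ++ H) ≡ moment e G + moment e H
  moment-++ e []            H = sym (+-identityˡ _)
  moment-++ e ((m , l) ∷ G) H = trans (cong (λ u → ι m * lever e l + u) (moment-++ e G H)) (sym (+-assoc _ _ _))

  scale : ℤ → Chain → Chain
  scale k = map (λ (m , l) → k ℤ.* m , l)

  ⟨⟩-scale : ∀ w k G → ⟨ w , scale k G ⟩ ≡ k ℤ.* ⟨ w , G ⟩
  ⟨⟩-scale w k []            = sym (ℤ.*-zeroʳ k)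
  ⟨⟩-scale w k ((m , l) ∷ G) = trans (cong (λ u → k ℤ.* m ℤ.* w l ℤ.+ u) (⟨⟩-scale w k G)) (eq k m (w l) _)
    where
    eq : ∀ k m u r → k ℤ.* m ℤ.* u ℤ.+ k ℤ.* r ≡ k ℤ.* (m ℤ.* u ℤ.+ r)
    eq = solve-∀

  moment-scale : ∀ e k G → moment e (scale k G) ≡ ι k * moment e G
  moment-scale e k []            = sym (zeroʳ _)
  moment-scale e k ((m , l) ∷ G) = trans (cong₂ (λ a u → a * lever e l + u) (ι-* k m) (moment-scale e k G))
    (solve 4 (λ k m u r → k :* m :* u :+ k :* r := k :* (m :* u :+ r)) refl (ι k) (ι m) _ _)

  -- Solvability depends only on the charges and moments, and is a linear
  -- condition on them.
  Solvable-combine : ∀ {G H K} → (∀ e → moment e K ≡ moment e G + moment e H) →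
                     (∀ w → ⟨ w , K ⟩ ≡ ⟨ w , G ⟩ ℤ.+ ⟨ w , H ⟩) → Solvable G → Solvable H → Solvable K
  Solvable-combine {G} {H} {K} hm hc (s , h , S) (s′ , h′ , S′) =
    (λ e → s e ℤ.+ s′ e) , (λ v → h v + h′ v) , record { edges = λ e → edge e (len e) (edges S e) (edges S′ e) ; vertices = vertex′ }
    where
    open Solution
    split : ∀ a b c d → (a + b) - (c + d) ≡ (a - c) + (b - d)
    split = solve 4 (λ a b c d → (a :+ b) :- (c :+ d) := (a :- c) :+ (b :- d)) refl
    edge : ∀ e ℓ → EdgeEquation e ℓ (s e) h G → EdgeEquation e ℓ (s′ e) h′ H →
           EdgeEquation e ℓ (s e ℤ.+ s′ e) (λ v → h v + h′ v) K
    edge e [ ℓ ] p q = begin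
      (h (tgt e) + h′ (tgt e)) - (h (src e) + h′ (src e))  ≡⟨ split _ _ _ _ ⟩
      (h (tgt e) - h (src e)) + (h′ (tgt e) - h′ (src e))  ≡⟨ cong₂ _+_ p q ⟩
      (ι (s e) * ℓ + moment e G) + (ι (s′ e) * ℓ + moment e H)
        ≡⟨ solve 5 (λ a b ℓ u v → (a :* ℓ :+ u) :+ (b :* ℓ :+ v) := (a :+ b) :* ℓ :+ (u :+ v)) refl _ _ ℓ _ _ ⟩
      (ι (s e) + ι (s′ e)) * ℓ + (moment e G + moment e H)
        ≡⟨ cong₂ (λ a u → a * ℓ + u) (sym (ι-+ (s e) (s′ e))) (sym (hm e)) ⟩
      ι (s e ℤ.+ s′ e) * ℓ + moment e K  ∎
      where open ≡-Reasoning
    edge e ⊤⁺ p q = trans (split _ _ _ _) (trans (cong₂ _+_ p q) (+-identityˡ 0#))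
    vertex′ : ∀ v → outflow (λ e → s e ℤ.+ s′ e) K v ≡ ⟨ atVertex v , K ⟩
    vertex′ v = begin
      sum (λ e → δ (src e) v ℤ.* (s e ℤ.+ s′ e) ℤ.- δ (tgt e) v ℤ.* (s e ℤ.+ s′ e ℤ.+ charge e K))
        ≡⟨ sum-cong-≗ (λ e → trans (cong (λ c → δ (src e) v ℤ.* (s e ℤ.+ s′ e) ℤ.- δ (tgt e) v ℤ.* (s e ℤ.+ s′ e ℤ.+ c)) (hc (onEdge e)))
                               (eq (δ (src e) v) (δ (tgt e) v) (s e) (s′ e) (charge e G) (charge e H))) ⟩
      sum (λ e → (δ (src e) v ℤ.* s e ℤ.- δ (tgt e) v ℤ.* (s e ℤ.+ charge e G)) ℤ.+
                 (δ (src e) v ℤ.* s′ e ℤ.- δ (tgt e) v ℤ.* (s′ e ℤ.+ charge e H)))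
        ≡⟨ ∑-distrib-+ (λ e → δ (src e) v ℤ.* s e ℤ.- δ (tgt e) v ℤ.* (s e ℤ.+ charge e G)) _ ⟩
      outflow s G v ℤ.+ outflow s′ H v  ≡⟨ cong₂ ℤ._+_ (vertices S v) (vertices S′ v) ⟩
      ⟨ atVertex v , G ⟩ ℤ.+ ⟨ atVertex v , H ⟩  ≡⟨ sym (hc (atVertex v)) ⟩
      ⟨ atVertex v , K ⟩  ∎
      where
      open ≡-Reasoning
      eq : ∀ a b s s′ g h → a ℤ.* (s ℤ.+ s′) ℤ.- b ℤ.* (s ℤ.+ s′ ℤ.+ (g ℤ.+ h)) ≡
                            (a ℤ.* s ℤ.- b ℤ.* (s ℤ.+ g)) ℤ.+ (a ℤ.* s′ ℤ.- b ℤ.* (s′ ℤ.+ h))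
      eq = solve-∀

  Solvable-[] : Solvable []
  Solvable-[] = (λ _ → 0ℤ) , (λ _ → 0#) , record
    { edges    = λ e → edge e (len e)
    ; vertices = λ v → sum-zero _ λ e → eq (δ (src e) v) (δ (tgt e) v) }
    where
    edge : ∀ e ℓ → EdgeEquation e ℓ 0ℤ (λ _ → 0#) []
    edge e [ ℓ ] = solve 1 (λ ℓ → con 0ℤ :- con 0ℤ := con 0ℤ :* ℓ :+ con 0ℤ) refl ℓ
    edge e ⊤⁺    = -‿inverseʳ 0#
    eq : ∀ a b → a ℤ.* 0ℤ ℤ.- b ℤ.* (0ℤ ℤ.+ 0ℤ) ≡ 0ℤ
    eq = solve-∀

  Solvable-≗ : ∀ {G H} → (∀ e → moment e H ≡ moment e G) → (∀ w → ⟨ w , H ⟩ ≡ ⟨ w , G ⟩) → Solvable G → Solvable H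
  Solvable-≗ hm hc S = Solvable-combine (λ e → trans (hm e) (sym (+-identityʳ _)))
                         (λ w → trans (hc w) (sym (ℤ.+-identityʳ _))) S Solvable-[]

  Solvable-scale : ∀ k {G} → Solvable G → Solvable (scale k G)
  Solvable-scale k {G} (s , h , S) = (λ e → k ℤ.* s e) , (λ v → ι k * h v) , record
    { edges = λ e → edge e (len e) (edges S e) ; vertices = vertex′ }
    where
    open Solution
    edge : ∀ e ℓ → EdgeEquation e ℓ (s e) h G → EdgeEquation e ℓ (k ℤ.* s e) (λ v → ι k * h v) (scale k G)
    edge e [ ℓ ] p = begin
      ι k * h (tgt e) - ι k * h (src e)  ≡⟨ solve 3 (λ k a b → k :* a :- k :* b := k :* (a :- b)) refl (ι k) _ _ ⟩
      ι k * (h (tgt e) - h (src e))  ≡⟨ cong (ι k *_) p ⟩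
      ι k * (ι (s e) * ℓ + moment e G)
        ≡⟨ solve 4 (λ k a ℓ u → k :* (a :* ℓ :+ u) := k :* a :* ℓ :+ k :* u) refl (ι k) _ ℓ _ ⟩
      ι k * ι (s e) * ℓ + ι k * moment e G  ≡⟨ cong₂ (λ a u → a * ℓ + u) (sym (ι-* k (s e))) (sym (moment-scale e k G)) ⟩
      ι (k ℤ.* s e) * ℓ + moment e (scale k G)  ∎
      where open ≡-Reasoning
    edge e ⊤⁺ p = trans (solve 3 (λ k a b → k :* a :- k :* b := k :* (a :- b)) refl (ι k) _ _) (trans (cong (ι k *_) p) (zeroʳ _))
    vertex′ : ∀ v → outflow (λ e → k ℤ.* s e) (scale k G) v ≡ ⟨ atVertex v , scale k G ⟩
    vertex′ v = begin
      outflow (λ e → k ℤ.* s e) (scale k G) v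
        ≡⟨ sum-cong-≗ (λ e → trans (cong (λ c → δ (src e) v ℤ.* (k ℤ.* s e) ℤ.- δ (tgt e) v ℤ.* (k ℤ.* s e ℤ.+ c)) (⟨⟩-scale (onEdge e) k G))
                               (eq k (δ (src e) v) (δ (tgt e) v) (s e) (charge e G))) ⟩
      sum (λ e → k ℤ.* (δ (src e) v ℤ.* s e ℤ.- δ (tgt e) v ℤ.* (s e ℤ.+ charge e G)))
        ≡⟨ sym (ℤSum*.*-distribˡ-sum k (λ e → δ (src e) v ℤ.* s e ℤ.- δ (tgt e) v ℤ.* (s e ℤ.+ charge e G))) ⟩
      k ℤ.* outflow s G v  ≡⟨ cong (λ u → k ℤ.* u) (vertices S v) ⟩
      k ℤ.* ⟨ atVertex v , G ⟩  ≡⟨ sym (⟨⟩-scale (atVertex v) k G) ⟩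
      ⟨ atVertex v , scale k G ⟩  ∎
      where
      open ≡-Reasoning
      eq : ∀ k a b s g → a ℤ.* (k ℤ.* s) ℤ.- b ℤ.* (k ℤ.* s ℤ.+ k ℤ.* g) ≡ k ℤ.* (a ℤ.* s ℤ.- b ℤ.* (s ℤ.+ g))
      eq = solve-∀

-- Bounding the slopes

module SlopeBound {ℝ : Reals} (Γ : TropicalCurve ℝ) where
  open OrderedField ℝ
  open TropicalCurve Γ
  open Solvability Γ

  InRange : Carrier ⁺ → Carrier → Set
  InRange [ ℓ ] t = 0# ≤ t × t ≤ ℓ
  InRange ⊤⁺    t = 0# ≤ t

  Valid : Location → Set
  Valid (inj₁ _ , _) = ⊤
  Valid (inj₂ e , t) = InRange (len e) t

  absolute : Chain → Chain
  absolute = map (λ (m , l) → pos ℤ.∣ m ∣ , l)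

  mass : Chain → ℤ
  mass G = ⟨ (λ _ → 1ℤ) , absolute G ⟩

  ∣_∣≤_ : ℤ → ℤ → Set
  ∣ i ∣≤ b = ℤ.- b ℤ.≤ i × i ℤ.≤ b

  ∣⟨⟩∣≤ : ∀ (w u : Location → ℤ) → (∀ l → ∣ w l ∣≤ u l) → ∀ G → ∣ ⟨ w , G ⟩ ∣≤ ⟨ u , absolute G ⟩
  ∣⟨⟩∣≤ w u h [] = ℤ.≤-refl , ℤ.≤-refl
  ∣⟨⟩∣≤ w u h ((m , l) ∷ G) with ∣⟨⟩∣≤ w u h G | term m
    where
    term : ∀ m → ∣ m ℤ.* w l ∣≤ (pos ℤ.∣ m ∣ ℤ.* u l)
    term (pos n) = subst (ℤ._≤ pos n ℤ.* w l) (sym (ℤ.neg-distribʳ-* (pos n) (u l))) (ℤ.*-monoˡ-≤-nonNeg (pos n) (proj₁ (h l)))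
                 , ℤ.*-monoˡ-≤-nonNeg (pos n) (proj₂ (h l))
    term -[1+ n ] = subst (ℤ._≤ -[1+ n ] ℤ.* w l) (sym (ℤ.neg-distribˡ-* (pos (suc n)) (u l))) (ℤ.*-monoˡ-≤-nonPos -[1+ n ] (proj₂ (h l)))
                 , subst (-[1+ n ] ℤ.* w l ℤ.≤_) (neg*neg (pos (suc n)) (u l)) (ℤ.*-monoˡ-≤-nonPos -[1+ n ] (proj₁ (h l)))
      where
      neg*neg : ∀ a b → ℤ.- a ℤ.* ℤ.- b ≡ a ℤ.* b
      neg*neg = solve-∀
  ... | lo , hi | lo′ , hi′ = subst (ℤ._≤ _) (sym (ℤ.neg-distrib-+ (pos ℤ.∣ m ∣ ℤ.* u l) _)) (ℤ.+-mono-≤ lo′ lo) , ℤ.+-mono-≤ hi′ hi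

  ⟨⟩-absolute-mono : ∀ (w u : Location → ℤ) → (∀ l → w l ℤ.≤ u l) → ∀ G → ⟨ w , absolute G ⟩ ℤ.≤ ⟨ u , absolute G ⟩
  ⟨⟩-absolute-mono w u h []            = ℤ.≤-refl
  ⟨⟩-absolute-mono w u h ((m , l) ∷ G) = ℤ.+-mono-≤ (ℤ.*-monoˡ-≤-nonNeg (pos ℤ.∣ m ∣) (h l)) (⟨⟩-absolute-mono w u h G)

  sum-⟨⟩ : ∀ {n} (c : Fin n → ℤ) (w : Fin n → Location → ℤ) G →
           sum (λ i → c i ℤ.* ⟨ w i , G ⟩) ≡ ⟨ (λ l → sum (λ i → c i ℤ.* w i l)) , G ⟩
  sum-⟨⟩ c w []            = sum-zero _ λ i → ℤ.*-zeroʳ (c i)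
  sum-⟨⟩ c w ((m , l) ∷ G) = begin
    sum (λ i → c i ℤ.* (m ℤ.* w i l ℤ.+ ⟨ w i , G ⟩))
      ≡⟨ sum-cong-≗ (λ i → eq (c i) m (w i l) _) ⟩
    sum (λ i → m ℤ.* (c i ℤ.* w i l) ℤ.+ c i ℤ.* ⟨ w i , G ⟩)
      ≡⟨ ∑-distrib-+ (λ i → m ℤ.* (c i ℤ.* w i l)) _ ⟩
    sum (λ i → m ℤ.* (c i ℤ.* w i l)) ℤ.+ sum (λ i → c i ℤ.* ⟨ w i , G ⟩)
      ≡⟨ cong₂ ℤ._+_ (sym (ℤSum*.*-distribˡ-sum m (λ i → c i ℤ.* w i l))) (sum-⟨⟩ c w G) ⟩
    m ℤ.* sum (λ i → c i ℤ.* w i l) ℤ.+ _ ∎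
    where
    open ≡-Reasoning
    eq : ∀ c m w r → c ℤ.* (m ℤ.* w ℤ.+ r) ≡ m ℤ.* (c ℤ.* w) ℤ.+ c ℤ.* r
    eq = solve-∀

  0≤δ : ∀ {n} (i j : Fin n) → 0ℤ ℤ.≤ δ i j
  0≤δ i j with i Fin.≟ j
  ... | yes _ = ℤ.+≤+ ℕ.z≤n
  ... | no  _ = ℤ.≤-refl

  δ≤1 : ∀ {n} (i j : Fin n) → δ i j ℤ.≤ 1ℤ
  δ≤1 i j with i Fin.≟ j
  ... | yes _ = ℤ.≤-refl
  ... | no  _ = ℤ.+≤+ ℕ.z≤n

  0≤onEdge : ∀ e l → 0ℤ ℤ.≤ onEdge e l
  0≤onEdge e (inj₁ _ , _) = ℤ.≤-refl
  0≤onEdge e (inj₂ d , _) = 0≤δ d e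

  ∣i∣≤i : ∀ {i} → 0ℤ ℤ.≤ i → ∣ i ∣≤ i
  ∣i∣≤i p = ℤ.≤-trans (ℤ.neg-mono-≤ p) p , ℤ.≤-refl

  module _ (G : Chain) (s : Edge → ℤ) (h : Vertex → Carrier) (S : Solution G s h) where
    open Solution S

    through : (Vertex → ℤ) → Edge → ℤ
    through w e = w (src e) ℤ.* s e ℤ.- w (tgt e) ℤ.* (s e ℤ.+ charge e G)

    -- Summation by parts: weight the vertex equations by `w` and exchange the sums. If `w` is the
    -- indicator of a set of vertices, the left side is the net flow out of that set.
    sum-through : ∀ w → sum (through w) ≡ sum (λ v → w v ℤ.* ⟨ atVertex v , G ⟩)
    sum-through w = sym (begin
      sum (λ v → w v ℤ.* ⟨ atVertex v , G ⟩)  ≡⟨ sum-cong-≗ (λ v → cong (λ u → w v ℤ.* u) (sym (vertices v))) ⟩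
      sum (λ v → w v ℤ.* outflow s G v)  ≡⟨ sum-cong-≗ (λ v → ℤSum*.*-distribˡ-sum (w v) (λ e → a v e)) ⟩
      sum (λ v → sum (λ e → w v ℤ.* a v e))  ≡⟨ ∑-comm (λ v e → w v ℤ.* a v e) ⟩
      sum (λ e → sum (λ v → w v ℤ.* a v e))  ≡⟨ sum-cong-≗ col ⟩
      sum (through w)  ∎)
      where
      open ≡-Reasoning
      a : Vertex → Edge → ℤ
      a v e = δ (src e) v ℤ.* s e ℤ.- δ (tgt e) v ℤ.* (s e ℤ.+ charge e G)
      eq : ∀ w a b s t → w ℤ.* (a ℤ.* s ℤ.- b ℤ.* t) ≡ (w ℤ.* a) ℤ.* s ℤ.+ (w ℤ.* b) ℤ.* ℤ.- t
      eq = solve-∀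
      eq′ : ∀ a s b t → a ℤ.* s ℤ.+ b ℤ.* ℤ.- t ≡ a ℤ.* s ℤ.- b ℤ.* t
      eq′ = solve-∀
      col : ∀ e → sum (λ v → w v ℤ.* a v e) ≡ through w e
      col e = begin
        sum (λ v → w v ℤ.* a v e)
          ≡⟨ sum-cong-≗ (λ v → eq (w v) (δ (src e) v) (δ (tgt e) v) (s e) (s e ℤ.+ charge e G)) ⟩
        sum (λ v → (w v ℤ.* δ (src e) v) ℤ.* s e ℤ.+ (w v ℤ.* δ (tgt e) v) ℤ.* ℤ.- (s e ℤ.+ charge e G))
          ≡⟨ ∑-distrib-+ (λ v → (w v ℤ.* δ (src e) v) ℤ.* s e) _ ⟩
        sum (λ v → (w v ℤ.* δ (src e) v) ℤ.* s e) ℤ.+ sum (λ v → (w v ℤ.* δ (tgt e) v) ℤ.* ℤ.- (s e ℤ.+ charge e G))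
          ≡⟨ sym (cong₂ ℤ._+_ (ℤSum*.*-distribʳ-sum (s e) (λ v → w v ℤ.* δ (src e) v)) (ℤSum*.*-distribʳ-sum (ℤ.- (s e ℤ.+ charge e G)) (λ v → w v ℤ.* δ (tgt e) v))) ⟩
        sum (λ v → w v ℤ.* δ (src e) v) ℤ.* s e ℤ.+ sum (λ v → w v ℤ.* δ (tgt e) v) ℤ.* ℤ.- (s e ℤ.+ charge e G)
          ≡⟨ cong₂ (λ a b → a ℤ.* s e ℤ.+ b ℤ.* ℤ.- (s e ℤ.+ charge e G)) (sum-δ w (src e)) (sum-δ w (tgt e)) ⟩
        w (src e) ℤ.* s e ℤ.+ w (tgt e) ℤ.* ℤ.- (s e ℤ.+ charge e G)
          ≡⟨ eq′ (w (src e)) (s e) (w (tgt e)) (s e ℤ.+ charge e G) ⟩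
        through w e ∎

  module _ (G : Chain) (valid : All (Valid ∘ proj₂) G) (s : Edge → ℤ) (h : Vertex → Carrier) (S : Solution G s h) where
    open Solution S

    private
      flow : (Vertex → ℤ) → Edge → ℤ
      flow = through G s h S

      W : ℤ
      W = mass G

      C : Edge → ℤ
      C e = ⟨ onEdge e , absolute G ⟩

      ∣charge∣≤C : ∀ e → ∣ charge e G ∣≤ C e
      ∣charge∣≤C e = ∣⟨⟩∣≤ (onEdge e) (onEdge e) (λ l → ∣i∣≤i (0≤onEdge e l)) G

      0≤C : ∀ e → 0ℤ ℤ.≤ C e
      0≤C e = subst (ℤ._≤ C e) (zeros G) (⟨⟩-absolute-mono (λ _ → 0ℤ) (onEdge e) (0≤onEdge e) G)
        where
        zeros : ∀ G → ⟨ (λ _ → 0ℤ) , absolute G ⟩ ≡ 0ℤ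
        zeros []            = refl
        zeros ((m , _) ∷ G) = cong₂ ℤ._+_ (ℤ.*-zeroʳ (pos ℤ.∣ m ∣)) (zeros G)

      sumC≤W : sum C ℤ.≤ W
      sumC≤W = subst (ℤ._≤ W) (trans (sym (sum-⟨⟩ (λ _ → 1ℤ) onEdge (absolute G))) (sum-cong-≗ λ e → ℤ.*-identityˡ (C e)))
                 (⟨⟩-absolute-mono _ (λ _ → 1ℤ) bound G)
        where
        bound : ∀ l → sum (λ e → 1ℤ ℤ.* onEdge e l) ℤ.≤ 1ℤ
        bound (inj₁ v , t) = subst (ℤ._≤ 1ℤ) (sym (sum-zero (λ e → 1ℤ ℤ.* onEdge e (inj₁ v , t)) λ _ → refl)) (ℤ.+≤+ ℕ.z≤n)
        bound (inj₂ d , _) = ℤ.≤-reflexive (sum-δ (λ _ → 1ℤ) d)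

      C≤W : ∀ e → C e ℤ.≤ W
      C≤W e = ℤ.≤-trans (term≤sum C 0≤C e) sumC≤W

      Weight : (Vertex → ℤ) → Set
      Weight w = ∀ v → 0ℤ ℤ.≤ w v × w v ℤ.≤ 1ℤ

      sum-through-bound : ∀ w → Weight w → ∣ sum (flow w) ∣≤ W
      sum-through-bound w h01 = subst (∣_∣≤ W) (sym (trans (sum-through G s h S w) (sum-⟨⟩ w atVertex G)))
                                  (∣⟨⟩∣≤ _ (λ _ → 1ℤ) bound G)
        where
        bound : ∀ l → ∣ sum (λ v → w v ℤ.* atVertex v l) ∣≤ 1ℤ
        bound (inj₁ u , _) = subst (∣_∣≤ 1ℤ) (sym (sum-δ w u)) (ℤ.≤-trans ℤ.-≤+ (proj₁ (h01 u)) , proj₂ (h01 u))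
        bound (inj₂ _ , _) = subst (∣_∣≤ 1ℤ) (sym (sum-zero _ λ v → ℤ.*-zeroʳ (w v))) (ℤ.-≤+ , ℤ.+≤+ ℕ.z≤n)

      2ℤ 3ℤ 4ℤ : ℤ
      2ℤ = pos 2
      3ℤ = pos 3
      4ℤ = pos 4

      -- If hardly anything flows inwards through any edge of a cut, then
      -- little flows outwards through each of them.
      cut : ∀ w → Weight w → (∀ e → flow w e ℤ.≤ 2ℤ ℤ.* C e) → ∀ e → ℤ.- (3ℤ ℤ.* W) ℤ.≤ flow w e
      cut w h01 hi e = begin
        ℤ.- (3ℤ ℤ.* W)  ≡⟨ eq₁ W ⟩
        ℤ.- (2ℤ ℤ.* W ℤ.+ W)
          ≤⟨ ℤ.neg-mono-≤ (ℤ.+-monoʳ-≤ (2ℤ ℤ.* W) (ℤ.neg-cancel-≤ (ℤ.≤-trans (proj₁ (sum-through-bound w h01)) (ℤ.≤-reflexive (sym (ℤ.neg-involutive _)))))) ⟩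
        ℤ.- (2ℤ ℤ.* W ℤ.+ ℤ.- sum (flow w))
          ≤⟨ ℤ.neg-mono-≤ (ℤ.+-monoˡ-≤ (ℤ.- sum (flow w)) (ℤ.*-monoˡ-≤-nonNeg 2ℤ sumC≤W)) ⟩
        ℤ.- (2ℤ ℤ.* sum C ℤ.+ ℤ.- sum (flow w))  ≡⟨ cong ℤ.-_ (sym sum-f) ⟩
        ℤ.- sum f  ≤⟨ ℤ.neg-mono-≤ (term≤sum f (λ d → ℤ.i≤j⇒0≤j-i (hi d)) e) ⟩
        ℤ.- (2ℤ ℤ.* C e ℤ.- flow w e)  ≡⟨ eq₂ (C e) (flow w e) ⟩
        flow w e ℤ.- 2ℤ ℤ.* C e  ≤⟨ ℤ.i≤j⇒i-k≤j (2ℤ ℤ.* C e) ⦃ ℤ.nonNegative (ℤ.*-monoˡ-≤-nonNeg 2ℤ (0≤C e)) ⦄ ℤ.≤-refl ⟩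
        flow w e  ∎
        where
        open ℤ.≤-Reasoning
        -- The slack in the hypothesis is nonnegative on every edge, so one term is at most the
        -- whole sum. The latter is at most `2 W` from the charges plus `W` from the net flow; hence
        -- the factor 3.
        f : Edge → ℤ
        f d = 2ℤ ℤ.* C d ℤ.- flow w d
        sum-f : sum f ≡ 2ℤ ℤ.* sum C ℤ.+ ℤ.- sum (flow w)
        sum-f = trans (∑-distrib-+ (λ d → 2ℤ ℤ.* C d) (λ d → ℤ.- flow w d))
                  (cong₂ ℤ._+_ (sym (ℤSum*.*-distribˡ-sum 2ℤ C)) (sum-neg (flow w)))
        eq₁ : ∀ W → ℤ.- (3ℤ ℤ.* W) ≡ ℤ.- (2ℤ ℤ.* W ℤ.+ W)
        eq₁ = solve-∀
        eq₂ : ∀ c t → ℤ.- (2ℤ ℤ.* c ℤ.- t) ≡ t ℤ.- 2ℤ ℤ.* c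
        eq₂ = solve-∀

      -- Valid positions have levers between 0 and the length of the edge.
      moment-bound : ∀ e {ℓ} → len e ≡ [ ℓ ] → - (ι (C e) * ℓ) ≤ moment e G × moment e G ≤ ι (C e) * ℓ
      moment-bound e {ℓ} len≡ = go G valid
        where
        term : ∀ m q r → 0# ≤ q → q ≤ r → - (ι (pos ℤ.∣ m ∣) * r) ≤ ι m * q × ι m * q ≤ ι (pos ℤ.∣ m ∣) * r
        term (pos n) q r p p′ =
          sub-0≤ (subst (0# ≤_) (solve 3 (λ n q r → n :* q :+ n :* r := n :* q :- :- (n :* r)) refl (ι (pos n)) q r)
            (0≤-+ (0≤-* (0≤ι n) p) (0≤-* (0≤ι n) (≤-trans p p′)))) ,
          sub-0≤ (subst (0# ≤_) (solve 3 (λ n q r → n :* (r :- q) := n :* r :- n :* q) refl (ι (pos n)) q r)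
            (0≤-* (0≤ι n) (0≤-sub p′)))
          where
          0≤ι : ∀ n → 0# ≤ ι (pos n)
          0≤ι n = ι-mono-≤ {0ℤ} {pos n} (ℤ.+≤+ ℕ.z≤n)
        term -[1+ n ] q r p p′ =
          sub-0≤ (subst (0# ≤_) (solve 3 (λ n q r → n :* (r :- q) := (:- n) :* q :- :- (n :* r)) refl (ι (pos (suc n))) q r)
            (0≤-* 0≤ι (0≤-sub p′))) ,
          sub-0≤ (subst (0# ≤_) (solve 3 (λ n q r → n :* r :+ n :* q := n :* r :- (:- n) :* q) refl (ι (pos (suc n))) q r)
            (0≤-+ (0≤-* 0≤ι (≤-trans p p′)) (0≤-* 0≤ι p)))
          where
          0≤ι : 0# ≤ ι (pos (suc n))
          0≤ι = <⇒≤ (0<ι-suc n)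
        lever-bound : ∀ l → Valid l → 0# ≤ lever e l × lever e l ≤ ι (onEdge e l) * ℓ
        lever-bound (inj₁ v , t) _ = inj₂ (sym (zeroˡ _)) , inj₂ (trans (zeroˡ _) (sym (zeroˡ _)))
        lever-bound (inj₂ d , t) v with d Fin.≟ e
        ... | no _ = inj₂ (sym (zeroˡ _)) , inj₂ (trans (zeroˡ _) (sym (zeroˡ _)))
        ... | yes refl with subst (λ L → InRange L t) len≡ v
        ...   | 0≤t , t≤ℓ rewrite len≡ = 0≤-* 0≤ι1 (0≤-sub t≤ℓ) ,
                sub-0≤ (subst (0# ≤_) (solve 3 (λ i ℓ t → i :* t := i :* ℓ :- i :* (ℓ :- t)) refl (ι 1ℤ) ℓ t) (0≤-* 0≤ι1 0≤t))
          where
          0≤ι1 : 0# ≤ ι 1ℤ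
          0≤ι1 = <⇒≤ (0<ι-suc 0)
        go : ∀ G → All (Valid ∘ proj₂) G → - (ι ⟨ onEdge e , absolute G ⟩ * ℓ) ≤ moment e G × moment e G ≤ ι ⟨ onEdge e , absolute G ⟩ * ℓ
        go [] [] = inj₂ (solve 1 (λ ℓ → :- (con 0ℤ :* ℓ) := con 0ℤ) refl ℓ) , inj₂ (solve 1 (λ ℓ → con 0ℤ := con 0ℤ :* ℓ) refl ℓ)
        go ((m , l) ∷ G) (v ∷ vs) with go G vs | lever-bound l v
        ... | lo , hi | 0≤q , q≤r with term m _ _ 0≤q q≤r
        ...   | lo′ , hi′ = subst (_≤ moment e ((m , l) ∷ G)) (trans (sym (neg-+ _ _)) (cong -_ eq)) (+-mono-≤ lo′ lo) ,
                            subst (moment e ((m , l) ∷ G) ≤_) eq (+-mono-≤ hi′ hi)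
          where
          neg-+ : ∀ a b → - (a + b) ≡ - a + - b
          neg-+ = solve 2 (λ a b → :- (a :+ b) := :- a :+ :- b) refl
          eq : ι (pos ℤ.∣ m ∣) * (ι (onEdge e l) * ℓ) + ι ⟨ onEdge e , absolute G ⟩ * ℓ ≡
               ι (pos ℤ.∣ m ∣ ℤ.* onEdge e l ℤ.+ ⟨ onEdge e , absolute G ⟩) * ℓ
          eq = trans (solve 4 (λ a b c ℓ → a :* (b :* ℓ) :+ c :* ℓ := (a :* b :+ c) :* ℓ) refl (ι (pos ℤ.∣ m ∣)) _ _ ℓ)
                 (cong (_* ℓ) (sym (trans (ι-+ (pos ℤ.∣ m ∣ ℤ.* onEdge e l) _) (cong (λ u → u + ι ⟨ onEdge e , absolute G ⟩) (ι-* (pos ℤ.∣ m ∣) (onEdge e l))))))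

      length-positive : ∀ e {ℓ} → len e ≡ [ ℓ ] → 0# < ℓ
      length-positive e len≡ with len e | len-pos e
      length-positive e refl | _ | Strict.[ p ] = p

      rise≡ : ∀ e {ℓ} → len e ≡ [ ℓ ] → h (tgt e) - h (src e) ≡ ι (s e) * ℓ + moment e G
      rise≡ e len≡ = subst (λ L → EdgeEquation e L (s e) h G) len≡ (edges e)

      scaled-< : ∀ {i j ℓ} → 0# < ℓ → i ℤ.< j → ι i * ℓ < ι j * ℓ
      scaled-< {i} {j} {ℓ} 0<ℓ p = sub-0< (subst (0# <_) (solve 3 (λ i j ℓ → (j :- i) :* ℓ := j :* ℓ :- i :* ℓ) refl (ι i) (ι j) ℓ)
                                     (*-pos (0<-sub (ι-mono-< p)) 0<ℓ))

      -- The moment is at least `- (ι (C e) * ℓ)`, so an initial slope above `C e` would make the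
      -- edge rise. `rising` is the mirror image.
      falling : ∀ e {ℓ} → len e ≡ [ ℓ ] → h (tgt e) ≤ h (src e) → s e ℤ.≤ C e
      falling e {ℓ} len≡ p = ℤ.≮⇒≥ λ C<s → <⇒≱ (scaled-< (length-positive e len≡) C<s) (sub-0≤ (subst (0# ≤_)
          (trans (solve 4 (λ a b m c → (a :- b) :+ (m :- :- c) := c :- ((b :- a) :- m)) refl (h (src e)) (h (tgt e)) (moment e G) (ι (C e) * ℓ))
            (trans (cong (λ u → ι (C e) * ℓ - (u - moment e G)) (rise≡ e len≡))
              (solve 3 (λ c s m → c :- ((s :+ m) :- m) := c :- s) refl (ι (C e) * ℓ) (ι (s e) * ℓ) (moment e G))))
          (0≤-+ (0≤-sub p) (0≤-sub (proj₁ (moment-bound e len≡))))))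

      rising : ∀ e {ℓ} → len e ≡ [ ℓ ] → h (src e) ≤ h (tgt e) → ℤ.- C e ℤ.≤ s e
      rising e {ℓ} len≡ p = ℤ.≮⇒≥ λ s<-C → <⇒≱ (scaled-< (length-positive e len≡) s<-C) (sub-0≤ (subst (0# ≤_)
          (begin
            (h (tgt e) - h (src e)) + (ι (C e) * ℓ - moment e G)
              ≡⟨ cong (λ u → u + (ι (C e) * ℓ - moment e G)) (rise≡ e len≡) ⟩
            (ι (s e) * ℓ + moment e G) + (ι (C e) * ℓ - moment e G)
              ≡⟨ solve 4 (λ s c m ℓ → (s :* ℓ :+ m) :+ (c :* ℓ :- m) := s :* ℓ :- (:- c) :* ℓ) refl (ι (s e)) (ι (C e)) (moment e G) ℓ ⟩
            ι (s e) * ℓ - (- ι (C e)) * ℓ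
              ≡⟨ cong (λ u → ι (s e) * ℓ - u * ℓ) (sym (ι-neg (C e))) ⟩
            ι (s e) * ℓ - ι (ℤ.- C e) * ℓ ∎)
          (0≤-+ (0≤-sub p) (0≤-sub (proj₂ (moment-bound e len≡))))))
        where open ≡-Reasoning

      level : Carrier → Vertex → ℤ
      level θ v with θ ≤? h v
      ... | yes _ = 1ℤ
      ... | no  _ = 0ℤ

      level-weight : ∀ θ → Weight (level θ)
      level-weight θ v with θ ≤? h v
      ... | yes _ = ℤ.+≤+ ℕ.z≤n , ℤ.≤-refl
      ... | no  _ = ℤ.≤-refl , ℤ.+≤+ ℕ.z≤n

      level-1 : ∀ {θ v} → θ ≤ h v → level θ v ≡ 1ℤ
      level-1 {θ} {v} p with θ ≤? h v
      ... | yes _ = refl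
      ... | no ¬p = ⊥-elim (¬p p)

      level-0 : ∀ {θ v} → ¬ θ ≤ h v → level θ v ≡ 0ℤ
      level-0 {θ} {v} ¬p with θ ≤? h v
      ... | yes p = ⊥-elim (¬p p)
      ... | no _  = refl

      double : ∀ c → c ℤ.+ c ≡ pos 2 ℤ.* c
      double = solve-∀

      C≤2C : ∀ e → C e ℤ.≤ 2ℤ ℤ.* C e
      C≤2C e = subst₂ ℤ._≤_ (ℤ.+-identityʳ (C e)) (double (C e)) (ℤ.+-monoʳ-≤ (C e) (0≤C e))

      -charge≤C : ∀ e → ℤ.- charge e G ℤ.≤ C e
      -charge≤C e = subst (ℤ.- charge e G ℤ.≤_) (ℤ.neg-involutive (C e)) (ℤ.neg-mono-≤ (proj₁ (∣charge∣≤C e)))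

      through₁₀ : ∀ s g → 1ℤ ℤ.* s ℤ.- 0ℤ ℤ.* (s ℤ.+ g) ≡ s
      through₁₀ = solve-∀

      through₀₁ : ∀ s g → 0ℤ ℤ.* s ℤ.- 1ℤ ℤ.* (s ℤ.+ g) ≡ ℤ.- s ℤ.+ ℤ.- g
      through₀₁ = solve-∀

      through₁₁ : ∀ s g → 1ℤ ℤ.* s ℤ.- 1ℤ ℤ.* (s ℤ.+ g) ≡ ℤ.- g
      through₁₁ = solve-∀

      through₀₀ : ∀ s g → 0ℤ ℤ.* s ℤ.- 0ℤ ℤ.* (s ℤ.+ g) ≡ 0ℤ
      through₀₀ = solve-∀

      -- The purpose of the convention for rays: no level set separates the two ends of a ray.
      flat-end : ∀ e → len e ≡ ⊤⁺ → h (tgt e) ≡ h (src e)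
      flat-end e len≡ = begin
        h (tgt e)  ≡⟨ solve 2 (λ a b → a := (a :- b) :+ b) refl _ (h (src e)) ⟩
        (h (tgt e) - h (src e)) + h (src e)
          ≡⟨ cong (λ u → u + h (src e)) (subst (λ L → EdgeEquation e L (s e) h G) len≡ (edges e)) ⟩
        0# + h (src e)  ≡⟨ +-identityˡ _ ⟩
        h (src e)  ∎
        where open ≡-Reasoning

      -- A level set is crossed outwards only by an edge that falls, whose initial slope is at most
      -- `C e` by `falling`. An edge crossed inwards contributes minus its final slope, at most
      -- `C e` by `rising` plus another `C e` for the charge; hence the factor 2.
      level-through : ∀ θ e → flow (level θ) e ℤ.≤ 2ℤ ℤ.* C e
      level-through θ e with θ ≤? h (src e) | θ ≤? h (tgt e)
      ... | yes _ | yes _ = subst (ℤ._≤ 2ℤ ℤ.* C e) (sym (through₁₁ (s e) (charge e G))) (ℤ.≤-trans (-charge≤C e) (C≤2C e))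
      ... | no _  | no _  = subst (ℤ._≤ 2ℤ ℤ.* C e) (sym (through₀₀ (s e) (charge e G))) (ℤ.≤-trans (0≤C e) (C≤2C e))
      ... | yes p | no ¬q with len e in len≡
      ...   | [ ℓ ] = subst (ℤ._≤ 2ℤ ℤ.* C e) (sym (through₁₀ (s e) (charge e G)))
                        (ℤ.≤-trans (falling e len≡ (≮⇒≥ λ r → ¬q (≤-trans p (<⇒≤ r)))) (C≤2C e))
      ...   | ⊤⁺    = ⊥-elim (¬q (subst (θ ≤_) (sym (flat-end e len≡)) p))
      level-through θ e | no ¬p | yes q with len e in len≡
      ...   | [ ℓ ] = subst₂ ℤ._≤_ (sym (through₀₁ (s e) (charge e G))) (double (C e))
                        (ℤ.+-mono-≤ (subst (ℤ.- s e ℤ.≤_) (ℤ.neg-involutive (C e))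
                          (ℤ.neg-mono-≤ (rising e len≡ (≮⇒≥ λ r → ¬p (≤-trans q (<⇒≤ r)))))) (-charge≤C e))
      ...   | ⊤⁺    = ⊥-elim (¬p (subst (θ ≤_) (flat-end e len≡) q))

      0≤W : 0ℤ ℤ.≤ W
      0≤W = ℤ.≤-trans (sum-nonneg C 0≤C) sumC≤W

      ≤4W : ∀ k {i} → i ℤ.≤ pos k ℤ.* W → k ℕ.≤ 4 → i ℤ.≤ 4ℤ ℤ.* W
      ≤4W k p k≤4 = ℤ.≤-trans p (ℤ.*-monoʳ-≤-nonNeg W ⦃ ℤ.nonNegative 0≤W ⦄ (ℤ.+≤+ k≤4))

      C≤1W : ∀ e → C e ℤ.≤ 1ℤ ℤ.* W
      C≤1W e = subst (C e ℤ.≤_) (sym (ℤ.*-identityˡ W)) (C≤W e)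

      -≤ : ∀ {i b} → ℤ.- i ℤ.≤ b → ℤ.- b ℤ.≤ i
      -≤ {i} p = subst (ℤ._≤_ _) (ℤ.neg-involutive i) (ℤ.neg-mono-≤ p)

    -- On a ray the equation at the end of valency one determines the slope. On a finite edge one
    -- side of the bound is `falling` or `rising`, the other is `cut` at the level of the higher
    -- end. For a falling edge the latter bounds the initial slope by `3 W`; for a rising edge it
    -- bounds the final slope, and subtracting the charge costs the fourth `W`.
    slope-bound : ∀ e → ∣ s e ∣≤ (4ℤ ℤ.* W)
    slope-bound e with len e in len≡
    ... | ⊤⁺ = -≤ (≤4W 2 (subst (ℤ._≤ pos 2 ℤ.* W) (sym -s≡) (bound (proj₂ ∣A∣≤W) (proj₂ ∣M∣≤W))) (ℕ.s≤s (ℕ.s≤s ℕ.z≤n))) ,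
                ≤4W 2 (subst (ℤ._≤ pos 2 ℤ.* W) (sym s≡) (bound (≤- (proj₁ ∣A∣≤W)) (≤- (proj₁ ∣M∣≤W)))) (ℕ.s≤s (ℕ.s≤s ℕ.z≤n))
      where
      A M : ℤ
      A = ⟨ atVertex (tgt e) , G ⟩
      M = charge e G
      ≤- : ∀ {i b} → ℤ.- b ℤ.≤ i → ℤ.- i ℤ.≤ b
      ≤- {b = b} p = subst (ℤ._≤_ _) (ℤ.neg-involutive b) (ℤ.neg-mono-≤ p)
      ∣M∣≤W : ∣ M ∣≤ W
      ∣M∣≤W = ℤ.≤-trans (ℤ.neg-mono-≤ (C≤W e)) (proj₁ (∣charge∣≤C e)) , ℤ.≤-trans (proj₂ (∣charge∣≤C e)) (C≤W e)
      ∣A∣≤W : ∣ A ∣≤ W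
      ∣A∣≤W = ∣⟨⟩∣≤ (atVertex (tgt e)) (λ _ → 1ℤ) (λ { (inj₁ u , _) → ℤ.≤-trans ℤ.-≤+ (0≤δ u (tgt e)) , δ≤1 u (tgt e)
                                                     ; (inj₂ _ , _) → ℤ.-≤+ , ℤ.+≤+ ℕ.z≤n }) G
      bound : ∀ {i j} → i ℤ.≤ W → j ℤ.≤ W → i ℤ.+ j ℤ.≤ pos 2 ℤ.* W
      bound p q = subst (ℤ._≤_ _) (double W) (ℤ.+-mono-≤ p q)
      A≡ : A ≡ ℤ.- s e ℤ.+ ℤ.- M
      A≡ = begin
        A  ≡⟨ sym (vertices (tgt e)) ⟩
        outflow s G (tgt e)  ≡⟨ sum-single _ e other ⟩
        δ (src e) (tgt e) ℤ.* s e ℤ.- δ (tgt e) (tgt e) ℤ.* (s e ℤ.+ M)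
          ≡⟨ cong₂ (λ a b → a ℤ.* s e ℤ.- b ℤ.* (s e ℤ.+ M)) (δ-≢ (src≢end len≡ e)) (δ-refl (tgt e)) ⟩
        0ℤ ℤ.* s e ℤ.- 1ℤ ℤ.* (s e ℤ.+ M)  ≡⟨ through₀₁ (s e) M ⟩
        ℤ.- s e ℤ.+ ℤ.- M  ∎
        where
        open ≡-Reasoning
        other : ∀ d → d ≢ e → δ (src d) (tgt e) ℤ.* s d ℤ.- δ (tgt d) (tgt e) ℤ.* (s d ℤ.+ charge d G) ≡ 0ℤ
        other d d≢e = trans (cong₂ (λ a b → a ℤ.* s d ℤ.- b ℤ.* (s d ℤ.+ charge d G)) (δ-≢ (src≢end len≡ d)) (δ-≢ (d≢e ∘ tgt-end len≡ d)))
                        (through₀₀ (s d) (charge d G))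
      -s≡ : ℤ.- s e ≡ A ℤ.+ M
      -s≡ = trans (eq (s e) M) (cong (ℤ._+ M) (sym A≡))
        where
        eq : ∀ s m → ℤ.- s ≡ (ℤ.- s ℤ.+ ℤ.- m) ℤ.+ m
        eq = solve-∀
      s≡ : s e ≡ ℤ.- A ℤ.+ ℤ.- M
      s≡ = trans (sym (ℤ.neg-involutive (s e))) (trans (cong ℤ.-_ -s≡) (ℤ.neg-distrib-+ A M))
    ... | [ ℓ ] with compare (h (src e)) (h (tgt e))
    ...   | tri≈ _ p _ = -≤ (≤4W 1 (ℤ.≤-trans (subst (ℤ.- s e ℤ.≤_) (ℤ.neg-involutive (C e)) (ℤ.neg-mono-≤ (rising e len≡ (inj₂ p)))) (C≤1W e)) (ℕ.s≤s ℕ.z≤n)) ,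
                         ≤4W 1 (ℤ.≤-trans (falling e len≡ (inj₂ (sym p))) (C≤1W e)) (ℕ.s≤s ℕ.z≤n)
    ...   | tri> _ _ p = -≤ (≤4W 3 (subst (ℤ._≤_ _) (ℤ.neg-involutive (3ℤ ℤ.* W)) (ℤ.neg-mono-≤ lower)) (ℕ.s≤s (ℕ.s≤s (ℕ.s≤s ℕ.z≤n)))) ,
                         ≤4W 1 (ℤ.≤-trans (falling e len≡ (<⇒≤ p)) (C≤1W e)) (ℕ.s≤s ℕ.z≤n)
      where
      θ : Carrier
      θ = h (src e)
      lower : ℤ.- (3ℤ ℤ.* W) ℤ.≤ s e
      lower = subst (ℤ.- (3ℤ ℤ.* W) ℤ.≤_)
        (trans (cong₂ (λ a b → a ℤ.* s e ℤ.- b ℤ.* (s e ℤ.+ charge e G)) (level-1 ≤-refl) (level-0 (<⇒≱ p))) (through₁₀ (s e) (charge e G)))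
        (cut (level θ) (level-weight θ) (level-through θ) e)
    slope-bound e | [ ℓ ] | tri< p _ _ =
      -≤ (≤4W 1 (ℤ.≤-trans (subst (ℤ.- s e ℤ.≤_) (ℤ.neg-involutive (C e)) (ℤ.neg-mono-≤ (rising e len≡ (<⇒≤ p)))) (C≤1W e)) (ℕ.s≤s ℕ.z≤n)) ,
      subst₂ ℤ._≤_ (eq₁ (s e) (charge e G)) (eq₂ W) (ℤ.+-mono-≤ upper (ℤ.≤-trans (-charge≤C e) (C≤W e)))
      where
      θ : Carrier
      θ = h (tgt e)
      eq₁ : ∀ s g → s ℤ.+ g ℤ.+ ℤ.- g ≡ s
      eq₁ = solve-∀
      eq₂ : ∀ w → pos 3 ℤ.* w ℤ.+ w ≡ pos 4 ℤ.* w
      eq₂ = solve-∀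
      eq₃ : ∀ s g → ℤ.- (ℤ.- s ℤ.+ ℤ.- g) ≡ s ℤ.+ g
      eq₃ = solve-∀
      upper : s e ℤ.+ charge e G ℤ.≤ 3ℤ ℤ.* W
      upper = subst₂ ℤ._≤_
        (trans (cong ℤ.-_ (trans (cong₂ (λ a b → a ℤ.* s e ℤ.- b ℤ.* (s e ℤ.+ charge e G)) (level-0 (<⇒≱ p)) (level-1 ≤-refl))
                                 (through₀₁ (s e) (charge e G)))) (eq₃ (s e) (charge e G)))
        (ℤ.neg-involutive (3ℤ ℤ.* W))
        (ℤ.neg-mono-≤ (cut (level θ) (level-weight θ) (level-through θ) e))

-- Divisors up to coincidence of points

module Divisors {ℝ : Reals} (Γ : TropicalCurve ℝ) where
  open OrderedField ℝ
  open TropicalCurve Γ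
  open Solvability Γ
  open SlopeBound Γ
  open Position

  infix 4 _≋_
  _≋_ : Point Γ → Point Γ → Set
  _≋_ = _≈_ Γ

  [0]≢len : ∀ e → [ 0# ] ≢ len e
  [0]≢len e p with len e | len-pos e
  [0]≢len e refl | _ | Strict.[ q ] = <-irrefl refl q

  locate-origin : ∀ {e} (x : Position Γ e) → coord x ≡ [ 0# ] → locate Γ (on e x) ≡ inj₁ (src e)
  locate-origin {e} x p with ≡-dec _≟_ (coord x) [ 0# ] | ≡-dec _≟_ (coord x) (len e)
  ... | yes _ | _ = refl
  ... | no ¬p | _ = ⊥-elim (¬p p)

  locate-terminus : ∀ {e} (x : Position Γ e) → coord x ≡ len e → locate Γ (on e x) ≡ inj₁ (tgt e)
  locate-terminus {e} x p with ≡-dec _≟_ (coord x) [ 0# ] | ≡-dec _≟_ (coord x) (len e)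
  ... | yes q | _     = ⊥-elim ([0]≢len e (trans (sym q) p))
  ... | no _  | yes _ = refl
  ... | no _  | no ¬p = ⊥-elim (¬p p)

  locate-interior : ∀ {e} (x : Position Γ e) → coord x ≢ [ 0# ] → coord x ≢ len e → locate Γ (on e x) ≡ inj₂ (e , coord x)
  locate-interior {e} x ¬p ¬q with ≡-dec _≟_ (coord x) [ 0# ] | ≡-dec _≟_ (coord x) (len e)
  ... | yes p | _     = ⊥-elim (¬p p)
  ... | no _  | yes q = ⊥-elim (¬q q)
  ... | no _  | no _  = refl

  finitePart : Carrier ⁺ → Carrier
  finitePart [ t ] = t
  finitePart ⊤⁺    = 0#

  -- Unlike `locate`, it keeps the ends of an edge on the edge. The point at infinity gets position
  -- 0, which is harmless since levers on rays are 0.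
  location : Point Γ → Location
  location (vertex v) = inj₁ v , 0#
  location (on e x)   = inj₂ e , finitePart (coord x)

  -- The bounds of a position are irrelevant fields; because the order is decidable, they can be
  -- recomputed.
  0≤coord′ : ∀ {e} (x : Position Γ e) → [ 0# ] ≤⁺ coord x
  0≤coord′ (position c 0≤c _) = recompute (NonStrict.≤⁺-dec _≤_ _≤?_ [ 0# ] c) 0≤c

  coord≤len′ : ∀ {e} (x : Position Γ e) → coord x ≤⁺ len e
  coord≤len′ {e} (position c _ c≤len) = recompute (NonStrict.≤⁺-dec _≤_ _≤?_ c (len e)) c≤len

  location-valid : ∀ p → Valid (location p)
  location-valid (vertex v) = tt
  location-valid (on e x) with len e | coord x | 0≤coord′ x | coord≤len′ x
  ... | _  | _ | NonStrict.[ p ] | NonStrict.[ q ]   = p , q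
  ... | ⊤⁺ | _ | NonStrict.[ p ] | _ NonStrict.≤⊤⁺   = p
  ... | ⊤⁺ | _ | _ NonStrict.≤⊤⁺ | _ NonStrict.≤⊤⁺   = ≤-refl

  chain : Divisor Γ → Chain
  chain = map (λ (m , p) → m , location p)

  chain-++ : ∀ D E → chain (D ++ E) ≡ chain D ++ chain E
  chain-++ = map-++ _

  coeff-∷-≉ : ∀ m q D p → ¬ q ≋ p → coeff Γ ((m , q) ∷ D) p ≡ coeff Γ D p
  coeff-∷-≉ m q D p q≉p with _≈?_ Γ q p
  ... | yes r = ⊥-elim (q≉p r)
  ... | no _  = refl

  -- Turns coefficients of divisors into linear expressions, within reach of the ring solver.
  [_at_] : Point Γ → Point Γ → ℤ
  [ q at p ] with _≈?_ Γ q p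
  ... | yes _ = 1ℤ
  ... | no _  = 0ℤ

  at-≉ : ∀ q p → ¬ q ≋ p → [ q at p ] ≡ 0ℤ
  at-≉ q p h with _≈?_ Γ q p
  ... | yes r = ⊥-elim (h r)
  ... | no _  = refl

  at-cong : ∀ q r p → q ≋ r → [ q at p ] ≡ [ r at p ]
  at-cong q r p h with _≈?_ Γ q p | _≈?_ Γ r p
  ... | yes _ | yes _ = refl
  ... | yes a | no ¬b = ⊥-elim (¬b (trans (sym h) a))
  ... | no ¬a | yes b = ⊥-elim (¬a (trans h b))
  ... | no _  | no _  = refl

  coeff-∷ : ∀ m q D p → coeff Γ ((m , q) ∷ D) p ≡ m ℤ.* [ q at p ] ℤ.+ coeff Γ D p
  coeff-∷ m q D p with _≈?_ Γ q p
  ... | yes _ = cong (λ u → u ℤ.+ coeff Γ D p) (sym (ℤ.*-identityʳ m))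
  ... | no _  = sym (trans (cong (λ u → u ℤ.+ coeff Γ D p) (ℤ.*-zeroʳ m)) (ℤ.+-identityˡ _))

  coeff-++ : ∀ D E p → coeff Γ (D ++ E) p ≡ coeff Γ D p ℤ.+ coeff Γ E p
  coeff-++ []            E p = sym (ℤ.+-identityˡ _)
  coeff-++ ((m , q) ∷ D) E p = begin
    coeff Γ ((m , q) ∷ (D ++ E)) p  ≡⟨ coeff-∷ m q (D ++ E) p ⟩
    m ℤ.* [ q at p ] ℤ.+ coeff Γ (D ++ E) p  ≡⟨ cong (λ u → m ℤ.* [ q at p ] ℤ.+ u) (coeff-++ D E p) ⟩
    m ℤ.* [ q at p ] ℤ.+ (coeff Γ D p ℤ.+ coeff Γ E p)  ≡⟨ sym (ℤ.+-assoc (m ℤ.* [ q at p ]) _ _) ⟩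
    m ℤ.* [ q at p ] ℤ.+ coeff Γ D p ℤ.+ coeff Γ E p  ≡⟨ cong (λ u → u ℤ.+ coeff Γ E p) (sym (coeff-∷ m q D p)) ⟩
    coeff Γ ((m , q) ∷ D) p ℤ.+ coeff Γ E p  ∎
    where open ≡-Reasoning

  negate : Divisor Γ → Divisor Γ
  negate = map (λ (k , p) → ℤ.- k , p)

  coeff-negate : ∀ D p → coeff Γ (negate D) p ≡ ℤ.- coeff Γ D p
  coeff-negate []            p = refl
  coeff-negate ((m , q) ∷ D) p = begin
    coeff Γ ((ℤ.- m , q) ∷ negate D) p  ≡⟨ coeff-∷ (ℤ.- m) q (negate D) p ⟩
    ℤ.- m ℤ.* [ q at p ] ℤ.+ coeff Γ (negate D) p  ≡⟨ cong (λ u → ℤ.- m ℤ.* [ q at p ] ℤ.+ u) (coeff-negate D p) ⟩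
    ℤ.- m ℤ.* [ q at p ] ℤ.+ ℤ.- coeff Γ D p  ≡⟨ eq m [ q at p ] (coeff Γ D p) ⟩
    ℤ.- (m ℤ.* [ q at p ] ℤ.+ coeff Γ D p)  ≡⟨ cong ℤ.-_ (sym (coeff-∷ m q D p)) ⟩
    ℤ.- coeff Γ ((m , q) ∷ D) p  ∎
    where
    open ≡-Reasoning
    eq : ∀ m a c → ℤ.- m ℤ.* a ℤ.+ ℤ.- c ≡ ℤ.- (m ℤ.* a ℤ.+ c)
    eq = solve-∀

  coeff-⊟ : ∀ D E p → coeff Γ (_⊟_ Γ D E) p ≡ coeff Γ D p ℤ.- coeff Γ E p
  coeff-⊟ D E p = trans (coeff-++ D (negate E) p) (cong (λ u → coeff Γ D p ℤ.+ u) (coeff-negate E p))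

  ⟨⟩-negate : ∀ w D → ⟨ w , chain (negate D) ⟩ ≡ ℤ.- ⟨ w , chain D ⟩
  ⟨⟩-negate w []            = refl
  ⟨⟩-negate w ((m , q) ∷ D) = trans (cong (λ u → ℤ.- m ℤ.* w (location q) ℤ.+ u) (⟨⟩-negate w D)) (eq m (w (location q)) _)
    where
    eq : ∀ m a c → ℤ.- m ℤ.* a ℤ.+ ℤ.- c ≡ ℤ.- (m ℤ.* a ℤ.+ c)
    eq = solve-∀

  moment-negate : ∀ e D → moment e (chain (negate D)) ≡ - moment e (chain D)
  moment-negate e []            = solve 0 (con 0ℤ := :- con 0ℤ) refl
  moment-negate e ((m , q) ∷ D) = trans (cong₂ (λ a u → a * lever e (location q) + u) (ι-neg m) (moment-negate e D))
    (solve 3 (λ m a c → (:- m) :* a :+ :- c := :- (m :* a :+ c)) refl (ι m) (lever e (location q)) _)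

  outside : Point Γ → Divisor Γ → Divisor Γ
  outside p []            = []
  outside p ((m , q) ∷ D) with _≈?_ Γ q p
  ... | yes _ = outside p D
  ... | no _  = (m , q) ∷ outside p D

  length-outside : ∀ p D → length (outside p D) ℕ.≤ length D
  length-outside p [] = ℕ.z≤n
  length-outside p ((m , q) ∷ D) with _≈?_ Γ q p
  ... | yes _ = ℕ.m≤n⇒m≤1+n (length-outside p D)
  ... | no _  = ℕ.s≤s (length-outside p D)

  length-outside-∷ : ∀ m p D → length (outside p ((m , p) ∷ D)) ℕ.≤ length D
  length-outside-∷ m p D with _≈?_ Γ p p
  ... | yes _ = length-outside p D
  ... | no ¬p = ⊥-elim (¬p refl)

  coeff-outside : ∀ p D q → coeff Γ D q ≡ coeff Γ D p ℤ.* [ p at q ] ℤ.+ coeff Γ (outside p D) q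
  coeff-outside p [] q = refl
  coeff-outside p ((m , r) ∷ D) q with _≈?_ Γ r p
  ... | yes r≈p = begin
    coeff Γ ((m , r) ∷ D) q  ≡⟨ coeff-∷ m r D q ⟩
    m ℤ.* [ r at q ] ℤ.+ coeff Γ D q  ≡⟨ cong₂ (λ a b → m ℤ.* a ℤ.+ b) (at-cong r p q r≈p) (coeff-outside p D q) ⟩
    m ℤ.* [ p at q ] ℤ.+ (coeff Γ D p ℤ.* [ p at q ] ℤ.+ coeff Γ (outside p D) q)  ≡⟨ eq m [ p at q ] (coeff Γ D p) _ ⟩
    (m ℤ.+ coeff Γ D p) ℤ.* [ p at q ] ℤ.+ coeff Γ (outside p D) q  ∎
    where
    open ≡-Reasoning
    eq : ∀ m a c d → m ℤ.* a ℤ.+ (c ℤ.* a ℤ.+ d) ≡ (m ℤ.+ c) ℤ.* a ℤ.+ d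
    eq = solve-∀
  ... | no r≉p = begin
    coeff Γ ((m , r) ∷ D) q  ≡⟨ coeff-∷ m r D q ⟩
    m ℤ.* [ r at q ] ℤ.+ coeff Γ D q  ≡⟨ cong (λ b → m ℤ.* [ r at q ] ℤ.+ b) (coeff-outside p D q) ⟩
    m ℤ.* [ r at q ] ℤ.+ (coeff Γ D p ℤ.* [ p at q ] ℤ.+ coeff Γ (outside p D) q)
      ≡⟨ eq (m ℤ.* [ r at q ]) (coeff Γ D p ℤ.* [ p at q ]) _ ⟩
    coeff Γ D p ℤ.* [ p at q ] ℤ.+ (m ℤ.* [ r at q ] ℤ.+ coeff Γ (outside p D) q)
      ≡⟨ cong (λ b → coeff Γ D p ℤ.* [ p at q ] ℤ.+ b) (sym (coeff-∷ m r (outside p D) q)) ⟩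
    coeff Γ D p ℤ.* [ p at q ] ℤ.+ coeff Γ ((m , r) ∷ outside p D) q  ∎
    where
    open ≡-Reasoning
    eq : ∀ a b c → a ℤ.+ (b ℤ.+ c) ≡ b ℤ.+ (a ℤ.+ c)
    eq = solve-∀

  coeff-outside-≈ : ∀ p D q → q ≋ p → coeff Γ (outside p D) q ≡ 0ℤ
  coeff-outside-≈ p [] q h = refl
  coeff-outside-≈ p ((m , r) ∷ D) q h with _≈?_ Γ r p
  ... | yes _  = coeff-outside-≈ p D q h
  ... | no r≉p = trans (coeff-∷-≉ m r (outside p D) q (λ r≈q → r≉p (trans r≈q h))) (coeff-outside-≈ p D q h)

  coeff-outside-≉ : ∀ p D q → ¬ q ≋ p → coeff Γ (outside p D) q ≡ coeff Γ D q
  coeff-outside-≉ p D q h = sym (trans (coeff-outside p D q) (trans (cong (λ a → coeff Γ D p ℤ.* a ℤ.+ coeff Γ (outside p D) q) (at-≉ p q (λ e → h (sym e))))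
    (trans (cong (λ u → u ℤ.+ coeff Γ (outside p D) q) (ℤ.*-zeroʳ (coeff Γ D p))) (ℤ.+-identityˡ _))))

  -- Interchangeable descriptions of a point

  _minus_ : Location → Location → Chain
  l minus k = (1ℤ , l) ∷ (ℤ.- 1ℤ , k) ∷ []

  canonical : Vertex ⊎ (Edge × Carrier ⁺) → Location
  canonical (inj₁ v)       = inj₁ v , 0#
  canonical (inj₂ (e , c)) = inj₂ e , finitePart c

  minus-self : ∀ l → Solvable (l minus l)
  minus-self l = Solvable-≗ (λ e → trans (cong (λ u → ι 1ℤ * lever e l + (u * lever e l + 0#)) (ι-neg 1ℤ))
      (solve 2 (λ o x → o :* x :+ ((:- o) :* x :+ con 0ℤ) := con 0ℤ) refl (ι 1ℤ) (lever e l)))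
    (λ w → eq (w l)) Solvable-[]
    where
    eq : ∀ x → 1ℤ ℤ.* x ℤ.+ (ℤ.- 1ℤ ℤ.* x ℤ.+ 0ℤ) ≡ 0ℤ
    eq = solve-∀

  lever-vertex : ∀ e v t → lever e (inj₁ v , t) ≡ 0#
  lever-vertex e v t = zeroˡ _

  -- The underlying function is 0. Since a point at position 0 still lies ahead of the initial
  -- slope, that slope has to be -1 on `e`, and the point brings it back to 0 at once.
  origin-minus-src : ∀ e → Solvable ((inj₂ e , 0#) minus (inj₁ (src e) , 0#))
  origin-minus-src e = s , (λ _ → 0#) , record { edges = λ d → edge d (len d) refl ; vertices = vertex′ }
    where
    G = (inj₂ e , 0#) minus (inj₁ (src e) , 0#)
    s : Edge → ℤ
    s d = ℤ.- δ e d
    edge : ∀ d ℓ → len d ≡ ℓ → EdgeEquation d ℓ (s d) (λ _ → 0#) G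
    edge d ⊤⁺    _    = -‿inverseʳ 0#
    edge d [ ℓ ] len≡ = sym (begin
      ι (ℤ.- δ e d) * ℓ + (ι 1ℤ * (ι (δ e d) * fromEnd (len d) 0#) + (ι (ℤ.- 1ℤ) * lever d (inj₁ (src e) , 0#) + 0#))
        ≡⟨ cong₂ (λ a b → a * ℓ + (ι 1ℤ * (ι (δ e d) * fromEnd (len d) 0#) + (ι (ℤ.- 1ℤ) * b + 0#))) (ι-neg (δ e d)) (lever-vertex d (src e) 0#) ⟩
      - ι (δ e d) * ℓ + (ι 1ℤ * (ι (δ e d) * fromEnd (len d) 0#) + (ι (ℤ.- 1ℤ) * 0# + 0#))
        ≡⟨ cong (λ L → - ι (δ e d) * ℓ + (ι 1ℤ * (ι (δ e d) * fromEnd L 0#) + (ι (ℤ.- 1ℤ) * 0# + 0#))) len≡ ⟩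
      - ι (δ e d) * ℓ + (ι 1ℤ * (ι (δ e d) * (ℓ - 0#)) + (ι (ℤ.- 1ℤ) * 0# + 0#))
        ≡⟨ solve 3 (λ a ℓ u → (:- a) :* ℓ :+ (con 1ℤ :* (a :* (ℓ :- con 0ℤ)) :+ (u :* con 0ℤ :+ con 0ℤ)) := con 0ℤ :- con 0ℤ) refl (ι (δ e d)) ℓ (ι (ℤ.- 1ℤ)) ⟩
      0# - 0# ∎)
      where open ≡-Reasoning
    vertex′ : ∀ v → outflow s G v ≡ ⟨ atVertex v , G ⟩
    vertex′ v = begin
      outflow s G v  ≡⟨ sum-cong-≗ (λ d → eq (δ (src d) v) (δ (tgt d) v) (δ e d)) ⟩
      sum (λ d → ℤ.- δ (src d) v ℤ.* δ e d)  ≡⟨ sum-δ (λ d → ℤ.- δ (src d) v) e ⟩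
      ℤ.- δ (src e) v  ≡⟨ eq′ (δ (src e) v) ⟩
      ⟨ atVertex v , G ⟩  ∎
      where
      open ≡-Reasoning
      eq : ∀ a b x → a ℤ.* ℤ.- x ℤ.- b ℤ.* (ℤ.- x ℤ.+ (1ℤ ℤ.* x ℤ.+ (ℤ.- 1ℤ ℤ.* 0ℤ ℤ.+ 0ℤ))) ≡ ℤ.- a ℤ.* x
      eq = solve-∀
      eq′ : ∀ a → ℤ.- a ≡ 1ℤ ℤ.* 0ℤ ℤ.+ (ℤ.- 1ℤ ℤ.* a ℤ.+ 0ℤ)
      eq′ = solve-∀

  -- The underlying function is again 0, now with all initial slopes 0. The point at the far end has
  -- no lever, and its charge is balanced at the target.
  terminus-minus-tgt : ∀ e → Solvable ((inj₂ e , finitePart (len e)) minus (inj₁ (tgt e) , 0#))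
  terminus-minus-tgt e = (λ _ → 0ℤ) , (λ _ → 0#) , record { edges = λ d → edge d (len d) refl ; vertices = vertex′ }
    where
    G = (inj₂ e , finitePart (len e)) minus (inj₁ (tgt e) , 0#)
    lever-0 : ∀ d → lever d (inj₂ e , finitePart (len e)) ≡ 0#
    lever-0 d with e Fin.≟ d
    ... | no _ = zeroˡ _
    ... | yes refl with len e
    ...   | [ ℓ ] = trans (cong (ι 1ℤ *_) (-‿inverseʳ ℓ)) (zeroʳ _)
    ...   | ⊤⁺    = zeroʳ _
    edge : ∀ d ℓ → len d ≡ ℓ → EdgeEquation d ℓ 0ℤ (λ _ → 0#) G
    edge d ⊤⁺    _ = -‿inverseʳ 0#
    edge d [ ℓ ] _ = sym (trans (cong₂ (λ a b → 0# * ℓ + (ι 1ℤ * a + (ι (ℤ.- 1ℤ) * b + 0#))) (lever-0 d) (lever-vertex d (tgt e) 0#))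
      (solve 3 (λ ℓ o u → con 0ℤ :* ℓ :+ (o :* con 0ℤ :+ (u :* con 0ℤ :+ con 0ℤ)) := con 0ℤ :- con 0ℤ) refl ℓ (ι 1ℤ) (ι (ℤ.- 1ℤ))))
    vertex′ : ∀ v → outflow (λ _ → 0ℤ) G v ≡ ⟨ atVertex v , G ⟩
    vertex′ v = begin
      outflow (λ _ → 0ℤ) G v  ≡⟨ sum-cong-≗ (λ d → eq (δ (src d) v) (δ (tgt d) v) (δ e d)) ⟩
      sum (λ d → ℤ.- δ (tgt d) v ℤ.* δ e d)  ≡⟨ sum-δ (λ d → ℤ.- δ (tgt d) v) e ⟩
      ℤ.- δ (tgt e) v  ≡⟨ eq′ (δ (tgt e) v) ⟩
      ⟨ atVertex v , G ⟩  ∎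
      where
      open ≡-Reasoning
      eq : ∀ a b x → a ℤ.* 0ℤ ℤ.- b ℤ.* (0ℤ ℤ.+ (1ℤ ℤ.* x ℤ.+ (ℤ.- 1ℤ ℤ.* 0ℤ ℤ.+ 0ℤ))) ≡ ℤ.- b ℤ.* x
      eq = solve-∀
      eq′ : ∀ a → ℤ.- a ≡ 1ℤ ℤ.* 0ℤ ℤ.+ (ℤ.- 1ℤ ℤ.* a ℤ.+ 0ℤ)
      eq′ = solve-∀

  minus-canonical : ∀ p → Solvable (location p minus canonical (locate Γ p))
  minus-canonical (vertex v) = minus-self _
  minus-canonical (on e x) = cases (≡-dec _≟_ (coord x) [ 0# ]) (≡-dec _≟_ (coord x) (len e))
    where
    cases : Dec (coord x ≡ [ 0# ]) → Dec (coord x ≡ len e) →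
            Solvable ((inj₂ e , finitePart (coord x)) minus canonical (locate Γ (on e x)))
    cases (yes p) _       = subst₂ (λ c l → Solvable ((inj₂ e , finitePart c) minus canonical l)) (sym p) (sym (locate-origin x p)) (origin-minus-src e)
    cases (no _)  (yes q) = subst₂ (λ c l → Solvable ((inj₂ e , finitePart c) minus canonical l)) (sym q) (sym (locate-terminus x q)) (terminus-minus-tgt e)
    cases (no ¬p) (no ¬q) = subst (λ l → Solvable ((inj₂ e , finitePart (coord x)) minus canonical l)) (sym (locate-interior x ¬p ¬q)) (minus-self _)

  -- Both locations are compared with the canonical one, which coinciding points share.
  minus-≈ : ∀ p q → p ≋ q → Solvable (location p minus location q)
  minus-≈ p q h = Solvable-combine
    {location p minus canonical (locate Γ p)} {scale (ℤ.- 1ℤ) (location q minus canonical (locate Γ p))}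
    (λ e → moments e) (λ w → charges (w (location p)) (w (location q)) (w (canonical (locate Γ p))))
    (minus-canonical p) (Solvable-scale (ℤ.- 1ℤ) (subst (λ l → Solvable (location q minus canonical l)) (sym h) (minus-canonical q)))
    where
    moments : ∀ e → moment e (location p minus location q) ≡
              moment e (location p minus canonical (locate Γ p)) + moment e (scale (ℤ.- 1ℤ) (location q minus canonical (locate Γ p)))
    moments e = trans
      (solve 3 (λ a b c → con 1ℤ :* a :+ (con (ℤ.- 1ℤ) :* b :+ con 0ℤ) :=
                          (con 1ℤ :* a :+ (con (ℤ.- 1ℤ) :* c :+ con 0ℤ)) :+ con (ℤ.- 1ℤ) :* (con 1ℤ :* b :+ (con (ℤ.- 1ℤ) :* c :+ con 0ℤ))) refl
        (lever e (location p)) (lever e (location q)) (lever e (canonical (locate Γ p))))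
      (cong (λ u → moment e (location p minus canonical (locate Γ p)) + u) (sym (moment-scale e (ℤ.- 1ℤ) (location q minus canonical (locate Γ p)))))
    charges : ∀ a b c → 1ℤ ℤ.* a ℤ.+ (ℤ.- 1ℤ ℤ.* b ℤ.+ 0ℤ) ≡
              (1ℤ ℤ.* a ℤ.+ (ℤ.- 1ℤ ℤ.* c ℤ.+ 0ℤ)) ℤ.+ (ℤ.- 1ℤ ℤ.* 1ℤ ℤ.* b ℤ.+ (ℤ.- 1ℤ ℤ.* ℤ.- 1ℤ ℤ.* c ℤ.+ 0ℤ))
    charges = solve-∀

  gather : Point Γ → Divisor Γ → Divisor Γ
  gather p D = (coeff Γ D p , p) ∷ outside p D

  moment-⊟ : ∀ e D E → moment e (chain (_⊟_ Γ D E)) ≡ moment e (chain D) - moment e (chain E)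
  moment-⊟ e D E = trans (cong (moment e) (chain-++ D (negate E)))
    (trans (moment-++ e (chain D) _) (cong (λ u → moment e (chain D) + u) (moment-negate e E)))

  ⟨⟩-⊟ : ∀ w D E → ⟨ w , chain (_⊟_ Γ D E) ⟩ ≡ ⟨ w , chain D ⟩ ℤ.- ⟨ w , chain E ⟩
  ⟨⟩-⊟ w D E = trans (cong (λ G → ⟨ w , G ⟩) (chain-++ D (negate E)))
    (trans (⟨⟩-++ w (chain D) _) (cong (λ u → ⟨ w , chain D ⟩ ℤ.+ u) (⟨⟩-negate w E)))

  Solvable-⊟⁻ : ∀ D E → Solvable (chain (_⊟_ Γ D E)) → Solvable (chain E) → Solvable (chain D)
  Solvable-⊟⁻ D E = Solvable-combine
    (λ e → trans (solve 2 (λ a b → a := (a :- b) :+ b) refl _ (moment e (chain E))) (cong (λ u → u + moment e (chain E)) (sym (moment-⊟ e D E))))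
    (λ w → trans (eq ⟨ w , chain D ⟩ ⟨ w , chain E ⟩) (cong (λ u → u ℤ.+ ⟨ w , chain E ⟩) (sym (⟨⟩-⊟ w D E))))
    where
    eq : ∀ a b → a ≡ (a ℤ.- b) ℤ.+ b
    eq = solve-∀

  -- Moving an entry `(m , r)` with `r ≋ p` over to `p` changes the chain by `m` times a solvable
  -- difference.
  gathering : ∀ p D → Solvable (chain (_⊟_ Γ D (gather p D)))
  gathering p [] = Solvable-≗ (λ e → solve 1 (λ a → con 0ℤ :* a :+ con 0ℤ := con 0ℤ) refl (lever e (location p)))
                     (λ w → refl) Solvable-[]
  gathering p ((m , r) ∷ D) with _≈?_ Γ r p
  ... | yes r≈p = Solvable-combine {chain (_⊟_ Γ D (gather p D))} {scale m (location r minus location p)}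
      (λ e → begin
        moment e (chain (_⊟_ Γ ((m , r) ∷ D) ((m ℤ.+ coeff Γ D p , p) ∷ outside p D)))
          ≡⟨ moment-⊟ e ((m , r) ∷ D) ((m ℤ.+ coeff Γ D p , p) ∷ outside p D) ⟩
        (ι m * lever e (location r) + moment e (chain D)) - (ι (m ℤ.+ coeff Γ D p) * lever e (location p) + moment e (chain (outside p D)))
          ≡⟨ cong (λ u → (ι m * lever e (location r) + moment e (chain D)) - (u * lever e (location p) + moment e (chain (outside p D)))) (ι-+ m (coeff Γ D p)) ⟩
        (ι m * lever e (location r) + moment e (chain D)) - ((ι m + ι (coeff Γ D p)) * lever e (location p) + moment e (chain (outside p D)))
          ≡⟨ solve 6 (λ m x y c D o → (m :* x :+ D) :- ((m :+ c) :* y :+ o) :=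
               (D :- (c :* y :+ o)) :+ m :* (con 1ℤ :* x :+ (con (ℤ.- 1ℤ) :* y :+ con 0ℤ))) refl (ι m) (lever e (location r)) (lever e (location p)) (ι (coeff Γ D p)) _ _ ⟩
        (moment e (chain D) - (ι (coeff Γ D p) * lever e (location p) + moment e (chain (outside p D)))) + ι m * moment e (location r minus location p)
          ≡⟨ sym (cong₂ _+_ (moment-⊟ e D (gather p D)) (moment-scale e m (location r minus location p))) ⟩
        moment e (chain (_⊟_ Γ D (gather p D))) + moment e (scale m (location r minus location p)) ∎)
      (λ w → trans (⟨⟩-⊟ w ((m , r) ∷ D) ((m ℤ.+ coeff Γ D p , p) ∷ outside p D))
        (trans (eq m (w (location r)) (w (location p)) (coeff Γ D p) _ _)
          (sym (cong₂ ℤ._+_ (⟨⟩-⊟ w D (gather p D)) (⟨⟩-scale w m (location r minus location p))))))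
      (gathering p D) (Solvable-scale m (minus-≈ r p r≈p))
    where
    open ≡-Reasoning
    eq : ∀ m x y c D o → (m ℤ.* x ℤ.+ D) ℤ.- ((m ℤ.+ c) ℤ.* y ℤ.+ o) ≡
         (D ℤ.- (c ℤ.* y ℤ.+ o)) ℤ.+ m ℤ.* (1ℤ ℤ.* x ℤ.+ (ℤ.- 1ℤ ℤ.* y ℤ.+ 0ℤ))
    eq = solve-∀
  ... | no r≉p = Solvable-≗ {chain (_⊟_ Γ D (gather p D))}
      (λ e → trans (moment-⊟ e ((m , r) ∷ D) ((coeff Γ D p , p) ∷ (m , r) ∷ outside p D))
        (trans (solve 4 (λ x D y o → (x :+ D) :- (y :+ (x :+ o)) := D :- (y :+ o)) refl (ι m * lever e (location r)) _ (ι (coeff Γ D p) * lever e (location p)) _)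
          (sym (moment-⊟ e D (gather p D)))))
      (λ w → trans (⟨⟩-⊟ w ((m , r) ∷ D) ((coeff Γ D p , p) ∷ (m , r) ∷ outside p D))
        (trans (eq (m ℤ.* w (location r)) _ (coeff Γ D p ℤ.* w (location p)) _) (sym (⟨⟩-⊟ w D (gather p D)))))
      (gathering p D)
    where
    eq : ∀ x D y o → (x ℤ.+ D) ℤ.- (y ℤ.+ (x ℤ.+ o)) ≡ D ℤ.- (y ℤ.+ o)
    eq = solve-∀

  Solvable-0∷ : ∀ l {G} → Solvable G → Solvable ((0ℤ , l) ∷ G)
  Solvable-0∷ l = Solvable-≗ (λ e → solve 2 (λ a b → con 0ℤ :* a :+ b := b) refl (lever e l) _) (λ w → ℤ.+-identityˡ _)

  -- Chains are formal sums, whereas divisors are compared by coefficients. Gathering one point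
  -- after another leaves entries with coefficient 0, which do not affect solvability.
  Solvable-≐0 : ∀ D → (∀ p → coeff Γ D p ≡ 0ℤ) → Solvable (chain D)
  Solvable-≐0 D = go (length D) D ℕ.≤-refl
    where
    -- `outside` is not a structural part of the list; a bound on the length makes the recursion
    -- terminate.
    go : ∀ n D → length D ℕ.≤ n → (∀ p → coeff Γ D p ≡ 0ℤ) → Solvable (chain D)
    go _ [] _ _ = Solvable-[]
    go (suc n) ((m , p) ∷ D) (ℕ.s≤s l) h = Solvable-⊟⁻ ((m , p) ∷ D) (gather p ((m , p) ∷ D)) (gathering p ((m , p) ∷ D))
      (subst (λ c → Solvable ((c , location p) ∷ chain (outside p ((m , p) ∷ D)))) (sym (h p))
        (Solvable-0∷ (location p) (go n (outside p ((m , p) ∷ D)) (ℕ.≤-trans (length-outside-∷ m p D) l) rest)))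
      where
      rest : ∀ q → coeff Γ (outside p ((m , p) ∷ D)) q ≡ 0ℤ
      rest q with _≈?_ Γ q p
      ... | yes q≈p = coeff-outside-≈ p ((m , p) ∷ D) q q≈p
      ... | no q≉p  = trans (coeff-outside-≉ p ((m , p) ∷ D) q q≉p) (h q)

  Solvable-≐ : ∀ {D E} → _≐_ Γ D E → Solvable (chain E) → Solvable (chain D)
  Solvable-≐ {D} {E} h = Solvable-⊟⁻ D E (Solvable-≐0 (_⊟_ Γ D E) λ p →
    trans (coeff-⊟ D E p) (trans (cong (λ c → c ℤ.- coeff Γ E p) (h p)) (ℤ.+-inverseʳ (coeff Γ E p))))

-- Rational functions solve the equations

module Necessity {ℝ : Reals} (Γ : TropicalCurve ℝ) where
  open OrderedField ℝ
  open TropicalCurve Γ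
  open Solvability Γ
  open SlopeBound Γ
  open Divisors Γ
  open Position

  origin≈src : ∀ e → on e (origin Γ e) ≋ vertex (src e)
  origin≈src e = locate-origin (origin Γ e) refl

  terminus≈tgt : ∀ e → on e (terminus Γ e) ≋ vertex (tgt e)
  terminus≈tgt e = locate-terminus (terminus Γ e) refl

  module _ {f : Point Γ → Carrier ±} {e : Edge} where

    -- A piece contributes opposite multiples of two locations on the same edge, which `w` does not
    -- distinguish.
    ⟨⟩-piecesDiv : ∀ {x y} w → (∀ t u → w (inj₂ e , t) ≡ w (inj₂ e , u)) →
                   (Ps : TransClosure (Piece Γ f e) x y) → ⟨ w , chain (piecesDiv Γ Ps) ⟩ ≡ 0ℤ
    ⟨⟩-piecesDiv w h = go
      where
      cancel : ∀ k {a b r} → a ≡ b → r ≡ 0ℤ → k ℤ.* a ℤ.+ (ℤ.- k ℤ.* b ℤ.+ r) ≡ 0ℤ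
      cancel k {a} refl refl = eq k a
        where
        eq : ∀ k a → k ℤ.* a ℤ.+ (ℤ.- k ℤ.* a ℤ.+ 0ℤ) ≡ 0ℤ
        eq = solve-∀
      go : ∀ {x y} (Ps : TransClosure (Piece Γ f e) x y) → ⟨ w , chain (piecesDiv Γ Ps) ⟩ ≡ 0ℤ
      go [ P ]ᵀ   = cancel (Piece.slope P) (h _ _) refl
      go (P ∷ Ps) = cancel (Piece.slope P) (h _ _) (go Ps)

    moment-piecesDiv-≢ : ∀ {x y} d → e ≢ d → (Ps : TransClosure (Piece Γ f e) x y) → moment d (chain (piecesDiv Γ Ps)) ≡ 0#
    moment-piecesDiv-≢ d e≢d = go
      where
      lever-0 : ∀ t → lever d (inj₂ e , t) ≡ 0#
      lever-0 t = trans (cong (λ k → ι k * fromEnd (len d) t) (δ-≢ e≢d)) (zeroˡ _)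
      collapse : ∀ a b t u r → r ≡ 0# → a * lever d (inj₂ e , t) + (b * lever d (inj₂ e , u) + r) ≡ 0#
      collapse a b t u r p = trans (cong₂ (λ x y → a * x + (b * y + r)) (lever-0 t) (lever-0 u))
        (trans (cong (λ z → a * 0# + (b * 0# + z)) p) (solve 2 (λ a b → a :* con 0ℤ :+ (b :* con 0ℤ :+ con 0ℤ) := con 0ℤ) refl a b))
      go : ∀ {x y} (Ps : TransClosure (Piece Γ f e) x y) → moment d (chain (piecesDiv Γ Ps)) ≡ 0#
      go [ P ]ᵀ   = collapse _ _ _ _ _ refl
      go (P ∷ Ps) = collapse _ _ _ _ _ (go Ps)

    -- The levers at `a` and `b` differ by `b - a`, so the two entries of a piece contribute slope
    -- times length, its rise. The rest `r` stands for the remaining pieces.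
    piece-rise : ∀ {ℓ x y} → len e ≡ [ ℓ ] → (P : Piece Γ f e x y) → ∀ r →
      ∃[ u ] ∃[ v ] f (on e x) ≡ [ u ]± × f (on e y) ≡ [ v ]± ×
        ι (Piece.slope P) * lever e (location (on e x)) + (ι (ℤ.- Piece.slope P) * lever e (location (on e y)) + r) ≡ (v - u) + r
    piece-rise {ℓ} {x} {y} len≡ P r = cases (coord y) refl (subst (coord y ≤⁺_) len≡ (coord≤len′ y))
      where
      open Piece P
      open ≡-Reasoning
      cases : ∀ k → coord y ≡ k → k ≤⁺ [ ℓ ] → ∃[ u ] ∃[ v ] f (on e x) ≡ [ u ]± × f (on e y) ≡ [ v ]± ×
        ι slope * lever e (location (on e x)) + (ι (ℤ.- slope) * lever e (location (on e y)) + r) ≡ (v - u) + r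
      cases ⊤⁺ _ ()
      cases [ b ] y≡ _ =
        _ , _ , trans (linear x (≤⁺-refl (coord x)) (<⁺⇒≤⁺ x<y)) (cong (affine Γ a c slope) x≡a) ,
        trans (linear y (<⁺⇒≤⁺ x<y) (≤⁺-refl (coord y))) (cong (affine Γ a c slope) y≡) , (begin
          ι slope * lever e (location (on e x)) + (ι (ℤ.- slope) * lever e (location (on e y)) + r)
            ≡⟨ cong₂ (λ s t → ι slope * lever e (inj₂ e , finitePart s) + (ι (ℤ.- slope) * lever e (inj₂ e , finitePart t) + r)) x≡a y≡ ⟩
          ι slope * (ι (δ e e) * fromEnd (len e) a) + (ι (ℤ.- slope) * (ι (δ e e) * fromEnd (len e) b) + r)
            ≡⟨ cong₂ (λ k L → ι slope * (ι k * fromEnd L a) + (ι (ℤ.- slope) * (ι k * fromEnd L b) + r)) (δ-refl e) len≡ ⟩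
          ι slope * (ι 1ℤ * (ℓ - a)) + (ι (ℤ.- slope) * (ι 1ℤ * (ℓ - b)) + r)
            ≡⟨ cong (λ k → ι slope * (ι 1ℤ * (ℓ - a)) + (k * (ι 1ℤ * (ℓ - b)) + r)) (ι-neg slope) ⟩
          ι slope * (ι 1ℤ * (ℓ - a)) + (- ι slope * (ι 1ℤ * (ℓ - b)) + r)
            ≡⟨ solve 6 (λ s ℓ a b c r → s :* (con 1ℤ :* (ℓ :- a)) :+ ((:- s) :* (con 1ℤ :* (ℓ :- b)) :+ r) :=
                 ((c :+ s :* (b :- a)) :- (c :+ s :* (a :- a))) :+ r) refl (ι slope) ℓ a b c r ⟩
          ((c + ι slope * (b - a)) - (c + ι slope * (a - a))) + r
            ≡⟨ cong₂ (λ u v → ((c + v) - (c + u)) + r) (sym (·≡ι* slope (a - a))) (sym (·≡ι* slope (b - a))) ⟩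
          ((c + slope · (b - a)) - (c + slope · (a - a))) + r ∎)

    -- The rises of consecutive pieces telescope.
    moment-piecesDiv : ∀ {ℓ x y} → len e ≡ [ ℓ ] → (Ps : TransClosure (Piece Γ f e) x y) →
      ∃[ u ] ∃[ v ] f (on e x) ≡ [ u ]± × f (on e y) ≡ [ v ]± × moment e (chain (piecesDiv Γ Ps)) ≡ v - u
    moment-piecesDiv len≡ [ P ]ᵀ with piece-rise len≡ P 0#
    ... | u , v , p , q , r = u , v , p , q , trans r (+-identityʳ _)
    moment-piecesDiv len≡ (P ∷ Ps) with moment-piecesDiv len≡ Ps
    ... | v′ , w , p′ , q′ , r′ with piece-rise len≡ P (moment e (chain (piecesDiv Γ Ps)))
    ...   | u , v , p , q , r with []±-injective (trans (sym q) p′)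
    ...     | refl = u , w , p , q′ , trans r (trans (cong (λ z → (v - u) + z) r′)
                       (solve 3 (λ u v w → (v :- u) :+ (w :- v) := w :- u) refl u v w))

  ⟨⟩-concat : ∀ {n} w (D : Fin n → Divisor Γ) → (∀ i → ⟨ w , chain (D i) ⟩ ≡ 0ℤ) → ⟨ w , chain (concat (tabulate D)) ⟩ ≡ 0ℤ
  ⟨⟩-concat {zero}  w D h = refl
  ⟨⟩-concat {suc n} w D h = trans (cong (λ G → ⟨ w , G ⟩) (chain-++ (D zero) _)) (trans (⟨⟩-++ w (chain (D zero)) _)
    (cong₂ ℤ._+_ (h zero) (⟨⟩-concat w (D ∘ suc) (h ∘ suc))))

  moment-concat-0 : ∀ {n} e (D : Fin n → Divisor Γ) → (∀ i → moment e (chain (D i)) ≡ 0#) → moment e (chain (concat (tabulate D))) ≡ 0#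
  moment-concat-0 {zero}  e D h = refl
  moment-concat-0 {suc n} e D h = trans (cong (moment e) (chain-++ (D zero) _)) (trans (moment-++ e (chain (D zero)) _)
    (trans (cong₂ _+_ (h zero) (moment-concat-0 e (D ∘ suc) (h ∘ suc))) (+-identityˡ 0#)))

  moment-concat : ∀ {n} e (D : Fin n → Divisor Γ) i → (∀ j → j ≢ i → moment e (chain (D j)) ≡ 0#) →
                  moment e (chain (concat (tabulate D))) ≡ moment e (chain (D i))
  moment-concat e D zero h = trans (cong (moment e) (chain-++ (D zero) _)) (trans (moment-++ e (chain (D zero)) _)
    (trans (cong (λ u → moment e (chain (D zero)) + u) (moment-concat-0 e (D ∘ suc) (λ j → h (suc j) λ ()))) (+-identityʳ _)))
  moment-concat e D (suc i) h = trans (cong (moment e) (chain-++ (D zero) _)) (trans (moment-++ e (chain (D zero)) _)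
    (trans (cong₂ _+_ (h zero λ ()) (moment-concat e (D ∘ suc) i λ j j≢i → h (suc j) (j≢i ∘ Fin.suc-injective))) (+-identityˡ _)))

  IsEnd : Vertex → Edge → Set
  IsEnd v e = len e ≡ ⊤⁺ × tgt e ≡ v

  end? : ∀ v → Dec (∃ (IsEnd v))
  end? v = Fin.any? λ e → ≡-dec _≟_ (len e) ⊤⁺ ×-dec (tgt e Fin.≟ v)

  src-not-end : ∀ e → ¬ ∃ (IsEnd (src e))
  src-not-end e (d , p , q) = src≢end p e (sym q)

  tgt-not-end : ∀ {e ℓ} → len e ≡ [ ℓ ] → ¬ ∃ (IsEnd (tgt e))
  tgt-not-end {e} len≡ (d , p , q) with tgt-end p e (sym q)
  ... | refl with trans (sym len≡) p
  ...   | ()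

  module _ (f : RationalFunction Γ) where
    open RationalFunction f

    private
      finiteValue : Carrier ± → Carrier
      finiteValue [ x ]± = x
      finiteValue ⊥±     = 0#
      finiteValue ⊤±     = 0#

      base : Vertex → Carrier
      base v = finiteValue (value (vertex v))

      -- At an unbounded end the function may be infinite, so the height of the other end of the ray
      -- is taken, as the equation for rays demands.
      heightBy : ∀ v → Dec (∃ (IsEnd v)) → Carrier
      heightBy v (yes (e , _)) = base (src e)
      heightBy v (no _)        = base v

      height : Vertex → Carrier
      height v = heightBy v (end? v)

      height-base : ∀ v → ¬ ∃ (IsEnd v) → height v ≡ base v
      height-base v h = cases (end? v)
        where
        cases : ∀ d → heightBy v d ≡ base v
        cases (yes p) = ⊥-elim (h p)
        cases (no _)  = refl

      height-end : ∀ e → len e ≡ ⊤⁺ → height (tgt e) ≡ base (src e)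
      height-end e len≡ = cases (end? (tgt e))
        where
        cases : ∀ d → heightBy (tgt e) d ≡ base (src e)
        cases (yes (d , p , q)) = cong (base ∘ src) (sym (tgt-end p e (sym q)))
        cases (no h)            = ⊥-elim (h (e , len≡ , refl))

      moment-div : ∀ {e ℓ} → len e ≡ [ ℓ ] → height (tgt e) - height (src e) ≡ moment e (chain (div Γ f))
      moment-div {e} {ℓ} len≡ with moment-piecesDiv len≡ (pieces e)
      ... | u , v , p , q , r = begin
        height (tgt e) - height (src e)
          ≡⟨ cong₂ _-_ (height-base (tgt e) (tgt-not-end len≡)) (height-base (src e) (src-not-end e)) ⟩
        base (tgt e) - base (src e)
          ≡⟨ cong₂ (λ a b → finiteValue a - finiteValue b) (trans (sym (respects (terminus≈tgt e))) q) (trans (sym (respects (origin≈src e))) p) ⟩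
        v - u  ≡⟨ sym r ⟩
        moment e (chain (piecesDiv Γ (pieces e)))
          ≡⟨ sym (moment-concat e (λ d → piecesDiv Γ (pieces d)) e (λ d d≢e → moment-piecesDiv-≢ e d≢e (pieces d))) ⟩
        moment e (chain (div Γ f))  ∎
        where open ≡-Reasoning

      charge-div : ∀ e → charge e (chain (div Γ f)) ≡ 0ℤ
      charge-div e = ⟨⟩-concat (onEdge e) _ λ d → ⟨⟩-piecesDiv (onEdge e) (λ _ _ → refl) (pieces d)

    -- `div` describes all its points as points on edges, including those at vertices. The initial
    -- slope of an edge thus appears as an entry at position 0, and its final slope cancels the
    -- charge at the far end; all unknown slopes are 0 and the vertex equations read 0 = 0.
    Solvable-div : Solvable (chain (div Γ f))
    Solvable-div = (λ _ → 0ℤ) , height , record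
      { edges    = λ e → edge e (len e) refl
      ; vertices = λ v → trans
          (sum-zero _ λ e → trans (cong (λ c → δ (src e) v ℤ.* 0ℤ ℤ.- δ (tgt e) v ℤ.* (0ℤ ℤ.+ c)) (charge-div e)) (eq (δ (src e) v) (δ (tgt e) v)))
          (sym (⟨⟩-concat (atVertex v) _ λ d → ⟨⟩-piecesDiv (atVertex v) (λ _ _ → refl) (pieces d))) }
      where
      eq : ∀ a b → a ℤ.* 0ℤ ℤ.- b ℤ.* (0ℤ ℤ.+ 0ℤ) ≡ 0ℤ
      eq = solve-∀
      edge : ∀ e ℓ → len e ≡ ℓ → EdgeEquation e ℓ 0ℤ height (chain (div Γ f))
      edge e [ ℓ ] len≡ = trans (moment-div len≡) (solve 2 (λ ℓ m → m := con 0ℤ :* ℓ :+ m) refl ℓ _)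
      edge e ⊤⁺    len≡ = trans (cong₂ _-_ (height-end e len≡) (height-base (src e) (src-not-end e))) (-‿inverseʳ _)

-- Solutions of the equations define rational functions

module Sufficiency {ℝ : Reals} (Γ : TropicalCurve ℝ) where
  open OrderedField ℝ
  open TropicalCurve Γ
  open Solvability Γ
  open SlopeBound Γ
  open Divisors Γ
  open Necessity Γ
  open Position

  position-≡ : ∀ {e} (x y : Position Γ e) → coord x ≡ coord y → x ≡ y
  position-≡ (position _ _ _) (position _ _ _) refl = refl

  -- A place where the slope changes inside the edge. A point at the far end is left out, as no part
  -- of the edge follows it.
  record Break (e : Edge) : Set where
    field
      multiplicity : ℤ
      place        : Position Γ e
      time         : Carrier
      place≡time   : coord place ≡ [ time ]
      time<len     : [ time ] <⁺ len e

    0≤time : 0# ≤ time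
    0≤time with coord place | 0≤coord′ place | place≡time
    ... | _ | NonStrict.[ p ] | refl = p

  open Break

  ramp : Carrier → Carrier → Carrier
  ramp t x with t <? x
  ... | yes _ = x - t
  ... | no  _ = 0#

  ramp-≥ : ∀ {t x} → t ≤ x → ramp t x ≡ x - t
  ramp-≥ {t} {x} p with t <? x
  ... | yes _ = refl
  ramp-≥ {t} {x} (inj₁ p)    | no ¬p = ⊥-elim (¬p p)
  ramp-≥ {t} {x} (inj₂ refl) | no _  = sym (-‿inverseʳ t)

  ramp-≤ : ∀ {t x} → x ≤ t → ramp t x ≡ 0#
  ramp-≤ {t} {x} p with t <? x
  ... | yes q = ⊥-elim (<⇒≱ q p)
  ... | no _  = refl

  sumᴿ : ∀ {A : Set} → (A → Carrier) → List A → Carrier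
  sumᴿ φ = foldr (λ k r → φ k + r) 0#

  sumᶻ : ∀ {A : Set} → (A → ℤ) → List A → ℤ
  sumᶻ φ = foldr (λ k r → φ k ℤ.+ r) 0ℤ

  sumᶻ-cong : ∀ {A : Set} {φ ψ : A → ℤ} B → (∀ k → k ∈ B → φ k ≡ ψ k) → sumᶻ φ B ≡ sumᶻ ψ B
  sumᶻ-cong []      h = refl
  sumᶻ-cong (k ∷ B) h = cong₂ ℤ._+_ (h k (here refl)) (sumᶻ-cong B λ j j∈ → h j (there j∈))

  sumᶻ-+ : ∀ {A : Set} (φ ψ : A → ℤ) B → sumᶻ (λ k → φ k ℤ.+ ψ k) B ≡ sumᶻ φ B ℤ.+ sumᶻ ψ B
  sumᶻ-+ φ ψ []      = refl
  sumᶻ-+ φ ψ (k ∷ B) = trans (cong (λ u → φ k ℤ.+ ψ k ℤ.+ u) (sumᶻ-+ φ ψ B)) (eq (φ k) (ψ k) _ _)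
    where
    eq : ∀ a b c d → a ℤ.+ b ℤ.+ (c ℤ.+ d) ≡ (a ℤ.+ c) ℤ.+ (b ℤ.+ d)
    eq = solve-∀

  sumᶻ-* : ∀ {A : Set} (φ : A → ℤ) c B → sumᶻ (λ k → φ k ℤ.* c) B ≡ sumᶻ φ B ℤ.* c
  sumᶻ-* φ c []      = refl
  sumᶻ-* φ c (k ∷ B) = trans (cong (λ u → φ k ℤ.* c ℤ.+ u) (sumᶻ-* φ c B)) (sym (ℤ.*-distribʳ-+ c (φ k) _))

  sumᶻ-0 : ∀ {A : Set} (B : List A) → sumᶻ (λ _ → 0ℤ) B ≡ 0ℤ
  sumᶻ-0 []      = refl
  sumᶻ-0 (k ∷ B) = trans (ℤ.+-identityˡ _) (sumᶻ-0 B)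

  sumᶻ-++ : ∀ {A : Set} (φ : A → ℤ) B C → sumᶻ φ (B ++ C) ≡ sumᶻ φ B ℤ.+ sumᶻ φ C
  sumᶻ-++ φ []      C = sym (ℤ.+-identityˡ _)
  sumᶻ-++ φ (k ∷ B) C = trans (cong (λ u → φ k ℤ.+ u) (sumᶻ-++ φ B C)) (sym (ℤ.+-assoc (φ k) _ _))

  sumᴿ-++ : ∀ {A : Set} (φ : A → Carrier) B C → sumᴿ φ (B ++ C) ≡ sumᴿ φ B + sumᴿ φ C
  sumᴿ-++ φ []      C = sym (+-identityˡ _)
  sumᴿ-++ φ (k ∷ B) C = trans (cong (λ u → φ k + u) (sumᴿ-++ φ B C)) (sym (+-assoc (φ k) _ _))

  if_≤_then_ : Carrier → Carrier → ℤ → ℤ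
  if t ≤ b then m with t ≤? b
  ... | yes _ = m
  ... | no  _ = 0ℤ

  if-≤ : ∀ {t b m} → t ≤ b → (if t ≤ b then m) ≡ m
  if-≤ {t} {b} p with t ≤? b
  ... | yes _ = refl
  ... | no ¬p = ⊥-elim (¬p p)

  if-> : ∀ {t b m} → b < t → (if t ≤ b then m) ≡ 0ℤ
  if-> {t} {b} p with t ≤? b
  ... | yes q = ⊥-elim (<⇒≱ p q)
  ... | no _  = refl

  ≤-or-> : ∀ t b → t ≤ b ⊎ b < t
  ≤-or-> t b with b <? t
  ... | yes p = inj₂ p
  ... | no ¬p = inj₁ (≮⇒≥ ¬p)

  -- Ramps and breaks along one edge

  module _ {e : Edge} where

    total : List (Break e) → ℤ
    total = sumᶻ multiplicity

    upto : Carrier → List (Break e) → ℤ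
    upto b = sumᶻ (λ k → if time k ≤ b then multiplicity k)

    ramps : Carrier → List (Break e) → Carrier
    ramps x = sumᴿ (λ k → ι (multiplicity k) * ramp (time k) x)

    -- A ramp that has started by `b` keeps its full slope up to `z`; one that starts at `z` or
    -- later is still 0 there.
    ramps-affine : ∀ b z B → b ≤ z → (∀ k → k ∈ B → time k ≤ b ⊎ b < time k × z ≤ time k) →
                   ramps z B ≡ ramps b B + ι (upto b B) * (z - b)
    ramps-affine b z []      b≤z h = solve 1 (λ u → con 0ℤ := con 0ℤ :+ con 0ℤ :* u) refl (z - b)
    ramps-affine b z (k ∷ B) b≤z h = begin
      ι m * ramp t z + ramps z B
        ≡⟨ cong₂ _+_ (term (h k (here refl))) (ramps-affine b z B b≤z λ j j∈ → h j (there j∈)) ⟩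
      (ι m * ramp t b + ι (if t ≤ b then m) * (z - b)) + (ramps b B + ι (upto b B) * (z - b))
        ≡⟨ solve 5 (λ a u r v w → (a :+ u :* w) :+ (r :+ v :* w) := (a :+ r) :+ (u :+ v) :* w) refl _ (ι (if t ≤ b then m)) _ (ι (upto b B)) (z - b) ⟩
      (ι m * ramp t b + ramps b B) + (ι (if t ≤ b then m) + ι (upto b B)) * (z - b)
        ≡⟨ cong (λ u → (ι m * ramp t b + ramps b B) + u * (z - b)) (sym (ι-+ (if t ≤ b then m) (upto b B))) ⟩
      (ι m * ramp t b + ramps b B) + ι (upto b (k ∷ B)) * (z - b) ∎
      where
      open ≡-Reasoning
      m = multiplicity k
      t = time k
      term : t ≤ b ⊎ b < t × z ≤ t → ι m * ramp t z ≡ ι m * ramp t b + ι (if t ≤ b then m) * (z - b)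
      term (inj₁ p) = trans (cong (ι m *_) (ramp-≥ (≤-trans p b≤z)))
        (trans (solve 4 (λ m z t b → m :* (z :- t) := m :* (b :- t) :+ m :* (z :- b)) refl (ι m) z t b)
          (sym (cong₂ (λ u v → ι m * u + ι v * (z - b)) (ramp-≥ p) (if-≤ p))))
      term (inj₂ (p , q)) = trans (cong (ι m *_) (ramp-≤ q))
        (trans (solve 2 (λ m w → m :* con 0ℤ := m :* con 0ℤ :+ con 0ℤ :* w) refl (ι m) (z - b))
          (sym (cong₂ (λ u v → ι m * u + ι v * (z - b)) (ramp-≤ (<⇒≤ p)) (if-> p))))

    torque : List (Break e) → Carrier
    torque = sumᴿ (λ k → ι (multiplicity k) * time k)

    -- Beyond all breaks the ramps add up to one affine function. Its constant term, minus the
    -- torque, is needed for the value at infinity.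
    ramps-beyond : ∀ x B → (∀ k → k ∈ B → time k ≤ x) → ramps x B ≡ ι (total B) * x - torque B
    ramps-beyond x []      h = solve 1 (λ x → con 0ℤ := con 0ℤ :* x :- con 0ℤ) refl x
    ramps-beyond x (k ∷ B) h = trans (cong₂ (λ u v → ι (multiplicity k) * u + v) (ramp-≥ (h k (here refl))) (ramps-beyond x B λ j j∈ → h j (there j∈)))
      (trans (solve 5 (λ m x t M T → m :* (x :- t) :+ (M :* x :- T) := (m :+ M) :* x :- (m :* t :+ T)) refl (ι (multiplicity k)) x (time k) (ι (total B)) (torque B))
        (cong (λ u → u * x - torque (k ∷ B)) (sym (ι-+ (multiplicity k) (total B)))))

    ramps-0 : ∀ B → ramps 0# B ≡ 0#
    ramps-0 []      = refl
    ramps-0 (k ∷ B) = trans (cong₂ (λ u v → ι (multiplicity k) * u + v) (ramp-≤ (0≤time k)) (ramps-0 B))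
                        (solve 1 (λ m → m :* con 0ℤ :+ con 0ℤ := con 0ℤ) refl (ι (multiplicity k)))

    upto-total : ∀ b B → (∀ k → k ∈ B → time k ≤ b) → upto b B ≡ total B
    upto-total b B h = sumᶻ-cong B λ k k∈ → if-≤ (h k k∈)

    -- The measure on which the subdivision of an edge terminates.
    count : Carrier → List (Break e) → ℕ
    count b []      = 0
    count b (k ∷ B) with b <? time k
    ... | yes _ = suc (count b B)
    ... | no _  = count b B

    count-mono : ∀ {b c} B → b ≤ c → count c B ℕ.≤ count b B
    count-mono []      p = ℕ.z≤n
    count-mono {b} {c} (k ∷ B) p with c <? time k | b <? time k
    ... | yes _ | yes _ = ℕ.s≤s (count-mono B p)
    ... | yes q | no ¬q = ⊥-elim (¬q (≤-<-trans p q))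
    ... | no _  | yes _ = ℕ.m≤n⇒m≤1+n (count-mono B p)
    ... | no _  | no _  = count-mono B p

    count-decreases : ∀ {b k} B → k ∈ B → b < time k → count (time k) B ℕ.< count b B
    count-decreases {b} {k} (_ ∷ B) (here refl) p with time k <? time k | b <? time k
    ... | yes q | _     = ⊥-elim (<-irrefl refl q)
    ... | no _  | yes _ = ℕ.s≤s (count-mono B (<⇒≤ p))
    ... | no _  | no ¬q = ⊥-elim (¬q p)
    count-decreases {b} {k} (j ∷ B) (there k∈) p with time k <? time j | b <? time j
    ... | yes _ | yes _ = ℕ.s≤s (count-decreases B k∈ p)
    ... | yes q | no ¬q = ⊥-elim (¬q (<-trans p q))
    ... | no _  | yes _ = ℕ.m≤n⇒m≤1+n (count-decreases B k∈ p)
    ... | no _  | no _  = count-decreases B k∈ p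

    nextBreak : ∀ b (B : List (Break e)) → (∀ k → k ∈ B → time k ≤ b) ⊎
                   (∃[ n ] n ∈ B × b < time n × ∀ k → k ∈ B → time k ≤ b ⊎ b < time k × time n ≤ time k)
    nextBreak b B with maximum-by (λ k → b <? time k) (λ k → - time k) B
    ... | inj₁ none = inj₁ λ k k∈ → ≮⇒≥ (none k k∈)
    ... | inj₂ (n , n∈ , b<n , max) = inj₂ (n , n∈ , b<n , λ k k∈ → cases k k∈ (≤-or-> (time k) b))
      where
      cases : ∀ k → k ∈ B → time k ≤ b ⊎ b < time k → time k ≤ b ⊎ b < time k × time n ≤ time k
      cases k k∈ (inj₁ p) = inj₁ p
      cases k k∈ (inj₂ p) = inj₂ (p , neg-cancel-≤ (max k k∈ p))

  data Kind {e : Edge} (x : Position Γ e) : Set where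
    inner : ∀ t → coord x ≡ [ t ] → [ t ] <⁺ len e → Kind x
    final : coord x ≡ len e → Kind x

  kind : ∀ {e} (x : Position Γ e) → Kind x
  kind {e} x = cases (coord x) (len e) refl refl (coord≤len′ x)
    where
    cases : ∀ c ℓ → coord x ≡ c → len e ≡ ℓ → c ≤⁺ ℓ → Kind x
    cases [ t ] [ ℓ ] p q NonStrict.[ inj₁ r ]    = inner t p (subst ([ t ] <⁺_) (sym q) Strict.[ r ])
    cases [ t ] [ ℓ ] p q NonStrict.[ inj₂ refl ] = final (trans p (sym q))
    cases [ t ] ⊤⁺    p q _                       = inner t p (subst ([ t ] <⁺_) (sym q) Strict.[ t ]<⊤⁺)
    cases ⊤⁺    ⊤⁺    p q _                       = final (trans p (sym q))

  breakOf : ∀ {e} → ℤ → (x : Position Γ e) → Kind x → List (Break e)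
  breakOf m x (inner t p q) = record { multiplicity = m ; place = x ; time = t ; place≡time = p ; time<len = q } ∷ []
  breakOf m x (final _)     = []

  breakOn : ∀ e {d} → ℤ → Position Γ d → Dec (d ≡ e) → List (Break e)
  breakOn e m x (yes refl) = breakOf m x (kind x)
  breakOn e m x (no _)     = []

  breaks₁ : ∀ e → ℤ → Point Γ → List (Break e)
  breaks₁ e m (vertex _) = []
  breaks₁ e m (on d x)   = breakOn e m x (d Fin.≟ e)

  breaks : ∀ e → Divisor Γ → List (Break e)
  breaks e []            = []
  breaks e ((m , q) ∷ G) = breaks₁ e m q ++ breaks e G

  -- A point at the far end is no break, so the left side is 0. On the right its own term and its
  -- share of the charge cancel, since it coincides with the target.
  breaks₁-coeff : ∀ e m q p →
    sumᶻ (λ k → multiplicity k ℤ.* [ on e (place k) at p ]) (breaks₁ e m q) ℤ.- total (breaks₁ e m q) ℤ.* [ vertex (tgt e) at p ] ≡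
    onEdge e (location q) ℤ.* (m ℤ.* [ q at p ]) ℤ.- (m ℤ.* onEdge e (location q)) ℤ.* [ vertex (tgt e) at p ]
  breaks₁-coeff e m (vertex v) p = eq m [ vertex (tgt e) at p ] [ vertex v at p ]
    where
    eq : ∀ m a b → 0ℤ ℤ.- 0ℤ ℤ.* a ≡ 0ℤ ℤ.* (m ℤ.* b) ℤ.- (m ℤ.* 0ℤ) ℤ.* a
    eq = solve-∀
  breaks₁-coeff e m (on d x) p with d Fin.≟ e
  ... | no _ = eq m [ vertex (tgt e) at p ] [ on d x at p ]
    where
    eq : ∀ m a b → 0ℤ ℤ.- 0ℤ ℤ.* a ≡ 0ℤ ℤ.* (m ℤ.* b) ℤ.- (m ℤ.* 0ℤ) ℤ.* a
    eq = solve-∀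
  ... | yes refl = cases (kind x)
    where
    eq₁ : ∀ m a b → (m ℤ.* b ℤ.+ 0ℤ) ℤ.- (m ℤ.+ 0ℤ) ℤ.* a ≡ 1ℤ ℤ.* (m ℤ.* b) ℤ.- (m ℤ.* 1ℤ) ℤ.* a
    eq₁ = solve-∀
    eq₂ : ∀ m a → 0ℤ ℤ.- 0ℤ ℤ.* a ≡ 1ℤ ℤ.* (m ℤ.* a) ℤ.- (m ℤ.* 1ℤ) ℤ.* a
    eq₂ = solve-∀
    cases : ∀ K → sumᶻ (λ k → multiplicity k ℤ.* [ on e (place k) at p ]) (breakOf m x K) ℤ.- total (breakOf m x K) ℤ.* [ vertex (tgt e) at p ] ≡
                  1ℤ ℤ.* (m ℤ.* [ on e x at p ]) ℤ.- (m ℤ.* 1ℤ) ℤ.* [ vertex (tgt e) at p ]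
    cases (inner t _ _) = eq₁ m [ vertex (tgt e) at p ] [ on e x at p ]
    cases (final q) = trans (eq₂ m [ vertex (tgt e) at p ])
      (cong (λ a → 1ℤ ℤ.* (m ℤ.* a) ℤ.- (m ℤ.* 1ℤ) ℤ.* [ vertex (tgt e) at p ]) (sym (at-cong (on e x) (vertex (tgt e)) p (locate-terminus x q))))

  breaks-coeff : ∀ e G p →
    sumᶻ (λ k → multiplicity k ℤ.* [ on e (place k) at p ]) (breaks e G) ℤ.- total (breaks e G) ℤ.* [ vertex (tgt e) at p ] ≡
    sumᶻ (λ (m , q) → onEdge e (location q) ℤ.* (m ℤ.* [ q at p ])) G ℤ.- charge e (chain G) ℤ.* [ vertex (tgt e) at p ]
  breaks-coeff e []            p = refl
  breaks-coeff e ((m , q) ∷ G) p = begin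
    sumᶻ φ (B ++ C) ℤ.- total (B ++ C) ℤ.* a
      ≡⟨ cong₂ (λ u v → u ℤ.- v ℤ.* a) (sumᶻ-++ φ B C) (sumᶻ-++ multiplicity B C) ⟩
    (sumᶻ φ B ℤ.+ sumᶻ φ C) ℤ.- (total B ℤ.+ total C) ℤ.* a
      ≡⟨ eq₁ (sumᶻ φ B) (sumᶻ φ C) (total B) (total C) a ⟩
    (sumᶻ φ B ℤ.- total B ℤ.* a) ℤ.+ (sumᶻ φ C ℤ.- total C ℤ.* a)
      ≡⟨ cong₂ ℤ._+_ (breaks₁-coeff e m q p) (breaks-coeff e G p) ⟩
    _ ≡⟨ sym (eq₁ (onEdge e (location q) ℤ.* (m ℤ.* [ q at p ])) _ (m ℤ.* onEdge e (location q)) (charge e (chain G)) a) ⟩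
    _ ∎
    where
    open ≡-Reasoning
    φ = λ k → multiplicity k ℤ.* [ on e (place k) at p ]
    B = breaks₁ e m q
    C = breaks e G
    a = [ vertex (tgt e) at p ]
    eq₁ : ∀ x y m n a → (x ℤ.+ y) ℤ.- (m ℤ.+ n) ℤ.* a ≡ (x ℤ.- m ℤ.* a) ℤ.+ (y ℤ.- n ℤ.* a)
    eq₁ = solve-∀

  ramps-breaks₁ : ∀ {e ℓ} → len e ≡ [ ℓ ] → ∀ m q → ramps ℓ (breaks₁ e m q) ≡ ι m * lever e (location q)
  ramps-breaks₁ {e} len≡ m (vertex v) = solve 2 (λ m f → con 0ℤ := m :* (con 0ℤ :* f)) refl (ι m) _
  ramps-breaks₁ {e} {ℓ} len≡ m (on d x) with d Fin.≟ e
  ... | no _ = solve 2 (λ m f → con 0ℤ := m :* (con 0ℤ :* f)) refl (ι m) _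
  ... | yes refl = cases (kind x)
    where
    open ≡-Reasoning
    cases : ∀ K → ramps ℓ (breakOf m x K) ≡ ι m * (ι 1ℤ * fromEnd (len e) (finitePart (coord x)))
    cases (inner t p q) = begin
      ι m * ramp t ℓ + 0#  ≡⟨ cong (λ u → ι m * u + 0#) (ramp-≥ t≤ℓ) ⟩
      ι m * (ℓ - t) + 0#  ≡⟨ solve 2 (λ m u → m :* u :+ con 0ℤ := m :* (con 1ℤ :* u)) refl (ι m) (ℓ - t) ⟩
      ι m * (ι 1ℤ * (ℓ - t))  ≡⟨ sym (cong₂ (λ L c → ι m * (ι 1ℤ * fromEnd L (finitePart c))) len≡ p) ⟩
      ι m * (ι 1ℤ * fromEnd (len e) (finitePart (coord x)))  ∎
      where
      t≤ℓ : t ≤ ℓ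
      t≤ℓ with subst ([ t ] <⁺_) len≡ q
      ... | Strict.[ r ] = <⇒≤ r
    cases (final q) = begin
      0#  ≡⟨ solve 2 (λ m u → con 0ℤ := m :* (con 1ℤ :* (u :- u))) refl (ι m) ℓ ⟩
      ι m * (ι 1ℤ * (ℓ - ℓ))  ≡⟨ sym (cong₂ (λ L c → ι m * (ι 1ℤ * fromEnd L (finitePart c))) len≡ (trans q len≡)) ⟩
      ι m * (ι 1ℤ * fromEnd (len e) (finitePart (coord x)))  ∎

  -- By the far end, a ramp has risen by exactly the lever of its point; points at the far end have
  -- lever 0.
  ramps-breaks : ∀ {e ℓ} → len e ≡ [ ℓ ] → ∀ G → ramps ℓ (breaks e G) ≡ moment e (chain G)
  ramps-breaks len≡ []            = refl
  ramps-breaks {e} {ℓ} len≡ ((m , q) ∷ G) = trans (sumᴿ-++ (λ k → ι (multiplicity k) * ramp (time k) ℓ) (breaks₁ e m q) (breaks e G))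
    (cong₂ _+_ (ramps-breaks₁ len≡ m q) (ramps-breaks len≡ G))

  -- The rational function belonging to a solution

  module _ (G : Divisor Γ) (s : Edge → ℤ) (h : Vertex → Carrier) (S : Solution (chain G) s h) where
    open Solution S

    private
      profile : Edge → Carrier → Carrier
      profile e x = h (src e) + ι (s e) * x + ramps x (breaks e G)

      finalSlope : Edge → ℤ
      finalSlope e = s e ℤ.+ total (breaks e G)

      -- Beyond all breaks the profile is affine with this constant term, so its limit is infinite
      -- unless the final slope is 0.
      limit : Edge → Carrier ±
      limit e = affine Γ 0# (h (src e) - torque (breaks e G)) (finalSlope e) ⊤⁺

      atVertexBy : ∀ v → Dec (∃ (IsEnd v)) → Carrier ±
      atVertexBy v (yes (e , _)) = limit e
      atVertexBy v (no _)        = [ h v ]±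

      -- The last clause never applies.
      evaluate : Vertex ⊎ (Edge × Carrier ⁺) → Carrier ±
      evaluate (inj₁ v)             = atVertexBy v (end? v)
      evaluate (inj₂ (e , [ x ]))   = [ profile e x ]±
      evaluate (inj₂ (e , ⊤⁺))      = [ 0# ]±

      -- Factoring through `locate` makes the values agree at coinciding points.
      valueAt : Point Γ → Carrier ±
      valueAt p = evaluate (locate Γ p)

      evaluate-inner : ∀ v → ¬ ∃ (IsEnd v) → evaluate (inj₁ v) ≡ [ h v ]±
      evaluate-inner v ¬end = cases (end? v)
        where
        cases : ∀ d → atVertexBy v d ≡ [ h v ]±
        cases (yes p) = ⊥-elim (¬end p)
        cases (no _)  = refl

      evaluate-end : ∀ e → len e ≡ ⊤⁺ → evaluate (inj₁ (tgt e)) ≡ limit e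
      evaluate-end e len≡ = cases (end? (tgt e))
        where
        cases : ∀ d → atVertexBy (tgt e) d ≡ limit e
        cases (yes (d , p , q)) = cong limit (sym (tgt-end p e (sym q)))
        cases (no ¬end)         = ⊥-elim (¬end (e , len≡ , refl))

      -- The values prescribed at vertices have to fit the profile. At the origin all ramps vanish;
      -- at a finite terminus the fit is the edge equation.
      value-on : ∀ {e} (x : Position Γ e) {t} → coord x ≡ [ t ] → valueAt (on e x) ≡ [ profile e t ]±
      value-on {e} x {t} x≡t = cases (≡-dec _≟_ (coord x) [ 0# ]) (≡-dec _≟_ (coord x) (len e))
        where
        open ≡-Reasoning
        cases : Dec (coord x ≡ [ 0# ]) → Dec (coord x ≡ len e) → valueAt (on e x) ≡ [ profile e t ]±
        cases (yes p) _ with trans (sym x≡t) p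
        ... | refl = trans (cong evaluate (locate-origin x p)) (trans (evaluate-inner (src e) (src-not-end e)) (cong [_]± (begin
          h (src e)  ≡⟨ solve 2 (λ h s → h := h :+ s :* con 0ℤ :+ con 0ℤ) refl _ (ι (s e)) ⟩
          h (src e) + ι (s e) * 0# + 0#  ≡⟨ cong (λ u → h (src e) + ι (s e) * 0# + u) (sym (ramps-0 (breaks e G))) ⟩
          profile e 0#  ∎)))
        cases (no _) (yes q) = trans (cong evaluate (locate-terminus x q)) (trans (evaluate-inner (tgt e) (tgt-not-end len≡)) (cong [_]± (begin
          h (tgt e)  ≡⟨ solve 2 (λ a b → a := b :+ (a :- b)) refl _ (h (src e)) ⟩
          h (src e) + (h (tgt e) - h (src e))
            ≡⟨ cong (λ u → h (src e) + u) (subst (λ L → EdgeEquation e L (s e) h (chain G)) len≡ (edges e)) ⟩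
          h (src e) + (ι (s e) * t + moment e (chain G))  ≡⟨ sym (+-assoc _ _ _) ⟩
          h (src e) + ι (s e) * t + moment e (chain G)
            ≡⟨ cong (λ u → h (src e) + ι (s e) * t + u) (sym (ramps-breaks len≡ G)) ⟩
          profile e t  ∎)))
          where
          len≡ : len e ≡ [ t ]
          len≡ = trans (sym q) x≡t
        cases (no ¬p) (no ¬q) = trans (cong evaluate (locate-interior x ¬p ¬q)) (cong (λ c → evaluate (inj₂ (e , c))) x≡t)

      value-at-⊤ : ∀ {e} (x : Position Γ e) → coord x ≡ ⊤⁺ → valueAt (on e x) ≡ limit e
      value-at-⊤ {e} x x≡⊤ = trans (cong evaluate (locate-terminus x (trans x≡⊤ (sym len≡)))) (evaluate-end e len≡)
        where
        len≡ : len e ≡ ⊤⁺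
        len≡ with len e | subst (_≤⁺ len e) x≡⊤ (coord≤len′ x)
        ... | ⊤⁺ | _ = refl

      profile-affine : ∀ e b z → b ≤ z → (∀ k → k ∈ breaks e G → time k ≤ b ⊎ b < time k × z ≤ time k) →
                       profile e z ≡ profile e b + (s e ℤ.+ upto b (breaks e G)) · (z - b)
      profile-affine e b z b≤z none = begin
        h (src e) + ι (s e) * z + ramps z B
          ≡⟨ cong (λ u → h (src e) + ι (s e) * z + u) (ramps-affine b z B b≤z none) ⟩
        h (src e) + ι (s e) * z + (ramps b B + ι (upto b B) * (z - b))
          ≡⟨ solve 6 (λ h s z r u b → h :+ s :* z :+ (r :+ u :* (z :- b)) := (h :+ s :* b :+ r) :+ (s :+ u) :* (z :- b)) refl (h (src e)) (ι (s e)) z (ramps b B) (ι (upto b B)) b ⟩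
        profile e b + (ι (s e) + ι (upto b B)) * (z - b)
          ≡⟨ cong (λ u → profile e b + u * (z - b)) (sym (ι-+ (s e) (upto b B))) ⟩
        profile e b + ι (s e ℤ.+ upto b B) * (z - b)
          ≡⟨ cong (λ u → profile e b + u) (sym (·≡ι* (s e ℤ.+ upto b B) (z - b))) ⟩
        profile e b + (s e ℤ.+ upto b B) · (z - b) ∎
        where
        open ≡-Reasoning
        B = breaks e G

      affine-⊤ : ∀ {a c a′ c′} k → (k ≡ 0ℤ → c ≡ c′) → affine Γ a c k ⊤⁺ ≡ affine Γ a′ c′ k ⊤⁺
      affine-⊤ (pos zero)    h = cong [_]± (h refl)
      affine-⊤ (pos (suc _)) h = refl
      affine-⊤ -[1+ _ ]      h = refl

      -- The last two hypotheses say that no break lies strictly between `b` and a point of the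
      -- piece, for finite points and for infinity respectively.
      mkPiece : ∀ {e} (x y : Position Γ e) b → coord x ≡ [ b ] → coord x <⁺ coord y →
                (∀ z → coord z ≤⁺ coord y → ∀ {t} → coord z ≡ [ t ] → ∀ k → k ∈ breaks e G → time k ≤ b ⊎ b < time k × t ≤ time k) →
                (∀ z → coord z ≤⁺ coord y → coord z ≡ ⊤⁺ → ∀ k → k ∈ breaks e G → time k ≤ b) → Piece Γ valueAt e x y
      mkPiece {e} x y b x≡b x<y none none⊤ = record
        { slope = slope ; a = b ; c = profile e b ; x≡a = x≡b ; x<y = x<y ; linear = λ z x≤z z≤y → linear z x≤z z≤y (coord z) refl }
        where
        B = breaks e G
        slope = s e ℤ.+ upto b B
        linear : ∀ z → coord x ≤⁺ coord z → coord z ≤⁺ coord y → ∀ c → coord z ≡ c → valueAt (on e z) ≡ affine Γ b (profile e b) slope (coord z)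
        linear z x≤z z≤y [ t ] z≡t = trans (value-on z z≡t) (trans (cong [_]± (profile-affine e b t b≤t (none z z≤y z≡t)))
                                       (cong (affine Γ b (profile e b) slope) (sym z≡t)))
          where
          b≤t : b ≤ t
          b≤t = NonStrict.[≤]-injective _ (subst₂ _≤⁺_ x≡b z≡t x≤z)
        linear z x≤z z≤y ⊤⁺ z≡⊤ = trans (value-at-⊤ z z≡⊤) (trans (trans
            (cong (λ k → affine Γ 0# (h (src e) - torque B) (s e ℤ.+ k) ⊤⁺) (sym (upto-total b B beyond)))
            (affine-⊤ slope flat)) (cong (affine Γ b (profile e b) slope) (sym z≡⊤)))
          where
          beyond : ∀ k → k ∈ B → time k ≤ b
          beyond = none⊤ z z≤y z≡⊤
          flat : slope ≡ 0ℤ → h (src e) - torque B ≡ profile e b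
          flat p = sym (begin
            h (src e) + ι (s e) * b + ramps b B  ≡⟨ cong (λ u → h (src e) + ι (s e) * b + u) (ramps-beyond b B beyond) ⟩
            h (src e) + ι (s e) * b + (ι (total B) * b - torque B)
              ≡⟨ solve 5 (λ h s b M T → h :+ s :* b :+ (M :* b :- T) := (h :- T) :+ (s :+ M) :* b) refl (h (src e)) (ι (s e)) b (ι (total B)) (torque B) ⟩
            (h (src e) - torque B) + (ι (s e) + ι (total B)) * b  ≡⟨ cong (λ u → (h (src e) - torque B) + u * b) (trans (sym (ι-+ (s e) (total B)))
                                                                              (cong ι (trans (cong (λ k → s e ℤ.+ k) (sym (upto-total b B beyond))) p))) ⟩
            (h (src e) - torque B) + 0# * b  ≡⟨ solve 2 (λ u b → u :+ con 0ℤ :* b := u) refl _ b ⟩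
            h (src e) - torque B  ∎)
            where open ≡-Reasoning

      later : ∀ {e} → Carrier → Point Γ → Break e → ℤ
      later {e} b p k = (multiplicity k ℤ.- (if time k ≤ b then multiplicity k)) ℤ.* [ on e (place k) at p ]

      -- The divisor of the edge from `x` onwards: the slope with which it leaves `x`, the breaks
      -- beyond `b`, and minus the final slope at the terminus.
      Subdivided : ∀ {e} (x : Position Γ e) → Carrier → Set
      Subdivided {e} x b = ∃[ Ps ] ∀ p → coeff Γ (piecesDiv Γ {f = valueAt} {e} {x} {terminus Γ e} Ps) p ≡
        (s e ℤ.+ upto b (breaks e G)) ℤ.* [ on e x at p ] ℤ.+ sumᶻ (later b p) (breaks e G) ℤ.- finalSlope e ℤ.* [ on e (terminus Γ e) at p ]

      coeff-piece : ∀ k q r p D → coeff Γ ((k , q) ∷ (ℤ.- k , r) ∷ D) p ≡ k ℤ.* [ q at p ] ℤ.- k ℤ.* [ r at p ] ℤ.+ coeff Γ D p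
      coeff-piece k q r p D = trans (coeff-∷ k q _ p) (trans (cong (λ u → k ℤ.* [ q at p ] ℤ.+ u) (coeff-∷ (ℤ.- k) r D p))
        (eq k [ q at p ] [ r at p ] _))
        where
        eq : ∀ k a b c → k ℤ.* a ℤ.+ (ℤ.- k ℤ.* b ℤ.+ c) ≡ k ℤ.* a ℤ.- k ℤ.* b ℤ.+ c
        eq = solve-∀

      -- All breaks at the time of `j` are passed together. They are exactly the ones counted by
      -- `upto` at that time but not at `b`, and they share the place of `j`.
      extend : ∀ {e} (x : Position Γ e) b → coord x ≡ [ b ] → (j : Break e) → b < time j →
               (∀ k → k ∈ breaks e G → time k ≤ b ⊎ b < time k × time j ≤ time k) → Subdivided (place j) (time j) → Subdivided x b
      extend {e} x b x≡b j b<j min (Ps , coeffs) = P ∷ Ps , λ p → begin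
          coeff Γ (pieceDiv Γ P ++ piecesDiv Γ Ps) p
            ≡⟨ coeff-piece slope (on e x) (on e (place j)) p (piecesDiv Γ Ps) ⟩
          slope ℤ.* [ on e x at p ] ℤ.- slope ℤ.* [ on e (place j) at p ] ℤ.+ coeff Γ (piecesDiv Γ Ps) p
            ≡⟨ cong (λ u → slope ℤ.* [ on e x at p ] ℤ.- slope ℤ.* [ on e (place j) at p ] ℤ.+ u) (coeffs p) ⟩
          _ ≡⟨ eq (s e) (upto b B) (upto t B) [ on e x at p ] [ on e (place j) at p ] (sumᶻ (later t p) B) (finalSlope e ℤ.* [ on e (terminus Γ e) at p ]) ⟩
          slope ℤ.* [ on e x at p ] ℤ.+ ((upto t B ℤ.- upto b B) ℤ.* [ on e (place j) at p ] ℤ.+ sumᶻ (later t p) B) ℤ.- finalSlope e ℤ.* [ on e (terminus Γ e) at p ]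
            ≡⟨ cong (λ u → slope ℤ.* [ on e x at p ] ℤ.+ u ℤ.- finalSlope e ℤ.* [ on e (terminus Γ e) at p ]) (sym (split p)) ⟩
          slope ℤ.* [ on e x at p ] ℤ.+ sumᶻ (later b p) B ℤ.- finalSlope e ℤ.* [ on e (terminus Γ e) at p ] ∎
        where
        open ≡-Reasoning
        B = breaks e G
        t = time j
        none : ∀ z → coord z ≤⁺ coord (place j) → ∀ {u} → coord z ≡ [ u ] → ∀ k → k ∈ B → time k ≤ b ⊎ b < time k × u ≤ time k
        none z z≤j z≡u k k∈ with min k k∈
        ... | inj₁ p       = inj₁ p
        ... | inj₂ (p , q) = inj₂ (p , ≤-trans (NonStrict.[≤]-injective _ (subst₂ _≤⁺_ z≡u (place≡time j) z≤j)) q)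
        none⊤ : ∀ (z : Position Γ e) → coord z ≤⁺ coord (place j) → coord z ≡ ⊤⁺ → ∀ k → k ∈ B → time k ≤ b
        none⊤ z z≤j z≡⊤ with subst₂ _≤⁺_ z≡⊤ (place≡time j) z≤j
        ... | ()
        P : Piece Γ valueAt e x (place j)
        P = mkPiece x (place j) b x≡b (subst₂ _<⁺_ (sym x≡b) (sym (place≡time j)) Strict.[ b<j ]) none none⊤
        slope = Piece.slope P
        eq : ∀ s u v x y l f → (s ℤ.+ u) ℤ.* x ℤ.- (s ℤ.+ u) ℤ.* y ℤ.+ ((s ℤ.+ v) ℤ.* y ℤ.+ l ℤ.- f) ≡
                               (s ℤ.+ u) ℤ.* x ℤ.+ ((v ℤ.- u) ℤ.* y ℤ.+ l) ℤ.- f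
        eq = solve-∀
        split₁ : ∀ p k → k ∈ B → later b p k ≡ ((if time k ≤ t then multiplicity k) ℤ.+ ℤ.- (if time k ≤ b then multiplicity k)) ℤ.* [ on e (place j) at p ] ℤ.+ later t p k
        split₁ p k k∈ with min k k∈
        ... | inj₁ r = trans (cong (λ u → (m ℤ.- u) ℤ.* c) (if-≤ r)) (trans (eq₁ m a c)
                (sym (cong₂ (λ u v → (u ℤ.+ ℤ.- v) ℤ.* a ℤ.+ (m ℤ.- u) ℤ.* c) (if-≤ (≤-trans r (<⇒≤ b<j))) (if-≤ r))))
          where
          m = multiplicity k
          a = [ on e (place j) at p ]
          c = [ on e (place k) at p ]
          eq₁ : ∀ m a c → (m ℤ.- m) ℤ.* c ≡ (m ℤ.+ ℤ.- m) ℤ.* a ℤ.+ (m ℤ.- m) ℤ.* c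
          eq₁ = solve-∀
        ... | inj₂ (r , inj₁ t<k) = trans (cong (λ u → (m ℤ.- u) ℤ.* c) (if-> r)) (trans (eq₁ m a c)
                (sym (cong₂ (λ u v → (u ℤ.+ ℤ.- v) ℤ.* a ℤ.+ (m ℤ.- u) ℤ.* c) (if-> t<k) (if-> r))))
          where
          m = multiplicity k
          a = [ on e (place j) at p ]
          c = [ on e (place k) at p ]
          eq₁ : ∀ m a c → (m ℤ.- 0ℤ) ℤ.* c ≡ (0ℤ ℤ.+ ℤ.- 0ℤ) ℤ.* a ℤ.+ (m ℤ.- 0ℤ) ℤ.* c
          eq₁ = solve-∀
        ... | inj₂ (r , inj₂ t≡k) = trans (cong₂ (λ u v → (m ℤ.- u) ℤ.* [ on e v at p ]) (if-> r) (position-≡ (place k) (place j) same)) (trans (eq₁ m a c)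
                (sym (cong₂ (λ u v → (u ℤ.+ ℤ.- v) ℤ.* a ℤ.+ (m ℤ.- u) ℤ.* c) (if-≤ (inj₂ (sym t≡k))) (if-> r))))
          where
          m = multiplicity k
          a = [ on e (place j) at p ]
          c = [ on e (place k) at p ]
          same : coord (place k) ≡ coord (place j)
          same = trans (place≡time k) (trans (cong [_] (sym t≡k)) (sym (place≡time j)))
          eq₁ : ∀ m a c → (m ℤ.- 0ℤ) ℤ.* a ≡ (m ℤ.+ ℤ.- 0ℤ) ℤ.* a ℤ.+ (m ℤ.- m) ℤ.* c
          eq₁ = solve-∀
        split : ∀ p → sumᶻ (later b p) B ≡ (upto t B ℤ.- upto b B) ℤ.* [ on e (place j) at p ] ℤ.+ sumᶻ (later t p) B
        split p = begin
          sumᶻ (later b p) B ≡⟨ sumᶻ-cong B (split₁ p) ⟩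
          sumᶻ (λ k → (U k ℤ.+ ℤ.- V k) ℤ.* a ℤ.+ later t p k) B
            ≡⟨ sumᶻ-+ (λ k → (U k ℤ.+ ℤ.- V k) ℤ.* a) (later t p) B ⟩
          sumᶻ (λ k → (U k ℤ.+ ℤ.- V k) ℤ.* a) B ℤ.+ sumᶻ (later t p) B
            ≡⟨ cong (λ u → u ℤ.+ sumᶻ (later t p) B) (trans (sumᶻ-* (λ k → U k ℤ.+ ℤ.- V k) a B)
                 (cong (λ u → u ℤ.* a) (trans (sumᶻ-+ U (λ k → ℤ.- V k) B) (cong (λ u → sumᶻ U B ℤ.+ u) (sumᶻ-neg V B))))) ⟩
          (upto t B ℤ.- upto b B) ℤ.* a ℤ.+ sumᶻ (later t p) B ∎
          where
          a = [ on e (place j) at p ]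
          U V : Break e → ℤ
          U k = if time k ≤ t then multiplicity k
          V k = if time k ≤ b then multiplicity k
          sumᶻ-neg : ∀ (φ : Break e → ℤ) B → sumᶻ (λ k → ℤ.- φ k) B ≡ ℤ.- sumᶻ φ B
          sumᶻ-neg φ []      = refl
          sumᶻ-neg φ (k ∷ B) = trans (cong (λ u → ℤ.- φ k ℤ.+ u) (sumᶻ-neg φ B)) (sym (ℤ.neg-distrib-+ (φ k) _))

      subdivide : ∀ {e} n (x : Position Γ e) b → coord x ≡ [ b ] → [ b ] <⁺ len e → count b (breaks e G) ℕ.≤ n → Subdivided x b
      subdivide {e} n x b x≡b b<len c≤n with nextBreak b (breaks e G)
      ... | inj₁ none = [ P ]ᵀ , λ p → trans (coeff-piece slope (on e x) (on e (terminus Γ e)) p [])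
              (trans (eq slope [ on e x at p ] [ on e (terminus Γ e) at p ])
                (cong₂ (λ u v → slope ℤ.* [ on e x at p ] ℤ.+ u ℤ.- v ℤ.* [ on e (terminus Γ e) at p ])
                  (sym (trans (sumᶻ-cong B (past p)) (sumᶻ-0 B))) (cong (λ k → s e ℤ.+ k) (upto-total b B none))))
        where
        B = breaks e G
        P : Piece Γ valueAt e x (terminus Γ e)
        P = mkPiece x (terminus Γ e) b x≡b (subst (_<⁺ len e) (sym x≡b) b<len) (λ _ _ _ k k∈ → inj₁ (none k k∈)) (λ _ _ _ → none)
        slope = Piece.slope P
        past : ∀ p k → k ∈ B → later b p k ≡ 0ℤ
        past p k k∈ = trans (cong (λ u → (multiplicity k ℤ.- u) ℤ.* [ on e (place k) at p ]) (if-≤ (none k k∈)))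
                           (cong (λ u → u ℤ.* [ on e (place k) at p ]) (ℤ.+-inverseʳ (multiplicity k)))
        eq : ∀ k a b → k ℤ.* a ℤ.- k ℤ.* b ℤ.+ 0ℤ ≡ k ℤ.* a ℤ.+ 0ℤ ℤ.- k ℤ.* b
        eq = solve-∀
      subdivide {e} zero x b x≡b b<len c≤n | inj₂ (j , j∈ , b<j , min) =
        ⊥-elim (ℕ.n≮0 (ℕ.<-≤-trans (count-decreases (breaks e G) j∈ b<j) c≤n))
      subdivide {e} (suc n) x b x≡b b<len c≤n | inj₂ (j , j∈ , b<j , min) = extend x b x≡b j b<j min
        (subdivide n (place j) (time j) (place≡time j) (time<len j)
          (ℕ.≤-pred (ℕ.≤-trans (count-decreases (breaks e G) j∈ b<j) c≤n)))

      subdivision : ∀ e → Subdivided (origin Γ e) 0#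
      subdivision e = subdivide (count 0# (breaks e G)) (origin Γ e) 0# refl (len-pos e) ℕ.≤-refl

    rationalFunction : RationalFunction Γ
    rationalFunction = record
      { value    = valueAt
      ; respects = λ h → cong evaluate h
      ; finite   = λ p → finite p (locate Γ p) refl
      ; pieces   = λ e → proj₁ (subdivision e) }
      where
      finite : ∀ p l → locate Γ p ≡ l → ¬ UnboundedEnd Γ p → ∃[ c ] valueAt p ≡ [ c ]±
      finite p (inj₁ v) eq bounded = h v , trans (cong evaluate eq) (evaluate-inner v λ (e , q , r) →
        bounded (e , q , trans eq (trans (cong inj₁ (sym r)) (sym (terminus≈tgt e)))))
      finite p (inj₂ (e , [ t ])) eq bounded = _ , cong evaluate eq
      finite p (inj₂ (e , ⊤⁺))    eq bounded = _ , cong evaluate eq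

    private
      -- Breaks at time 0 already belong to the first slope and, together with the later ones,
      -- exhaust all breaks. What remains is the flow through `e` for the indicator of the vertices
      -- coinciding with `p`, plus the points of `G` on `e`.
      coeff-edge : ∀ e p → coeff Γ (piecesDiv Γ (proj₁ (subdivision e))) p ≡
        ([ vertex (src e) at p ] ℤ.* s e ℤ.- [ vertex (tgt e) at p ] ℤ.* (s e ℤ.+ charge e (chain G))) ℤ.+
        sumᶻ (λ (m , q) → onEdge e (location q) ℤ.* (m ℤ.* [ q at p ])) G
      coeff-edge e p = begin
        coeff Γ (piecesDiv Γ (proj₁ (subdivision e))) p
          ≡⟨ proj₂ (subdivision e) p ⟩
        (s e ℤ.+ upto 0# B) ℤ.* [ on e (origin Γ e) at p ] ℤ.+ sumᶻ (later 0# p) B ℤ.- finalSlope e ℤ.* [ on e (terminus Γ e) at p ]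
          ≡⟨ cong (λ u → (s e ℤ.+ upto 0# B) ℤ.* [ on e (origin Γ e) at p ] ℤ.+ sumᶻ (later 0# p) B ℤ.- finalSlope e ℤ.* u)
               (at-cong (on e (terminus Γ e)) (vertex (tgt e)) p (terminus≈tgt e)) ⟩
        (s e ℤ.+ upto 0# B) ℤ.* [ on e (origin Γ e) at p ] ℤ.+ sumᶻ (later 0# p) B ℤ.- finalSlope e ℤ.* z
          ≡⟨ eq₁ (s e) (upto 0# B) [ on e (origin Γ e) at p ] (sumᶻ (later 0# p) B) (total B) z ⟩
        s e ℤ.* [ on e (origin Γ e) at p ] ℤ.+ (upto 0# B ℤ.* [ on e (origin Γ e) at p ] ℤ.+ sumᶻ (later 0# p) B ℤ.- total B ℤ.* z) ℤ.- s e ℤ.* z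
          ≡⟨ cong₂ (λ u v → s e ℤ.* u ℤ.+ (v ℤ.- total B ℤ.* z) ℤ.- s e ℤ.* z) (at-cong (on e (origin Γ e)) (vertex (src e)) p (origin≈src e)) merge ⟩
        s e ℤ.* a ℤ.+ (sumᶻ (λ k → multiplicity k ℤ.* [ on e (place k) at p ]) B ℤ.- total B ℤ.* z) ℤ.- s e ℤ.* z
          ≡⟨ cong (λ u → s e ℤ.* a ℤ.+ u ℤ.- s e ℤ.* z) (breaks-coeff e G p) ⟩
        s e ℤ.* a ℤ.+ (R ℤ.- charge e (chain G) ℤ.* z) ℤ.- s e ℤ.* z
          ≡⟨ eq₂ (s e) a R (charge e (chain G)) z ⟩
        (a ℤ.* s e ℤ.- z ℤ.* (s e ℤ.+ charge e (chain G))) ℤ.+ R ∎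
        where
        open ≡-Reasoning
        B = breaks e G
        a = [ vertex (src e) at p ]
        z = [ vertex (tgt e) at p ]
        R = sumᶻ (λ (m , q) → onEdge e (location q) ℤ.* (m ℤ.* [ q at p ])) G
        eq₁ : ∀ s u o l t z → (s ℤ.+ u) ℤ.* o ℤ.+ l ℤ.- (s ℤ.+ t) ℤ.* z ≡ s ℤ.* o ℤ.+ (u ℤ.* o ℤ.+ l ℤ.- t ℤ.* z) ℤ.- s ℤ.* z
        eq₁ = solve-∀
        eq₂ : ∀ s a r c z → s ℤ.* a ℤ.+ (r ℤ.- c ℤ.* z) ℤ.- s ℤ.* z ≡ (a ℤ.* s ℤ.- z ℤ.* (s ℤ.+ c)) ℤ.+ r
        eq₂ = solve-∀
        o = [ on e (origin Γ e) at p ]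
        merge₁ : ∀ k → (if time k ≤ 0# then multiplicity k) ℤ.* o ℤ.+ later 0# p k ≡ multiplicity k ℤ.* [ on e (place k) at p ]
        merge₁ k with ≤-or-> (time k) 0#
        ... | inj₁ r = trans (cong₂ (λ u v → u ℤ.* [ on e v at p ] ℤ.+ (multiplicity k ℤ.- u) ℤ.* [ on e (place k) at p ]) (if-≤ r)
                         (position-≡ (origin Γ e) (place k) (trans (cong [_] (≤-antisym (0≤time k) r)) (sym (place≡time k)))))
                         (eq (multiplicity k) [ on e (place k) at p ])
          where
          eq : ∀ m c → m ℤ.* c ℤ.+ (m ℤ.- m) ℤ.* c ≡ m ℤ.* c
          eq = solve-∀
        ... | inj₂ r = trans (cong (λ u → u ℤ.* o ℤ.+ (multiplicity k ℤ.- u) ℤ.* [ on e (place k) at p ]) (if-> r)) (eq (multiplicity k) o [ on e (place k) at p ])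
          where
          eq : ∀ m o c → 0ℤ ℤ.* o ℤ.+ (m ℤ.- 0ℤ) ℤ.* c ≡ m ℤ.* c
          eq = solve-∀
        merge : upto 0# B ℤ.* o ℤ.+ sumᶻ (later 0# p) B ≡ sumᶻ (λ k → multiplicity k ℤ.* [ on e (place k) at p ]) B
        merge = trans (cong (λ u → u ℤ.+ sumᶻ (later 0# p) B) (sym (sumᶻ-* (λ k → if time k ≤ 0# then multiplicity k) o B)))
          (trans (sym (sumᶻ-+ (λ k → (if time k ≤ 0# then multiplicity k) ℤ.* o) (later 0# p) B)) (sumᶻ-cong B λ k _ → merge₁ k))

      coeff-concat : ∀ {n} (D : Fin n → Divisor Γ) p → coeff Γ (concat (tabulate D)) p ≡ sum (λ i → coeff Γ (D i) p)
      coeff-concat {zero}  D p = refl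
      coeff-concat {suc n} D p = trans (coeff-++ (D zero) _ p) (cong (λ u → coeff Γ (D zero) p ℤ.+ u) (coeff-concat (D ∘ suc) p))

      -- Each point lies at exactly one vertex or on exactly one edge.
      distribute : ∀ H p → ⟨ (λ l → sum (λ v → [ vertex v at p ] ℤ.* atVertex v l)) , chain H ⟩ ℤ.+
                           sum (λ e → sumᶻ (λ (m , q) → onEdge e (location q) ℤ.* (m ℤ.* [ q at p ])) H) ≡ coeff Γ H p
      distribute []            p = trans (ℤ.+-identityˡ _) (sum-zero {#edges} _ λ _ → refl)
      distribute ((m , q) ∷ H) p = begin
        m ℤ.* w (location q) ℤ.+ ⟨ w , chain H ⟩ ℤ.+ sum (λ e → onEdge e (location q) ℤ.* (m ℤ.* [ q at p ]) ℤ.+ r e)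
          ≡⟨ cong (λ u → m ℤ.* w (location q) ℤ.+ ⟨ w , chain H ⟩ ℤ.+ u) (∑-distrib-+ (λ e → onEdge e (location q) ℤ.* (m ℤ.* [ q at p ])) r) ⟩
        m ℤ.* w (location q) ℤ.+ ⟨ w , chain H ⟩ ℤ.+ (sum (λ e → onEdge e (location q) ℤ.* (m ℤ.* [ q at p ])) ℤ.+ sum r)
          ≡⟨ eq (m ℤ.* w (location q)) ⟨ w , chain H ⟩ _ (sum r) ⟩
        (m ℤ.* w (location q) ℤ.+ sum (λ e → onEdge e (location q) ℤ.* (m ℤ.* [ q at p ]))) ℤ.+ (⟨ w , chain H ⟩ ℤ.+ sum r)
          ≡⟨ cong₂ ℤ._+_ (single q) (distribute H p) ⟩
        m ℤ.* [ q at p ] ℤ.+ coeff Γ H p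
          ≡⟨ sym (coeff-∷ m q H p) ⟩
        coeff Γ ((m , q) ∷ H) p ∎
        where
        open ≡-Reasoning
        w : Location → ℤ
        w l = sum (λ v → [ vertex v at p ] ℤ.* atVertex v l)
        r : Edge → ℤ
        r e = sumᶻ (λ (m , q) → onEdge e (location q) ℤ.* (m ℤ.* [ q at p ])) H
        eq : ∀ a b c d → a ℤ.+ b ℤ.+ (c ℤ.+ d) ≡ (a ℤ.+ c) ℤ.+ (b ℤ.+ d)
        eq = solve-∀
        single : ∀ q → m ℤ.* w (location q) ℤ.+ sum (λ e → onEdge e (location q) ℤ.* (m ℤ.* [ q at p ])) ≡ m ℤ.* [ q at p ]
        single (vertex v) = trans (cong₂ (λ a b → m ℤ.* a ℤ.+ b) (sum-δ (λ u → [ vertex u at p ]) v) (sum-zero {#edges} _ λ _ → refl)) (ℤ.+-identityʳ _)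
        single (on d x) = trans (cong₂ (λ a b → m ℤ.* a ℤ.+ b) (sum-zero _ λ v → ℤ.*-zeroʳ [ vertex v at p ])
            (trans (sum-cong-≗ λ e → ℤ.*-comm (δ d e) _) (sum-δ (λ _ → m ℤ.* [ on d x at p ]) d)))
          (trans (cong (λ u → u ℤ.+ m ℤ.* [ on d x at p ]) (ℤ.*-zeroʳ m)) (ℤ.+-identityˡ _))

    -- `sum-through`, with the indicator of the vertices coinciding with `p`, converts the flows on
    -- the edges into the part of `G` placed at vertices.
    div-rationalFunction : _≐_ Γ G (div Γ rationalFunction)
    div-rationalFunction p = sym (begin
      coeff Γ (div Γ rationalFunction) p
        ≡⟨ coeff-concat (λ e → piecesDiv Γ (proj₁ (subdivision e))) p ⟩
      sum (λ e → coeff Γ (piecesDiv Γ (proj₁ (subdivision e))) p)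
        ≡⟨ sum-cong-≗ (λ e → coeff-edge e p) ⟩
      sum (λ e → through (chain G) s h S χ e ℤ.+ R e)
        ≡⟨ ∑-distrib-+ (through (chain G) s h S χ) R ⟩
      sum (through (chain G) s h S χ) ℤ.+ sum R
        ≡⟨ cong (λ u → u ℤ.+ sum R) (trans (sum-through (chain G) s h S χ) (sum-⟨⟩ χ atVertex (chain G))) ⟩
      ⟨ (λ l → sum (λ v → χ v ℤ.* atVertex v l)) , chain G ⟩ ℤ.+ sum R
        ≡⟨ distribute G p ⟩
      coeff Γ G p ∎)
      where
      open ≡-Reasoning
      χ : Vertex → ℤ
      χ v = [ vertex v at p ]
      R : Edge → ℤ
      R e = sumᶻ (λ (m , q) → onEdge e (location q) ℤ.* (m ℤ.* [ q at p ])) G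

-- Linear systems

module LinearSystems {ℝ : Reals} (Γ : TropicalCurve ℝ) where
  open OrderedField ℝ
  open TropicalCurve Γ
  open Solvability Γ
  open SlopeBound Γ
  open Divisors Γ
  open Necessity Γ
  open Sufficiency Γ

  points : List (Point Γ) → Divisor Γ
  points = map (1ℤ ,_)

  coeff-replicate : ∀ k p q → coeff Γ (points (replicate k p)) q ≡ pos k ℤ.* [ p at q ]
  coeff-replicate zero    p q = refl
  coeff-replicate (suc k) p q = trans (coeff-∷ 1ℤ p (points (replicate k p)) q) (trans
    (cong (λ u → 1ℤ ℤ.* [ p at q ] ℤ.+ u) (coeff-replicate k p q)) (sym (ℤ.*-distribʳ-+ [ p at q ] 1ℤ (pos k))))

  points-++ : ∀ ps qs → points (ps ++ qs) ≡ points ps ++ points qs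
  points-++ = map-++ (1ℤ ,_)

  coeff-points : ∀ ps q → 0ℤ ℤ.≤ coeff Γ (points ps) q
  coeff-points []       q = ℤ.≤-refl
  coeff-points (p ∷ ps) q with _≈?_ Γ p q
  ... | yes _ = ℤ.+-mono-≤ {0ℤ} {1ℤ} (ℤ.+≤+ ℕ.z≤n) (coeff-points ps q)
  ... | no _  = coeff-points ps q

  deg-points : ∀ ps → deg Γ (points ps) ≡ pos (length ps)
  deg-points []       = refl
  deg-points (p ∷ ps) = cong (λ u → 1ℤ ℤ.+ u) (deg-points ps)

  deg-outside : ∀ p D → deg Γ D ≡ coeff Γ D p ℤ.+ deg Γ (outside p D)
  deg-outside p [] = refl
  deg-outside p ((m , q) ∷ D) with _≈?_ Γ q p
  ... | yes _ = trans (cong (λ u → m ℤ.+ u) (deg-outside p D)) (sym (ℤ.+-assoc m _ _))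
  ... | no _  = trans (cong (λ u → m ℤ.+ u) (deg-outside p D)) (eq m (coeff Γ D p) _)
    where
    eq : ∀ m c d → m ℤ.+ (c ℤ.+ d) ≡ c ℤ.+ (m ℤ.+ d)
    eq = solve-∀

  -- The first point is gathered; its total coefficient is nonnegative even if single entries are
  -- not, and is written out as copies of the point.
  effective-points : ∀ D → Effective Γ D → ∃[ ps ] _≐_ Γ D (points ps) × deg Γ D ≡ pos (length ps)
  effective-points D = go (length D) D ℕ.≤-refl
    where
    go : ∀ n D → length D ℕ.≤ n → Effective Γ D → ∃[ ps ] _≐_ Γ D (points ps) × deg Γ D ≡ pos (length ps)
    go _ [] _ _ = [] , (λ _ → refl) , refl
    go (suc n) D@((m , p) ∷ D′) (ℕ.s≤s l) eff = combine (coeff Γ D p) refl (eff p)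
      where
      rest-effective : Effective Γ (outside p D)
      rest-effective q with _≈?_ Γ q p
      ... | yes q≈p = ℤ.≤-reflexive (sym (coeff-outside-≈ p D q q≈p))
      ... | no q≉p  = subst (0ℤ ℤ.≤_) (sym (coeff-outside-≉ p D q q≉p)) (eff q)
      combine : ∀ c → coeff Γ D p ≡ c → 0ℤ ℤ.≤ c → ∃[ ps ] _≐_ Γ D (points ps) × deg Γ D ≡ pos (length ps)
      combine (pos k) c≡ _ with go n (outside p D) (ℕ.≤-trans (length-outside-∷ m p D′) l) rest-effective
      ... | ps , D≐ , deg≡ = replicate k p ++ ps ,
            (λ q → begin
              coeff Γ D q  ≡⟨ coeff-outside p D q ⟩
              coeff Γ D p ℤ.* [ p at q ] ℤ.+ coeff Γ (outside p D) q  ≡⟨ cong₂ (λ c u → c ℤ.* [ p at q ] ℤ.+ u) c≡ (D≐ q) ⟩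
              pos k ℤ.* [ p at q ] ℤ.+ coeff Γ (points ps) q
                ≡⟨ cong (λ u → u ℤ.+ coeff Γ (points ps) q) (sym (coeff-replicate k p q)) ⟩
              coeff Γ (points (replicate k p)) q ℤ.+ coeff Γ (points ps) q
                ≡⟨ sym (coeff-++ (points (replicate k p)) (points ps) q) ⟩
              coeff Γ (points (replicate k p) ++ points ps) q
                ≡⟨ cong (λ E → coeff Γ E q) (sym (points-++ (replicate k p) ps)) ⟩
              coeff Γ (points (replicate k p ++ ps)) q  ∎) ,
            (begin
              deg Γ D  ≡⟨ deg-outside p D ⟩
              coeff Γ D p ℤ.+ deg Γ (outside p D)  ≡⟨ cong₂ ℤ._+_ c≡ deg≡ ⟩
              pos (k ℕ.+ length ps)  ≡⟨ cong (λ j → pos (j ℕ.+ length ps)) (sym (length-replicate k)) ⟩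
              pos (length (replicate k p) ℕ.+ length ps)  ≡⟨ cong pos (sym (length-++ (replicate k p))) ⟩
              pos (length (replicate k p ++ ps))  ∎)
        where open ≡-Reasoning

  ⟨1⟩-deg : ∀ D → ⟨ (λ _ → 1ℤ) , chain D ⟩ ≡ deg Γ D
  ⟨1⟩-deg []            = refl
  ⟨1⟩-deg ((m , p) ∷ D) = cong₂ ℤ._+_ (ℤ.*-identityʳ m) (⟨1⟩-deg D)

  -- With the constant weight 1, each edge contributes minus its charge to the total flow, which
  -- cancels the points on edges.
  Solvable-degree : ∀ G → Solvable G → ⟨ (λ _ → 1ℤ) , G ⟩ ≡ 0ℤ
  Solvable-degree G (s , h , S) = begin
    ⟨ (λ _ → 1ℤ) , G ⟩
      ≡⟨ decompose G ⟩
    sum (λ v → 1ℤ ℤ.* ⟨ atVertex v , G ⟩) ℤ.+ sum (λ e → 1ℤ ℤ.* charge e G)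
      ≡⟨ cong (λ u → u ℤ.+ sum (λ e → 1ℤ ℤ.* charge e G)) (sym (sum-through G s h S (λ _ → 1ℤ))) ⟩
    sum (through G s h S (λ _ → 1ℤ)) ℤ.+ sum (λ e → 1ℤ ℤ.* charge e G)
      ≡⟨ sym (∑-distrib-+ (through G s h S (λ _ → 1ℤ)) (λ e → 1ℤ ℤ.* charge e G)) ⟩
    sum (λ e → through G s h S (λ _ → 1ℤ) e ℤ.+ 1ℤ ℤ.* charge e G)
      ≡⟨ sum-zero _ (λ e → eq (s e) (charge e G)) ⟩
    0ℤ ∎
    where
    open ≡-Reasoning
    eq : ∀ s c → (1ℤ ℤ.* s ℤ.- 1ℤ ℤ.* (s ℤ.+ c)) ℤ.+ 1ℤ ℤ.* c ≡ 0ℤ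
    eq = solve-∀
    weight : ∀ l → sum (λ v → 1ℤ ℤ.* atVertex v l) ℤ.+ sum (λ e → 1ℤ ℤ.* onEdge e l) ≡ 1ℤ
    weight (inj₁ v , _) = cong₂ ℤ._+_ (sum-δ (λ _ → 1ℤ) v) (sum-zero {#edges} _ λ _ → refl)
    weight (inj₂ e , _) = cong₂ ℤ._+_ (sum-zero {#vertices} _ λ _ → refl) (sum-δ (λ _ → 1ℤ) e)
    combine : ∀ (u v : Location → ℤ) G → (∀ l → u l ℤ.+ v l ≡ 1ℤ) → ⟨ (λ _ → 1ℤ) , G ⟩ ≡ ⟨ u , G ⟩ ℤ.+ ⟨ v , G ⟩
    combine u v []            h = refl
    combine u v ((m , l) ∷ G) h = trans (cong₂ (λ a b → m ℤ.* a ℤ.+ b) (sym (h l)) (combine u v G h)) (eq′ m (u l) (v l) _ _)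
      where
      eq′ : ∀ m a b c d → m ℤ.* (a ℤ.+ b) ℤ.+ (c ℤ.+ d) ≡ (m ℤ.* a ℤ.+ c) ℤ.+ (m ℤ.* b ℤ.+ d)
      eq′ = solve-∀
    decompose : ∀ G → ⟨ (λ _ → 1ℤ) , G ⟩ ≡ sum (λ v → 1ℤ ℤ.* ⟨ atVertex v , G ⟩) ℤ.+ sum (λ e → 1ℤ ℤ.* charge e G)
    decompose G = trans (combine _ _ G weight) (sym (cong₂ ℤ._+_ (sum-⟨⟩ (λ _ → 1ℤ) atVertex G) (sum-⟨⟩ (λ _ → 1ℤ) onEdge G)))

  placed : Vertex ⊎ Edge → Carrier → Location
  placed (inj₁ v) _ = inj₁ v , 0#
  placed (inj₂ e) t = inj₂ e , t

  point-at : ∀ p t → Valid (placed p t) → ∃[ q ] location q ≡ placed p t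
  point-at (inj₁ v) t _ = vertex v , refl
  point-at (inj₂ e) t valid = on e (position [ t ] (NonStrict.[ proj₁ (bounds (len e) valid) ]) (proj₂ (bounds (len e) valid))) , refl
    where
    bounds : ∀ L → InRange L t → 0# ≤ t × [ t ] ≤⁺ L
    bounds [ ℓ ] (p , q) = p , NonStrict.[ q ]
    bounds ⊤⁺    p       = p , ([ t ] NonStrict.≤⊤⁺)

  module _ (D : Divisor Γ) where

    difference : List (Point Γ) → List (Point Γ) → Divisor Γ
    difference qs ps = points qs ++ (points ps ++ negate D)

    coeff-difference : ∀ qs ps r → coeff Γ (difference qs ps) r ≡ coeff Γ (points qs) r ℤ.+ (coeff Γ (points ps) r ℤ.- coeff Γ D r)
    coeff-difference qs ps r = trans (coeff-++ (points qs) _ r)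
      (cong (λ u → coeff Γ (points qs) r ℤ.+ u) (trans (coeff-++ (points ps) (negate D) r) (cong (λ u → coeff Γ (points ps) r ℤ.+ u) (coeff-negate D r))))

    -- With `F` and `E` the sums of `qs` and `ps`, this says that `F + E - D` is principal, that is,
    -- `F` belongs to `∣ D - E ∣`.
    Rational : List (Point Γ) → List (Point Γ) → Set
    Rational qs ps = Solvable (chain (difference qs ps))

    ⟨⟩-difference : ∀ w qs ps → ⟨ w , chain (difference qs ps) ⟩ ≡ ⟨ w , chain (points qs) ⟩ ℤ.+ (⟨ w , chain (points ps) ⟩ ℤ.- ⟨ w , chain D ⟩)
    ⟨⟩-difference w qs ps = begin
      ⟨ w , chain (difference qs ps) ⟩  ≡⟨ cong (λ G → ⟨ w , G ⟩) (chain-++ (points qs) _) ⟩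
      ⟨ w , chain (points qs) ++ chain (points ps ++ negate D) ⟩  ≡⟨ ⟨⟩-++ w (chain (points qs)) _ ⟩
      ⟨ w , chain (points qs) ⟩ ℤ.+ ⟨ w , chain (points ps ++ negate D) ⟩
        ≡⟨ cong (λ u → ⟨ w , chain (points qs) ⟩ ℤ.+ u) (⟨⟩-⊟ w (points ps) D) ⟩
      ⟨ w , chain (points qs) ⟩ ℤ.+ (⟨ w , chain (points ps) ⟩ ℤ.- ⟨ w , chain D ⟩)  ∎
      where open ≡-Reasoning

    Rational-degree : ∀ {qs ps} → Rational qs ps → pos (length qs ℕ.+ length ps) ≡ deg Γ D
    Rational-degree {qs} {ps} S = begin
      pos (length qs) ℤ.+ pos (length ps)  ≡⟨ eq (pos (length qs)) (pos (length ps)) (deg Γ D) ⟩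
      (pos (length qs) ℤ.+ (pos (length ps) ℤ.- deg Γ D)) ℤ.+ deg Γ D  ≡⟨ cong (λ u → u ℤ.+ deg Γ D) zero-degree ⟩
      0ℤ ℤ.+ deg Γ D  ≡⟨ ℤ.+-identityˡ _ ⟩
      deg Γ D  ∎
      where
      open ≡-Reasoning
      eq : ∀ a b d → a ℤ.+ b ≡ (a ℤ.+ (b ℤ.- d)) ℤ.+ d
      eq = solve-∀
      zero-degree : pos (length qs) ℤ.+ (pos (length ps) ℤ.- deg Γ D) ≡ 0ℤ
      zero-degree = trans (sym (trans (⟨⟩-difference (λ _ → 1ℤ) qs ps) (cong₂ ℤ._+_ (trans (⟨1⟩-deg (points qs)) (deg-points qs))
        (cong₂ ℤ._-_ (trans (⟨1⟩-deg (points ps)) (deg-points ps)) (⟨1⟩-deg D))))) (Solvable-degree _ S)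

    nonempty⇒Rational : ∀ {E ps} → _≐_ Γ E (points ps) → ∃ (∣_∣ Γ (_⊟_ Γ D E)) → ∃[ qs ] Rational qs ps
    nonempty⇒Rational {E} {ps} E≐ (F , F-effective , f , F≐) with effective-points F F-effective
    ... | qs , F≐qs , _ = qs , Solvable-≐ {difference qs ps} {div Γ f} (λ r → begin
        coeff Γ (difference qs ps) r  ≡⟨ coeff-difference qs ps r ⟩
        coeff Γ (points qs) r ℤ.+ (coeff Γ (points ps) r ℤ.- coeff Γ D r)
          ≡⟨ cong₂ (λ a b → a ℤ.+ (b ℤ.- coeff Γ D r)) (trans (sym (F≐qs r)) (F≐ r)) (sym (E≐ r)) ⟩
        coeff Γ (_⊟_ Γ D E ++ div Γ f) r ℤ.+ (coeff Γ E r ℤ.- coeff Γ D r)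
          ≡⟨ cong (λ u → u ℤ.+ (coeff Γ E r ℤ.- coeff Γ D r)) (trans (coeff-++ (_⊟_ Γ D E) (div Γ f) r) (cong (λ u → u ℤ.+ coeff Γ (div Γ f) r) (coeff-⊟ D E r))) ⟩
        (coeff Γ D r ℤ.- coeff Γ E r ℤ.+ coeff Γ (div Γ f) r) ℤ.+ (coeff Γ E r ℤ.- coeff Γ D r)
          ≡⟨ eq (coeff Γ D r) (coeff Γ E r) _ ⟩
        coeff Γ (div Γ f) r  ∎) (Solvable-div f)
      where
      open ≡-Reasoning
      eq : ∀ d e f → (d ℤ.- e ℤ.+ f) ℤ.+ (e ℤ.- d) ≡ f
      eq = solve-∀

    Rational⇒nonempty : ∀ {E qs ps} → _≐_ Γ E (points ps) → Rational qs ps → ∃ (∣_∣ Γ (_⊟_ Γ D E))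
    Rational⇒nonempty {E} {qs} {ps} E≐ (s , h , S) = points qs , coeff-points qs , f , λ r → begin
        coeff Γ (points qs) r
          ≡⟨ eq (coeff Γ (points qs) r) (coeff Γ (points ps) r) (coeff Γ D r) ⟩
        coeff Γ D r ℤ.- coeff Γ (points ps) r ℤ.+ (coeff Γ (points qs) r ℤ.+ (coeff Γ (points ps) r ℤ.- coeff Γ D r))
          ≡⟨ cong₂ (λ a b → coeff Γ D r ℤ.- a ℤ.+ b) (sym (E≐ r)) (trans (sym (coeff-difference qs ps r)) (div-rationalFunction (difference qs ps) s h S r)) ⟩
        coeff Γ D r ℤ.- coeff Γ E r ℤ.+ coeff Γ (div Γ f) r
          ≡⟨ cong (λ u → u ℤ.+ coeff Γ (div Γ f) r) (sym (coeff-⊟ D E r)) ⟩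
        coeff Γ (_⊟_ Γ D E) r ℤ.+ coeff Γ (div Γ f) r
          ≡⟨ sym (coeff-++ (_⊟_ Γ D E) (div Γ f) r) ⟩
        coeff Γ (_⊞_ Γ (_⊟_ Γ D E) (div Γ f)) r ∎
      where
      open ≡-Reasoning
      f : RationalFunction Γ
      f = rationalFunction (difference qs ps) s h S
      eq : ∀ q p d → q ≡ d ℤ.- p ℤ.+ (q ℤ.+ (p ℤ.- d))
      eq = solve-∀

-- The algorithm

-- An entry consists of a multiplicity, a place and a position. The position is a form because it
-- may be a quantified variable; for the given divisor it is constant. An edge is recorded as index,
-- source, target and length.
place entry edge : Ty
place = nat ⊕ nat
entry = real ⊗ (place ⊗ form)
edge  = nat ⊗ (nat ⊗ (nat ⊗ extended))

plusᵀ : Term Δ (nat ⇒ nat ⇒ nat)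
plusᵀ = lam (lam (natrec v0 (lam (lam (suc v0))) v1))

opaque
  monusᵀ : Term Δ (nat ⇒ nat ⇒ nat)
  monusᵀ = lam (lam (natrec v1 (lam (lam (natrec zero (lam (lam v1)) v0))) v0))

realᵀ : Term Δ (nat ⇒ real)
realᵀ = lam (natrec 0ᴿ (lam (lam (add 1ᴿ v0))) v0)

δᵀ : Term Δ (nat ⇒ nat ⇒ real)
δᵀ = lam (natrec (lam (natrec 1ᴿ (lam (lam 0ᴿ)) v0)) (lam (lam (lam (natrec 0ᴿ (lam (lam (v3 $ v1))) v0)))) v0)

nthᵀ : Term Δ (list real ⇒ nat ⇒ real)
nthᵀ = lam (fold (lam 0ᴿ) (lam (lam (lam (natrec v2 (lam (lam (v3 $ v1))) v0)))) v0)

lengthᵀ : Term Δ (list σ ⇒ nat)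
lengthᵀ = lam (fold zero (lam (lam (suc v0))) v0)

opaque
  enumerateᵀ : Term Δ (list σ ⇒ list (nat ⊗ σ))
  enumerateᵀ = lam (fold nil (lam (lam (cons (pair zero v1) (mapᵀ $ v0 $ lam (pair (suc (fst v0)) (snd v0)))))) v0)

belowᵀ : Term Δ (nat ⇒ list nat)
belowᵀ = lam (natrec nil (lam (lam (cons v1 v0))) v0)

sumᵀ : Term Δ (list σ ⇒ (σ ⇒ real) ⇒ real)
sumᵀ = lam (lam (fold 0ᴿ (lam (lam (add (v2 $ v1) v0))) v1))

wordsᵀ : Term Δ (nat ⇒ list σ ⇒ list (list σ))
wordsᵀ = lam (lam (natrec (cons nil nil)
  (lam (lam (bindᵀ $ v2 $ lam (mapᵀ $ v1 $ lam (cons v1 v0))))) v1))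

placesᵀ : Term Δ (nat ⇒ list edge ⇒ list place)
placesᵀ = lam (lam (appendᵀ $ (mapᵀ $ (belowᵀ $ v1) $ lam (inl v0)) $ (mapᵀ $ v0 $ lam (inr (fst v0)))))

slopesᵀ : Term Δ (nat ⇒ list real)
slopesᵀ = lam (natrec (cons 0ᴿ nil)
  (lam (lam (cons (realᵀ $ suc v1) (cons (neg (realᵀ $ suc v1)) v0)))) v0)

-- Points at the given places, whose positions are the consecutive
-- variables from the n-th onwards.
entriesᵀ : Term Δ (list place ⇒ nat ⇒ list entry)
entriesᵀ = lam (fold (lam nil) (lam (lam (lam
  (cons (pair 1ᴿ (pair v2 (lam (nthᵀ $ v0 $ v1)))) (v1 $ suc v0))))) v0)

opaque
  onEdgeᵀ atVertexᵀ : Term Δ (nat ⇒ place ⇒ real)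
  onEdgeᵀ   = lam (lam (case v0 0ᴿ (δᵀ $ v0 $ v2)))
  atVertexᵀ = lam (lam (case v0 (δᵀ $ v0 $ v2) 0ᴿ))

  chargeᵀ : Term Δ (nat ⇒ list entry ⇒ real)
  chargeᵀ = lam (lam (sumᵀ $ v0 $ lam (mul (fst v0) (onEdgeᵀ $ v2 $ fst (snd v0)))))

  edgeFormᵀ : Term Δ (list entry ⇒ list real ⇒ edge ⇒ form)
  edgeFormᵀ = lam (lam (lam (lam (case (snd (snd (snd v1)))
    (add (add (nthᵀ $ v1 $ fst (snd (snd v2))) (neg (nthᵀ $ v1 $ fst (snd v2))))
         (neg (add (mul (nthᵀ $ v3 $ fst v2) v0)
                   (sumᵀ $ v4 $ lam (mul (fst v0)
                     (mul (onEdgeᵀ $ fst v3 $ fst (snd v0)) (add v1 (neg (snd (snd v0) $ v2)))))))))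
    (add (nthᵀ $ v1 $ fst (snd (snd v2))) (neg (nthᵀ $ v1 $ fst (snd v2))))))))

  vertexFormᵀ : Term Δ (list edge ⇒ list entry ⇒ list real ⇒ nat ⇒ real)
  vertexFormᵀ = lam (lam (lam (lam (add
    (sumᵀ $ v3 $ lam (add (mul (δᵀ $ fst (snd v0) $ v1) (nthᵀ $ v2 $ fst v0))
      (neg (mul (δᵀ $ fst (snd (snd v0)) $ v1) (add (nthᵀ $ v2 $ fst v0) (chargeᵀ $ fst v0 $ v3))))))
    (neg (sumᵀ $ v2 $ lam (mul (fst v0) (atVertexᵀ $ v1 $ fst (snd v0)))))))))

  systemᴾ : Term Δ (nat ⇒ list edge ⇒ list entry ⇒ list real ⇒ pred)
  systemᴾ = lam (lam (lam (lam (andᴾ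
    $ (allᴾ $ v2 $ lam (zeroᴾ $ (edgeFormᵀ $ v2 $ v1 $ v0)))
    $ (allᴾ $ (belowᵀ $ v3) $ lam (zeroᴾ $ lam (vertexFormᵀ $ v4 $ v3 $ v2 $ v1)))))))

  -- The factor `onEdgeᵀ` voids the condition for all edges except the one carrying the point, so
  -- the edge of an entry need not be looked up.
  beyondᵀ beforeᵀ : Term Δ (entry ⇒ edge ⇒ form)
  beyondᵀ = lam (lam (lam (mul (onEdgeᵀ $ fst v1 $ fst (snd v2)) (snd (snd v2) $ v0))))
  beforeᵀ = lam (lam (lam (case (snd (snd (snd v1)))
    (mul (onEdgeᵀ $ fst v2 $ fst (snd v3)) (add v0 (neg (snd (snd v3) $ v1)))) 0ᴿ)))

  validᴾ : Term Δ (list edge ⇒ list entry ⇒ pred)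
  validᴾ = lam (lam (allᴾ $ v0 $ lam (allᴾ $ v2 $ lam
    (andᴾ $ (nonnegᴾ $ (beyondᵀ $ v1 $ v0)) $ (nonnegᴾ $ (beforeᵀ $ v1 $ v0))))))

  -- The leading variables are the heights of all vertices, followed by the positions of the points
  -- of `F`; all others enter through the given entries.
  solvableᴾ : Term Δ (nat ⇒ list edge ⇒ nat ⇒ nat ⇒ list entry ⇒ pred)
  solvableᴾ = lam (lam (lam (lam (lam (anyᴾ $ (wordsᵀ $ v2 $ (placesᵀ $ v4 $ v3)) $ lam
    (anyᴾ $ (wordsᵀ $ (lengthᵀ $ v4) $ (slopesᵀ $ v2)) $ lam (andᴾ
      $ (systemᴾ $ v6 $ v5 $ (appendᵀ $ (entriesᵀ $ v1 $ v6) $ v2) $ v0)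
      $ (validᴾ $ v5 $ (entriesᵀ $ v1 $ v6)))))))))

  -- Some effective divisor E of degree k has no effective divisor of degree
  -- d linearly equivalent to D - E; the slopes are bounded by b.
  deficientᵀ : Term Δ (nat ⇒ list edge ⇒ list entry ⇒ nat ⇒ nat ⇒ nat ⇒ bool)
  deficientᵀ = lam (lam (lam (lam (lam (lam (snd (anyᴾ $ (wordsᵀ $ v2 $ (placesᵀ $ v5 $ v4)) $ lam
    (existsⁿᴾ $ v3 $ (andᴾ $ (validᴾ $ v5 $ (entriesᵀ $ v0 $ zero)) $ (notᴾ $ (existsⁿᴾ $ (plusᵀ $ v6 $ v2)
      -- The inner block puts its variables, one per vertex and one per point of `F`, in front,
      -- which shifts the positions of `E` by that number.
      $ (solvableᴾ $ v6 $ v5 $ v2 $ v1 $ (appendᵀ $ (entriesᵀ $ v0 $ (plusᵀ $ v6 $ v2)) $ v4))))))) $ nil))))))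

positivePartᵀ negativePartᵀ : Term Δ (int ⊗ point ⇒ nat)
positivePartᵀ = lam (case (fst v0) v0 zero)
negativePartᵀ = lam (case (fst v0) zero (suc v0))

opaque
  -- The difference of these numbers is the degree, their sum the mass of the divisor.
  positiveᵀ negativeᵀ : Term Δ (divisor ⇒ nat)
  positiveᵀ = lam (fold zero (lam (lam (plusᵀ $ (positivePartᵀ $ v1) $ v0))) v0)
  negativeᵀ = lam (fold zero (lam (lam (plusᵀ $ (negativePartᵀ $ v1) $ v0))) v0)

oppositeEntryᵀ : Term Δ (int ⊗ point ⇒ entry)
oppositeEntryᵀ = lam (pair
  (case (fst v0) (neg (realᵀ $ v0)) (realᵀ $ suc v0))
  (case (snd v0) (pair (inl v0) (lam 0ᴿ)) (pair (inr (fst v0)) (lam (case (snd v1) v0 0ᴿ)))))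

opaque
  oppositeᵀ : Term Δ (divisor ⇒ list entry)
  oppositeᵀ = lam (mapᵀ $ v0 $ oppositeEntryᵀ)

opaque
  -- The factor 4 of `slope-bound`.
  quadrupleᵀ : Term Δ (nat ⇒ nat)
  quadrupleᵀ = lam (plusᵀ $ (plusᵀ $ v0 $ v0) $ (plusᵀ $ v0 $ v0))

opaque
  -- The applied abstractions act as local definitions of the positive part, the negative part and
  -- the degree of `F`.
  testᵀ : Term Δ (nat ⇒ curve ⊗ divisor ⇒ bool)
  testᵀ = lam (lam
    (lam (lam (lam (deficientᵀ $ fst (fst v3) $ (enumerateᵀ $ snd (fst v3)) $ (oppositeᵀ $ snd v3) $ v4 $ v0
      $ (quadrupleᵀ $ (plusᵀ $ (plusᵀ $ v0 $ v4) $ (plusᵀ $ v2 $ v1)))) $ (monusᵀ $ v1 $ (plusᵀ $ v0 $ v3)))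
      $ (negativeᵀ $ snd v1)) $ (positiveᵀ $ snd v0)))

rankAlgorithm : Algorithm (curve ⊗ divisor) int
rankAlgorithm = record
  { state = nat ⊗ (curve ⊗ divisor)
  ; start = lam (pair zero v0)
  ; step  = lam (case (testᵀ $ fst v0 $ snd v0)
                  -- The rank is one less than the degree found; for degree 0 this is -1, encoded as
                  -- `inr zero`.
                  (inr (natrec (inr zero) (lam (lam (inl v1))) (fst v1)))
                  (inl (pair (suc (fst v1)) (snd v1)))) }

-- Meaning of the formulas

module Semantics (ℝ : Reals) where
  open OrderedField ℝ
  open Decision ℝ

  Entry EdgeData : Set
  Entry    = ⟦_⟧ ℝ entry
  EdgeData = ⟦_⟧ ℝ edge

  position-of : Entry → Form
  position-of g = proj₂ (proj₂ g)

  sumᴴ : ∀ {A : Set} → (A → Carrier) → List A → Carrier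
  sumᴴ φ = foldr (λ k r → φ k + r) 0#

  sumᴴ-cong : ∀ {A : Set} {φ ψ : A → Carrier} (xs : List A) → (∀ x → φ x ≡ ψ x) → sumᴴ φ xs ≡ sumᴴ ψ xs
  sumᴴ-cong []       h = refl
  sumᴴ-cong (x ∷ xs) h = cong₂ _+_ (h x) (sumᴴ-cong xs h)

  δᴴ : ℕ → ℕ → Carrier
  δᴴ = eval ℝ δᵀ []

  nthᴴ : Env → ℕ → Carrier
  nthᴴ = eval ℝ nthᵀ []

  onEdgeᴴ atVertexᴴ : ℕ → ℕ ⊎ ℕ → Carrier
  onEdgeᴴ e (inj₁ _) = 0#
  onEdgeᴴ e (inj₂ d) = δᴴ d e
  atVertexᴴ v (inj₁ u) = δᴴ u v
  atVertexᴴ v (inj₂ _) = 0#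

  opaque
    unfolding onEdgeᵀ

    onEdge-eval : ∀ {ρ : All (⟦_⟧ ℝ) Δ} e p → eval ℝ onEdgeᵀ ρ e p ≡ onEdgeᴴ e p
    onEdge-eval e (inj₁ _) = refl
    onEdge-eval e (inj₂ _) = refl

  opaque
    unfolding atVertexᵀ

    atVertex-eval : ∀ {ρ : All (⟦_⟧ ℝ) Δ} v p → eval ℝ atVertexᵀ ρ v p ≡ atVertexᴴ v p
    atVertex-eval v (inj₁ _) = refl
    atVertex-eval v (inj₂ _) = refl

  chargeᴴ : ℕ → List Entry → Carrier
  chargeᴴ e = sumᴴ (λ (m , p , _) → m * onEdgeᴴ e p)

  opaque
    unfolding chargeᵀ

    charge-eval : ∀ {ρ : All (⟦_⟧ ℝ) Δ} e G → eval ℝ chargeᵀ ρ e G ≡ chargeᴴ e G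
    charge-eval e G = sumᴴ-cong G λ (m , p , _) → cong (m *_) (onEdge-eval e p)

  momentᴴ : ℕ → Carrier → List Entry → Form
  momentᴴ e ℓ G y = sumᴴ (λ (m , p , f) → m * (onEdgeᴴ e p * (ℓ - f y))) G

  edgeFormᴴ : List Entry → Env → EdgeData → Form
  edgeFormᴴ G s (e , a , b , inj₁ ℓ) y = (nthᴴ y b - nthᴴ y a) - (nthᴴ s e * ℓ + momentᴴ e ℓ G y)
  edgeFormᴴ G s (e , a , b , inj₂ _) y = nthᴴ y b - nthᴴ y a

  opaque
    unfolding edgeFormᵀ

    edgeForm-eval : ∀ {ρ : All (⟦_⟧ ℝ) Δ} G s d y → eval ℝ edgeFormᵀ ρ G s d y ≡ edgeFormᴴ G s d y
    edgeForm-eval G s (e , a , b , inj₁ ℓ) y = cong (λ u → (nthᴴ y b - nthᴴ y a) - (nthᴴ s e * ℓ + u))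
      (sumᴴ-cong G λ (m , p , f) → cong (λ u → m * (u * (ℓ - f y))) (onEdge-eval e p))
    edgeForm-eval G s (e , a , b , inj₂ _) y = refl

  vertexFormᴴ : List EdgeData → List Entry → Env → ℕ → Carrier
  vertexFormᴴ E G s v = sumᴴ (λ (e , a , b , _) → δᴴ a v * nthᴴ s e - δᴴ b v * (nthᴴ s e + chargeᴴ e G)) E
                        - sumᴴ (λ (m , p , _) → m * atVertexᴴ v p) G

  opaque
    unfolding vertexFormᵀ

    vertexForm-eval : ∀ {ρ : All (⟦_⟧ ℝ) Δ} E G s v → eval ℝ vertexFormᵀ ρ E G s v ≡ vertexFormᴴ E G s v
    vertexForm-eval E G s v = cong₂ _-_
      (sumᴴ-cong E λ (e , a , b , _) → cong (λ u → δᴴ a v * nthᴴ s e - δᴴ b v * (nthᴴ s e + u)) (charge-eval e G))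
      (sumᴴ-cong G λ (m , p , _) → cong (m *_) (atVertex-eval v p))

  beyondᴴ beforeᴴ : Entry → EdgeData → Form
  beyondᴴ (m , p , f) (e , _)                y = onEdgeᴴ e p * f y
  beforeᴴ (m , p , f) (e , _ , _ , inj₁ ℓ)   y = onEdgeᴴ e p * (ℓ - f y)
  beforeᴴ (m , p , f) (e , _ , _ , inj₂ _)   y = 0#

  Affine-sum : ∀ {A : Set} n (φ : A → Form) (xs : List A) → (∀ x → x ∈ xs → Affine n (φ x)) → Affine n (λ y → sumᴴ (λ x → φ x y) xs)
  Affine-sum n φ []       h = Affine-const n 0#
  Affine-sum n φ (x ∷ xs) h = Affine-+ n (h x (here refl)) (Affine-sum n φ xs λ z z∈ → h z (there z∈))

  Affine-nth : ∀ n i → Affine n (λ y → nthᴴ y i)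
  Affine-nth zero    i       = tt
  Affine-nth (suc n) zero    = (1# , λ x y → sym (trans (+-identityˡ _) (*-identityˡ x))) , Affine-const n 0#
  Affine-nth (suc n) (suc i) = (0# , λ x y → solve 2 (λ c x → c := c :+ con 0ℤ :* x) refl _ x) , Affine-nth n i

  AffineEntries : ℕ → List Entry → Set
  AffineEntries n G = ∀ g → g ∈ G → Affine n (position-of g)

  Affine-rise : ∀ n a b → Affine n (λ y → nthᴴ y b - nthᴴ y a)
  Affine-rise n a b = Affine-+ n (Affine-nth n b) (Affine-neg n (Affine-nth n a))

  Affine-edgeForm : ∀ n G s d → AffineEntries n G → Affine n (edgeFormᴴ G s d)
  Affine-edgeForm n G s (e , a , b , inj₁ ℓ) h = Affine-+ n (Affine-rise n a b) (Affine-neg n (Affine-+ n (Affine-const n _)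
    (Affine-sum n _ G λ (m , p , f) g∈ → Affine-* n m (Affine-* n (onEdgeᴴ e p) (Affine-+ n (Affine-const n ℓ) (Affine-neg n (h _ g∈)))))))
  Affine-edgeForm n G s (e , a , b , inj₂ _) h = Affine-rise n a b

  Affine-before : ∀ n g d → Affine n (position-of g) → Affine n (beforeᴴ g d)
  Affine-before n (m , p , f) (e , _ , _ , inj₁ ℓ) h = Affine-* n (onEdgeᴴ e p) (Affine-+ n (Affine-const n ℓ) (Affine-neg n h))
  Affine-before n (m , p , f) (e , _ , _ , inj₂ _) h = Affine-const n 0#

  belowᴴ : ℕ → List ℕ
  belowᴴ = eval ℝ belowᵀ []

  System : ℕ → List EdgeData → List Entry → Env → Env → Set
  System V E G s y = (∀ d → d ∈ E → edgeFormᴴ G s d y ≡ 0#) × (∀ v → v ∈ belowᴴ V → vertexFormᴴ E G s v ≡ 0#)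

  opaque
    unfolding systemᴾ

    system-denotes : ∀ {ρ : All (⟦_⟧ ℝ) Δ} {n} V E G s → AffineEntries n G → n ⊢ eval ℝ systemᴾ ρ V E G s ⇔ System V E G s
    system-denotes {n = n} V E G s h = and-denotes
      (all-denotes {n = n} edge E λ d d∈ → map-denotes (λ y → trans (sym (edgeForm-eval G s d y))) (λ y → trans (edgeForm-eval G s d y))
        (zero-denotes (Affine-cong n (λ y → sym (edgeForm-eval G s d y)) (Affine-edgeForm n G s d h))))
      (all-denotes {n = n} nat (belowᴴ V) λ v v∈ → map-denotes (λ y → trans (sym (vertexForm-eval E G s v))) (λ y → trans (vertexForm-eval E G s v))
        (zero-denotes (Affine-cong n (λ y → sym (vertexForm-eval E G s v)) (Affine-const n (vertexFormᴴ E G s v)))))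

  ValidEntries : List EdgeData → List Entry → Env → Set
  ValidEntries E F y = ∀ g → g ∈ F → ∀ d → d ∈ E → 0# ≤ beyondᴴ g d y × 0# ≤ beforeᴴ g d y

  opaque
    unfolding beyondᵀ beforeᵀ

    beyond-eval : ∀ {ρ : All (⟦_⟧ ℝ) Δ} g d y → eval ℝ beyondᵀ ρ g d y ≡ beyondᴴ g d y
    beyond-eval (m , p , f) (e , _) y = cong (_* f y) (onEdge-eval e p)

    before-eval : ∀ {ρ : All (⟦_⟧ ℝ) Δ} g d y → eval ℝ beforeᵀ ρ g d y ≡ beforeᴴ g d y
    before-eval (m , p , f) (e , _ , _ , inj₁ ℓ) y = cong (_* (ℓ - f y)) (onEdge-eval e p)
    before-eval (m , p , f) (e , _ , _ , inj₂ _) y = refl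

  opaque
    unfolding validᴾ

    valid-denotes : ∀ {ρ : All (⟦_⟧ ℝ) Δ} {n} E F → AffineEntries n F → n ⊢ eval ℝ validᴾ ρ E F ⇔ ValidEntries E F
    valid-denotes {n = n} E F h = all-denotes {n = n} entry F λ g g∈ → all-denotes {n = n} edge E λ d d∈ → and-denotes
      (map-denotes (λ y → subst (0# ≤_) (beyond-eval g d y)) (λ y → subst (0# ≤_) (sym (beyond-eval g d y)))
        (nonneg-denotes (Affine-cong n (λ y → sym (beyond-eval g d y)) (Affine-* n (onEdgeᴴ (proj₁ d) (proj₁ (proj₂ g))) (h g g∈)))))
      (map-denotes (λ y → subst (0# ≤_) (before-eval g d y)) (λ y → subst (0# ≤_) (sym (before-eval g d y)))
        (nonneg-denotes (Affine-cong n (λ y → sym (before-eval g d y)) (Affine-before n g d (h g g∈)))))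

  entriesᴴ : List (ℕ ⊎ ℕ) → ℕ → List Entry
  entriesᴴ = eval ℝ entriesᵀ []

  placesᴴ : ℕ → List EdgeData → List (ℕ ⊎ ℕ)
  placesᴴ = eval ℝ placesᵀ []

  wordsᴴ : ∀ σ → ℕ → List (⟦_⟧ ℝ σ) → List (List (⟦_⟧ ℝ σ))
  wordsᴴ σ = eval ℝ (wordsᵀ {σ = σ}) []

  slopesᴴ : ℕ → List Carrier
  slopesᴴ = eval ℝ slopesᵀ []

  lengthᴴ : List EdgeData → ℕ
  lengthᴴ = eval ℝ (lengthᵀ {σ = edge}) []

  plusᴴ : ℕ → ℕ → ℕ
  plusᴴ = eval ℝ plusᵀ []

  appendᴴ : List Entry → List Entry → List Entry
  appendᴴ G H = foldr _∷_ H G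

  Affine-entries : ∀ n w k → AffineEntries n (entriesᴴ w k)
  Affine-entries n (p ∷ w) k _ (here refl) = Affine-nth n k
  Affine-entries n (p ∷ w) k g (there g∈)  = Affine-entries n w (suc k) g g∈

  Affine-append : ∀ {n} G {H} → AffineEntries n G → AffineEntries n H → AffineEntries n (appendᴴ G H)
  Affine-append []      a b = b
  Affine-append (g ∷ G) a b _ (here refl) = a g (here refl)
  Affine-append (g ∷ G) a b f (there f∈)  = Affine-append G (λ x x∈ → a x (there x∈)) b f f∈

  SolvableAt : ℕ → List EdgeData → ℕ → ℕ → List Entry → Env → Set
  SolvableAt V E d b C y =
    ∃[ w ] w ∈ wordsᴴ place d (placesᴴ V E) × ∃[ s ] s ∈ wordsᴴ real (lengthᴴ E) (slopesᴴ b) ×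
      System V E (appendᴴ (entriesᴴ w V) C) s y × ValidEntries E (entriesᴴ w V) y

  opaque
    unfolding solvableᴾ

    solvable-denotes : ∀ {ρ : All (⟦_⟧ ℝ) Δ} {n} V E d b C → AffineEntries n C → n ⊢ eval ℝ solvableᴾ ρ V E d b C ⇔ SolvableAt V E d b C
    solvable-denotes {n = n} V E d b C h =
      any-denotes {n = n} (list place) (wordsᴴ place d (placesᴴ V E)) λ w _ →
      any-denotes {n = n} (list real) (wordsᴴ real (lengthᴴ E) (slopesᴴ b)) λ s _ →
      and-denotes (system-denotes V E (appendᴴ (entriesᴴ w V) C) s (Affine-append (entriesᴴ w V) (Affine-entries n w V) h))
                  (valid-denotes E (entriesᴴ w V) (Affine-entries n w V))

  Deficient : ℕ → List EdgeData → List Entry → ℕ → ℕ → ℕ → Set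
  Deficient V E D k d b = ∃[ w ] w ∈ wordsᴴ place k (placesᴴ V E) × ∃[ ts ] length ts ≡ k ×
    ValidEntries E (entriesᴴ w 0) (ts ++ []) ×
    ¬ (∃[ xs ] length xs ≡ plusᴴ V d × SolvableAt V E d b (appendᴴ (entriesᴴ w (plusᴴ V d)) D) (xs ++ (ts ++ [])))

  opaque
    unfolding deficientᵀ

    deficient-reflects : ∀ {ρ : All (⟦_⟧ ℝ) Δ} V E D k d b → (∀ n → AffineEntries n D) → Reflects (Deficient V E D k d b) (eval ℝ deficientᵀ ρ V E D k d b)
    deficient-reflects V E D k d b h = reflects
      (any-denotes {n = 0} (list place) (wordsᴴ place k (placesᴴ V E)) λ w _ →
        existsⁿ-denotes k (and-denotes (valid-denotes E (entriesᴴ w 0) (Affine-entries _ w 0))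
          (not-denotes (existsⁿ-denotes (plusᴴ V d) (solvable-denotes V E d b _
            (Affine-append (entriesᴴ w (plusᴴ V d)) (Affine-entries _ w (plusᴴ V d)) (h _)))))))
      []

-- Encoded data and the objects they denote

module Interpretation {ℝ : Reals} (Γ : TropicalCurve ℝ) where
  open OrderedField ℝ
  open Decision ℝ
  open Semantics ℝ
  open TropicalCurve Γ
  open Solvability Γ
  open SlopeBound Γ
  open Divisors Γ
  open LinearSystems Γ
  open Position

  Place : Set
  Place = Vertex ⊎ Edge

  code : Place → ℕ ⊎ ℕ
  code (inj₁ v) = inj₁ (toℕ v)
  code (inj₂ e) = inj₂ (toℕ e)

  edgeCode : Edge → EdgeData
  edgeCode e = toℕ e , toℕ (src e) , toℕ (tgt e) , encodeExtended {ℝ} (len e)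

  edgeCodes : List EdgeData
  edgeCodes = tabulate edgeCode

  δ-code : ∀ {n} (i j : Fin n) → δᴴ (toℕ i) (toℕ j) ≡ ι (δ i j)
  δ-code i j with i Fin.≟ j
  ... | yes refl = trans (same (toℕ i)) (sym ι-1)
    where
    same : ∀ n → δᴴ n n ≡ 1#
    same zero    = refl
    same (suc n) = same n
  ... | no i≢j = different (toℕ i) (toℕ j) (i≢j ∘ Fin.toℕ-injective)
    where
    different : ∀ m n → m ≢ n → δᴴ m n ≡ 0#
    different zero    zero    h = ⊥-elim (h refl)
    different zero    (suc n) h = refl
    different (suc m) zero    h = refl
    different (suc m) (suc n) h = different m n (h ∘ cong suc)

  -- A relation, since forms get a value only at `y` and the position attached to a vertex is
  -- arbitrary on both sides.
  data _⊨_∼_ (y : Env) : List Entry → Chain → Set where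
    []      : y ⊨ [] ∼ []
    vertexᴹ : ∀ {r m v f t G C} → r ≡ ι m → y ⊨ G ∼ C → y ⊨ (r , inj₁ (toℕ v) , f) ∷ G ∼ ((m , inj₁ v , t) ∷ C)
    edgeᴹ   : ∀ {r m e f t G C} → r ≡ ι m → f y ≡ t → y ⊨ G ∼ C → y ⊨ (r , inj₂ (toℕ e) , f) ∷ G ∼ ((m , inj₂ e , t) ∷ C)

  append-matches : ∀ {y G C H D} → y ⊨ G ∼ C → y ⊨ H ∼ D → y ⊨ appendᴴ G H ∼ (C ++ D)
  append-matches []              h = h
  append-matches (vertexᴹ r g)   h = vertexᴹ r (append-matches g h)
  append-matches (edgeᴹ r p g)   h = edgeᴹ r p (append-matches g h)

  ι-term : ∀ m c n {r x G} → r ≡ ι m → x ≡ ι c → G ≡ ι n → r * x + G ≡ ι (m ℤ.* c ℤ.+ n)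
  ι-term m c n refl refl refl = trans (cong (λ u → u + ι n) (sym (ι-* m c))) (sym (ι-+ (m ℤ.* c) n))

  charge-matches : ∀ {y G C} e → y ⊨ G ∼ C → chargeᴴ (toℕ e) G ≡ ι (charge e C)
  charge-matches e []                                        = refl
  charge-matches e (vertexᴹ {m = m} {C = C} r g)             = ι-term m 0ℤ (charge e C) r refl (charge-matches e g)
  charge-matches e (edgeᴹ {m = m} {e = d} {C = C} r p g)     = ι-term m (δ d e) (charge e C) r (δ-code d e) (charge-matches e g)

  atVertex-matches : ∀ {y G C} v → y ⊨ G ∼ C → sumᴴ (λ (m , p , _) → m * atVertexᴴ (toℕ v) p) G ≡ ι ⟨ atVertex v , C ⟩
  atVertex-matches v []                                      = refl
  atVertex-matches v (vertexᴹ {m = m} {v = u} {C = C} r g)   = ι-term m (δ u v) ⟨ atVertex v , C ⟩ r (δ-code u v) (atVertex-matches v g)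
  atVertex-matches v (edgeᴹ {m = m} {C = C} r p g)           = ι-term m 0ℤ ⟨ atVertex v , C ⟩ r refl (atVertex-matches v g)

  moment-matches : ∀ {y G C} e {ℓ} → len e ≡ [ ℓ ] → y ⊨ G ∼ C → momentᴴ (toℕ e) ℓ G y ≡ moment e C
  moment-matches e len≡ [] = refl
  moment-matches e {ℓ} len≡ (vertexᴹ {m = m} {t = t} refl g) =
    cong₂ (λ u v → ι m * u + v) (trans (zeroˡ _) (sym (zeroˡ _))) (moment-matches e len≡ g)
  moment-matches e {ℓ} len≡ (edgeᴹ {m = m} {e = d} {t = t} refl refl g) =
    cong₂ (λ u v → ι m * u + v) (cong₂ _*_ (δ-code d e) (cong (λ L → fromEnd L t) (sym len≡))) (moment-matches e len≡ g)

  sum-tabulate : ∀ {A : Set} {n} (φ : A → Carrier) (f : Fin n → A) (k : Fin n → ℤ) → (∀ i → φ (f i) ≡ ι (k i)) → sumᴴ φ (tabulate f) ≡ ι (sum k)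
  sum-tabulate {n = zero}  φ f k h = refl
  sum-tabulate {n = suc n} φ f k h = trans (cong₂ _+_ (h zero) (sum-tabulate φ (f ∘ suc) (k ∘ suc) (h ∘ suc))) (sym (ι-+ (k zero) _))

  ι-sub : ∀ a b → ι a - ι b ≡ ι (a ℤ.- b)
  ι-sub a b = sym (trans (ι-+ a (ℤ.- b)) (cong (λ u → ι a + u) (ι-neg b)))

  ∈below : ∀ {v n} → v ∈ belowᴴ n → v ℕ.< n
  ∈below {n = suc n} (here refl) = ℕ.≤-refl
  ∈below {n = suc n} (there v∈)  = ℕ.m≤n⇒m≤1+n (∈below v∈)

  below∋ : ∀ {v n} → v ℕ.< n → v ∈ belowᴴ n
  below∋ {v} {suc n} (ℕ.s≤s v≤n) with v ℕ.≟ n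
  ... | yes refl = here refl
  ... | no v≢n   = there (below∋ (ℕ.≤∧≢⇒< v≤n v≢n))

  module _ {y : Env} {G : List Entry} {C : Chain} (match : y ⊨ G ∼ C) (s : Env) (σ : Edge → ℤ) (s≡ : ∀ e → nthᴴ s (toℕ e) ≡ ι (σ e)) where
    private
      h : Vertex → Carrier
      h v = nthᴴ y (toℕ v)

    -- The real form is the image of an integer, so by injectivity of `ι` its vanishing is the
    -- integer equation.
    vertexForm-code : ∀ v → vertexFormᴴ edgeCodes G s (toℕ v) ≡ ι (outflow σ C v ℤ.- ⟨ atVertex v , C ⟩)
    vertexForm-code v = trans (cong₂ _-_ (sum-tabulate _ edgeCode (λ e → δ (src e) v ℤ.* σ e ℤ.- δ (tgt e) v ℤ.* (σ e ℤ.+ charge e C)) flow-code) (atVertex-matches v match))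
                              (ι-sub (outflow σ C v) _)
      where
      flow-code : ∀ e → δᴴ (toℕ (src e)) (toℕ v) * nthᴴ s (toℕ e) - δᴴ (toℕ (tgt e)) (toℕ v) * (nthᴴ s (toℕ e) + chargeᴴ (toℕ e) G) ≡
                        ι (δ (src e) v ℤ.* σ e ℤ.- δ (tgt e) v ℤ.* (σ e ℤ.+ charge e C))
      flow-code e = trans (cong₂ _-_
          (trans (cong₂ _*_ (δ-code (src e) v) (s≡ e)) (sym (ι-* (δ (src e) v) (σ e))))
          (trans (cong₂ _*_ (δ-code (tgt e) v) (trans (cong₂ _+_ (s≡ e) (charge-matches e match)) (sym (ι-+ (σ e) _)))) (sym (ι-* (δ (tgt e) v) (σ e ℤ.+ charge e C)))))
        (ι-sub (δ (src e) v ℤ.* σ e) _)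

    private
      edgeFormAt : Edge → Carrier ⁺ → Carrier
      edgeFormAt e L = edgeFormᴴ G s (toℕ e , toℕ (src e) , toℕ (tgt e) , encodeExtended {ℝ} L) y

      form⇒equation : ∀ e L → len e ≡ L → edgeFormAt e L ≡ 0# → EdgeEquation e L (σ e) h C
      form⇒equation e ⊤⁺    _    p = p
      form⇒equation e [ ℓ ] len≡ p = begin
        h (tgt e) - h (src e)  ≡⟨ solve 2 (λ a b → a := (a :- b) :+ b) refl _ _ ⟩
        edgeFormAt e [ ℓ ] + (nthᴴ s (toℕ e) * ℓ + momentᴴ (toℕ e) ℓ G y)
                                                               ≡⟨ cong₂ _+_ p (cong₂ (λ a b → a * ℓ + b) (s≡ e) (moment-matches e len≡ match)) ⟩
        0# + (ι (σ e) * ℓ + moment e C)  ≡⟨ +-identityˡ _ ⟩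
        ι (σ e) * ℓ + moment e C  ∎
        where open ≡-Reasoning

      equation⇒form : ∀ e L → len e ≡ L → EdgeEquation e L (σ e) h C → edgeFormAt e L ≡ 0#
      equation⇒form e ⊤⁺    _    p = p
      equation⇒form e [ ℓ ] len≡ p = trans (cong₂ _-_ p (cong₂ (λ a b → a * ℓ + b) (s≡ e) (moment-matches e len≡ match))) (-‿inverseʳ _)

    system⇒solution : System #vertices edgeCodes G s y → Solution C σ h
    system⇒solution (edges , vertices) = record
      { edges    = λ e → form⇒equation e (len e) refl (edges (edgeCode e) (∈-tabulate⁺ e))
      ; vertices = λ v → ℤ.i-j≡0⇒i≡j _ _ (ι-injective (trans (sym (vertexForm-code v)) (vertices (toℕ v) (below∋ (Fin.toℕ<n v))))) }

    solution⇒system : Solution C σ h → System #vertices edgeCodes G s y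
    solution⇒system S =
      (λ d d∈ → let (e , d≡) = ∈-tabulate⁻ d∈ in subst (λ d → edgeFormᴴ G s d y ≡ 0#) (sym d≡) (equation⇒form e (len e) refl (Solution.edges S e))) ,
      (λ v v∈ → subst (λ v → vertexFormᴴ edgeCodes G s v ≡ 0#) (Fin.toℕ-fromℕ< (∈below v∈))
        (trans (vertexForm-code (fromℕ< (∈below v∈))) (cong ι (ℤ.i≡j⇒i-j≡0 (Solution.vertices S _)))))

  ∈words⁻ : ∀ σ n A {w} → w ∈ wordsᴴ σ n A → length w ≡ n × All (_∈ A) w
  ∈words⁻ σ zero    A (here refl) = refl , []
  ∈words⁻ σ (suc n) A {w} w∈
    with find (∈-concatMap⁻ _ {xs = A} (subst (w ∈_) (bind-concatMap (λ a → foldr (λ w r → (a ∷ w) ∷ r) [] (wordsᴴ σ n A)) A) w∈))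
  ... | a , a∈ , w∈′ with ∈-map⁻ (a ∷_) (subst (w ∈_) (map-map (a ∷_) (wordsᴴ σ n A)) w∈′)
  ...   | w′ , w′∈ , refl = let (l , h) = ∈words⁻ σ n A w′∈ in cong suc l , a∈ ∷ h

  ∈words⁺ : ∀ σ A {w} → All (_∈ A) w → w ∈ wordsᴴ σ (length w) A
  ∈words⁺ σ A [] = here refl
  ∈words⁺ σ A {a ∷ w} (a∈ ∷ h) =
    subst (a ∷ w ∈_) (sym (bind-concatMap (λ a → foldr (λ w r → (a ∷ w) ∷ r) [] (wordsᴴ σ (length w) A)) A))
      (∈-concatMap⁺ _ (Any.map (λ { refl → subst (a ∷ w ∈_) (sym (map-map (a ∷_) (wordsᴴ σ (length w) A))) (∈-map⁺ (a ∷_) (∈words⁺ σ A h)) }) a∈))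

  places : List (ℕ ⊎ ℕ)
  places = placesᴴ #vertices edgeCodes

  places-++ : places ≡ map inj₁ (belowᴴ #vertices) ++ map (inj₂ ∘ proj₁) edgeCodes
  places-++ = trans (append-++ {A = ℕ ⊎ ℕ} (foldr (λ v r → inj₁ v ∷ r) [] (belowᴴ #vertices)) (foldr (λ d r → inj₂ (proj₁ d) ∷ r) [] edgeCodes))
    (cong₂ _++_ (map-map inj₁ (belowᴴ #vertices)) (map-map (inj₂ ∘ proj₁) edgeCodes))

  code∈places : ∀ P → code P ∈ places
  code∈places (inj₁ v) = subst (inj₁ (toℕ v) ∈_) (sym places-++) (∈-++⁺ˡ (∈-map⁺ inj₁ (below∋ (Fin.toℕ<n v))))
  code∈places (inj₂ e) = subst (inj₂ (toℕ e) ∈_) (sym places-++)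
    (∈-++⁺ʳ (map inj₁ (belowᴴ #vertices)) (∈-map⁺ (inj₂ ∘ proj₁) (∈-tabulate⁺ {f = edgeCode} e)))

  places⊆code : ∀ {p} → p ∈ places → ∃[ P ] p ≡ code P
  places⊆code {p} p∈ with ∈-++⁻ (map inj₁ (belowᴴ #vertices)) (subst (p ∈_) places-++ p∈)
  ... | inj₁ p∈₁ with ∈-map⁻ inj₁ p∈₁
  ...   | v , v∈ , refl = inj₁ (fromℕ< (∈below v∈)) , cong inj₁ (sym (Fin.toℕ-fromℕ< (∈below v∈)))
  places⊆code {p} p∈ | inj₂ p∈₂ with ∈-map⁻ (inj₂ ∘ proj₁) p∈₂
  ...   | d , d∈ , refl with ∈-tabulate⁻ {f = edgeCode} d∈
  ...     | e , refl = inj₂ e , refl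

  decode : ∀ {w} → All (_∈ places) w → ∃[ Ps ] w ≡ map code Ps
  decode []       = [] , refl
  decode (p∈ ∷ h) = let (P , p≡) = places⊆code p∈ ; (Ps , w≡) = decode h in P ∷ Ps , cong₂ _∷_ p≡ w≡

  code∈words : ∀ Ps {n} → length Ps ≡ n → map code Ps ∈ wordsᴴ place n places
  code∈words Ps refl = subst (λ n → map code Ps ∈ wordsᴴ place n places) (length-map code Ps) (∈words⁺ place places (codes Ps))
    where
    codes : ∀ Ps → All (_∈ places) (map code Ps)
    codes []       = []
    codes (P ∷ Ps) = code∈places P ∷ codes Ps

  real-ι : ∀ n → eval ℝ realᵀ [] n ≡ ι (pos n)
  real-ι zero    = refl
  real-ι (suc n) = cong (λ u → 1# + u) (real-ι n)

  ∈slopes⁻ : ∀ b {x} → x ∈ slopesᴴ b → ∃[ z ] x ≡ ι z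
  ∈slopes⁻ zero  (here refl)         = 0ℤ , refl
  ∈slopes⁻ (suc b) (here refl)         = pos (suc b) , real-ι (suc b)
  ∈slopes⁻ (suc b) (there (here refl)) = -[1+ b ] , cong -_ (real-ι (suc b))
  ∈slopes⁻ (suc b) (there (there x∈))  = ∈slopes⁻ b x∈

  ∈slopes⁺ : ∀ b z → ℤ.∣ z ∣ ℕ.≤ b → ι z ∈ slopesᴴ b
  ∈slopes⁺ zero    (pos zero) _ = here refl
  ∈slopes⁺ (suc b) z          p with ℤ.∣ z ∣ ℕ.≟ suc b
  ∈slopes⁺ (suc b) (pos .(suc b)) p | yes refl = here (sym (real-ι (suc b)))
  ∈slopes⁺ (suc b) -[1+ .b ]      p | yes refl = there (here (cong -_ (sym (real-ι (suc b)))))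
  ∈slopes⁺ (suc b) z p | no ¬q = there (there (∈slopes⁺ b z (ℕ.≤-pred (ℕ.≤∧≢⇒< p ¬q))))

  ∣∣≤⇒≤ : ∀ {z b} → ∣ z ∣≤ pos b → ℤ.∣ z ∣ ℕ.≤ b
  ∣∣≤⇒≤ {pos n}          (_ , ℤ.+≤+ p) = p
  ∣∣≤⇒≤ { -[1+ n ]} {zero}  (() , _)
  ∣∣≤⇒≤ { -[1+ n ]} {suc b} (ℤ.-≤- p , _) = ℕ.s≤s p

  nth-tabulate : ∀ {n} (f : Fin n → Carrier) zs i → nthᴴ (tabulate f ++ zs) (toℕ i) ≡ f i
  nth-tabulate f zs zero    = refl
  nth-tabulate f zs (suc i) = nth-tabulate (f ∘ suc) zs i

  nth-++ : ∀ xs ys n → nthᴴ (xs ++ ys) (length xs ℕ.+ n) ≡ nthᴴ ys n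
  nth-++ []       ys n = refl
  nth-++ (x ∷ xs) ys n = nth-++ xs ys n

  placedChain : List Place → ℕ → Env → Chain
  placedChain []       n y = []
  placedChain (P ∷ Ps) n y = (1ℤ , placed P (nthᴴ y n)) ∷ placedChain Ps (suc n) y

  entries-match : ∀ Ps n y → y ⊨ entriesᴴ (map code Ps) n ∼ placedChain Ps n y
  entries-match []            n y = []
  entries-match (inj₁ v ∷ Ps) n y = vertexᴹ (sym ι-1) (entries-match Ps (suc n) y)
  entries-match (inj₂ e ∷ Ps) n y = edgeᴹ (sym ι-1) refl (entries-match Ps (suc n) y)

  -- Accounts for a block of quantified variables put in front of the environment.
  placedChain-shift : ∀ Ps xs n y → placedChain Ps (length xs ℕ.+ n) (xs ++ y) ≡ placedChain Ps n y
  placedChain-shift []       xs n y = refl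
  placedChain-shift (P ∷ Ps) xs n y = cong₂ (λ t C → (1ℤ , placed P t) ∷ C) (nth-++ xs y n)
    (trans (cong (λ k → placedChain Ps k (xs ++ y)) (sym (ℕ.+-suc (length xs) n))) (placedChain-shift Ps xs (suc n) y))

  placedChain-points : ∀ qs z → placedChain (map (proj₁ ∘ location) qs) 0 (map (proj₂ ∘ location) qs ++ z) ≡ chain (points qs)
  placedChain-points []       z = refl
  placedChain-points (q ∷ qs) z = cong₂ (λ l C → (1ℤ , l) ∷ C) (relocate q)
    (trans (placedChain-shift (map (proj₁ ∘ location) qs) (proj₂ (location q) ∷ []) 0 _) (placedChain-points qs z))
    where
    relocate : ∀ q → placed (proj₁ (location q)) (proj₂ (location q)) ≡ location q
    relocate (vertex v) = refl
    relocate (on e x)   = refl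

  realise : ∀ Ps n y → All (Valid ∘ proj₂) (placedChain Ps n y) → ∃[ qs ] length qs ≡ length Ps × chain (points qs) ≡ placedChain Ps n y
  realise []       n y []       = [] , refl , refl
  realise (P ∷ Ps) n y (v ∷ vs) with point-at P (nthᴴ y n) v | realise Ps (suc n) y vs
  ... | q , q≡ | qs , l , qs≡ = q ∷ qs , cong suc l , cong₂ (λ p C → (1ℤ , p) ∷ C) q≡ qs≡

  validEntries⇒Valid : ∀ Ps n y → ValidEntries edgeCodes (entriesᴴ (map code Ps) n) y → All (Valid ∘ proj₂) (placedChain Ps n y)
  validEntries⇒Valid []            n y h = []
  validEntries⇒Valid (inj₁ v ∷ Ps) n y h = tt ∷ validEntries⇒Valid Ps (suc n) y (λ g g∈ → h g (there g∈))
  validEntries⇒Valid (inj₂ e ∷ Ps) n y h = range (len e) (proj₁ bounds) (proj₂ bounds) ∷ validEntries⇒Valid Ps (suc n) y (λ g g∈ → h g (there g∈))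
    where
    bounds = h _ (here refl) (edgeCode e) (∈-tabulate⁺ e)
    δ*≡ : ∀ x → δᴴ (toℕ e) (toℕ e) * x ≡ x
    δ*≡ x = trans (cong (_* x) (trans (δ-code e e) (trans (cong ι (δ-refl e)) ι-1))) (*-identityˡ x)
    range : ∀ L → 0# ≤ δᴴ (toℕ e) (toℕ e) * nthᴴ y n →
            0# ≤ beforeᴴ (1# , inj₂ (toℕ e) , λ z → nthᴴ z n) (toℕ e , toℕ (src e) , toℕ (tgt e) , encodeExtended {ℝ} L) y → InRange L (nthᴴ y n)
    range [ ℓ ] p q = subst (0# ≤_) (δ*≡ _) p , sub-0≤ (subst (0# ≤_) (δ*≡ _) q)
    range ⊤⁺    p q = subst (0# ≤_) (δ*≡ _) p

  Valid⇒validEntries : ∀ Ps n y → All (Valid ∘ proj₂) (placedChain Ps n y) → ValidEntries edgeCodes (entriesᴴ (map code Ps) n) y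
  Valid⇒validEntries (P ∷ Ps) n y (v ∷ vs) g (there g∈) d d∈ = Valid⇒validEntries Ps (suc n) y vs g g∈ d d∈
  Valid⇒validEntries (inj₁ v ∷ Ps) n y _ _ (here refl) d d∈ with ∈-tabulate⁻ {f = edgeCode} d∈
  ... | e , refl = inj₂ (sym (zeroˡ _)) , before (len e)
    where
    before : ∀ L → 0# ≤ beforeᴴ (1# , inj₁ (toℕ v) , λ z → nthᴴ z n) (toℕ e , toℕ (src e) , toℕ (tgt e) , encodeExtended {ℝ} L) y
    before [ ℓ ] = inj₂ (sym (zeroˡ _))
    before ⊤⁺    = ≤-refl
  Valid⇒validEntries (inj₂ c ∷ Ps) n y (v ∷ _) _ (here refl) d d∈ with ∈-tabulate⁻ {f = edgeCode} d∈
  ... | e , refl with c Fin.≟ e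
  ...   | no c≢e = subst (λ u → 0# ≤ u * nthᴴ y n) (sym δ≡0) (inj₂ (sym (zeroˡ _))) , before (len e)
    where
    δ≡0 : δᴴ (toℕ c) (toℕ e) ≡ 0#
    δ≡0 = trans (δ-code c e) (cong ι (δ-≢ c≢e))
    before : ∀ L → 0# ≤ beforeᴴ (1# , inj₂ (toℕ c) , λ z → nthᴴ z n) (toℕ e , toℕ (src e) , toℕ (tgt e) , encodeExtended {ℝ} L) y
    before [ ℓ ] = subst (λ u → 0# ≤ u * (ℓ - nthᴴ y n)) (sym δ≡0) (inj₂ (sym (zeroˡ _)))
    before ⊤⁺    = ≤-refl
  ...   | yes refl = 0≤-* 0≤δᴴ (lower (len c) v) , before (len c) v
    where
    0≤δᴴ : 0# ≤ δᴴ (toℕ c) (toℕ c)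
    0≤δᴴ = subst (0# ≤_) (sym (trans (δ-code c c) (trans (cong ι (δ-refl c)) ι-1))) (<⇒≤ 0<1)
    lower : ∀ L → InRange L (nthᴴ y n) → 0# ≤ nthᴴ y n
    lower [ ℓ ] = proj₁
    lower ⊤⁺ p  = p
    before : ∀ L → InRange L (nthᴴ y n) →
             0# ≤ beforeᴴ (1# , inj₂ (toℕ c) , λ z → nthᴴ z n) (toℕ c , toℕ (src c) , toℕ (tgt c) , encodeExtended {ℝ} L) y
    before [ ℓ ] (_ , p) = 0≤-* 0≤δᴴ (0≤-sub p)
    before ⊤⁺    _       = ≤-refl

  points-valid : ∀ D → All (Valid ∘ proj₂) (chain D)
  points-valid []            = []
  points-valid ((m , p) ∷ D) = location-valid p ∷ points-valid D

  integers : ∀ {n} b (s : Env) → length s ≡ n → All (_∈ slopesᴴ b) s → Σ[ σ ∈ (Fin n → ℤ) ] (∀ i → nthᴴ s (toℕ i) ≡ ι (σ i))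
  integers b []      refl []       = (λ ()) , λ ()
  integers b (x ∷ s) refl (x∈ ∷ h) with ∈slopes⁻ b x∈ | integers b s refl h
  ... | z , x≡ | σ , s≡ = (λ { zero → z ; (suc i) → σ i }) , λ { zero → x≡ ; (suc i) → s≡ i }

  length-edgeCodes : lengthᴴ edgeCodes ≡ #edges
  length-edgeCodes = go edgeCode
    where
    go : ∀ {n} (f : Fin n → EdgeData) → lengthᴴ (tabulate f) ≡ n
    go {zero}  f = refl
    go {suc n} f = cong suc (go (f ∘ suc))

  plus-+ : ∀ m n → plusᴴ m n ≡ m ℕ.+ n
  plus-+ zero    n = refl
  plus-+ (suc m) n = cong suc (plus-+ m n)

  solvableAt⇒solvable : ∀ {d b H C y} → y ⊨ H ∼ C → SolvableAt #vertices edgeCodes d b H y →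
                        ∃[ qs ] length qs ≡ d × Solvable (chain (points qs) ++ C)
  solvableAt⇒solvable {d} {b} {H} {C} {y} match (w , w∈ , s , s∈ , system , valid) with ∈words⁻ place d places w∈
  ... | lw , hw with decode hw
  ...   | Ps , refl with realise Ps #vertices y (validEntries⇒Valid Ps #vertices y valid)
                       | integers {#edges} b s (trans (proj₁ (∈words⁻ real (lengthᴴ edgeCodes) (slopesᴴ b) s∈)) length-edgeCodes)
                           (proj₂ (∈words⁻ real (lengthᴴ edgeCodes) (slopesᴴ b) s∈))
  ...     | qs , lq , qs≡ | σ , s≡ = qs , trans lq (trans (sym (length-map code Ps)) lw) , σ , _ ,
            subst (λ K → Solution (K ++ C) σ _) (sym qs≡)
              (system⇒solution (append-matches (entries-match Ps #vertices y) match) s σ s≡ system)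

  -- `slope-bound` places the slopes among the words that are tried; the quantified variables become
  -- the heights followed by the positions of `qs`.
  solvable⇒solvableAt : ∀ {d b H C z} qs → length qs ≡ d → All (Valid ∘ proj₂) C → mass (chain (points qs) ++ C) ℤ.* pos 4 ≡ pos b →
                        (∀ xs → length xs ≡ #vertices ℕ.+ d → (xs ++ z) ⊨ H ∼ C) → Solvable (chain (points qs) ++ C) →
                        ∃[ xs ] length xs ≡ plusᴴ #vertices d × SolvableAt #vertices edgeCodes d b H (xs ++ z)
  solvable⇒solvableAt {d} {b} {H} {C} {z} qs refl valid mass≡ match (σ , h , S) =
    xs , trans length-xs (sym (plus-+ #vertices d)) ,
    map code Ps , code∈words Ps (length-map _ qs) ,
    tabulate (ι ∘ σ) , subst (λ n → tabulate (ι ∘ σ) ∈ wordsᴴ real n (slopesᴴ b)) (trans (length-tabulate (ι ∘ σ)) (sym length-edgeCodes))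
                         (∈words⁺ real (slopesᴴ b) (All.tabulate⁺ λ e → ∈slopes⁺ b (σ e) (∣∣≤⇒≤ (bound e)))) ,
    solution⇒system (append-matches (entries-match Ps #vertices y) (match xs length-xs)) (tabulate (ι ∘ σ)) σ
      (λ e → trans (cong (λ l → nthᴴ l (toℕ e)) (sym (++-identityʳ (tabulate (ι ∘ σ))))) (nth-tabulate (ι ∘ σ) [] e))
      (subst (λ K → Solution (K ++ C) σ (λ v → nthᴴ y (toℕ v))) (sym placed≡) (solution-cong S)) ,
    Valid⇒validEntries Ps #vertices y (subst (All (Valid ∘ proj₂)) (sym placed≡) (points-valid (points qs)))
    where
    Ps : List Place
    Ps = map (proj₁ ∘ location) qs
    ts hs xs y : Env
    ts = map (proj₂ ∘ location) qs
    hs = tabulate h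
    xs = hs ++ ts
    y = xs ++ z
    length-xs : length xs ≡ #vertices ℕ.+ length qs
    length-xs = trans (length-++ hs) (cong₂ ℕ._+_ (length-tabulate h) (length-map _ qs))
    y≡ : y ≡ hs ++ (ts ++ z)
    y≡ = ++-assoc hs ts z
    nth-h : ∀ v → nthᴴ y (toℕ v) ≡ h v
    nth-h v = trans (cong (λ l → nthᴴ l (toℕ v)) y≡) (nth-tabulate h _ v)
    placed≡ : placedChain Ps #vertices y ≡ chain (points qs)
    placed≡ = trans (cong₂ (placedChain Ps) (trans (sym (length-tabulate h)) (sym (ℕ.+-identityʳ _))) y≡)
                (trans (placedChain-shift Ps hs 0 (ts ++ z)) (placedChain-points qs z))
    bound : ∀ e → ∣ σ e ∣≤ pos b
    bound e = subst (∣ σ e ∣≤_) (trans (ℤ.*-comm (pos 4) _) mass≡)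
      (slope-bound (chain (points qs) ++ C) (All.++⁺ (points-valid (points qs)) valid) σ h S e)
    solution-cong : ∀ {K} → Solution K σ h → Solution K σ (λ v → nthᴴ y (toℕ v))
    solution-cong {K} S = record { edges = λ e → edge-cong e (len e) (edges e) ; vertices = vertices }
      where
      open Solution S
      edge-cong : ∀ e L → EdgeEquation e L (σ e) h K → EdgeEquation e L (σ e) (λ v → nthᴴ y (toℕ v)) K
      edge-cong e [ ℓ ] p = trans (cong₂ _-_ (nth-h (tgt e)) (nth-h (src e))) p
      edge-cong e ⊤⁺    p = trans (cong₂ _-_ (nth-h (tgt e)) (nth-h (src e))) p

-- The test for one degree

module RankTest {ℝ : Reals} (Γ : TropicalCurve ℝ) (D : Divisor Γ) where
  open OrderedField ℝ
  open Decision ℝ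
  open Semantics ℝ
  open TropicalCurve Γ
  open Solvability Γ
  open SlopeBound Γ
  open Divisors Γ
  open LinearSystems Γ
  open Interpretation Γ
  open Position

  private
    input : ⟦_⟧ ℝ (curve ⊗ divisor)
    input = encodeCurve Γ , encodeDivisor Γ D

  opaque
    unfolding enumerateᵀ

    enumerate-tabulate : ∀ {Δ} {ρ : All (⟦_⟧ ℝ) Δ} σ {n} (f : Fin n → ⟦_⟧ ℝ σ) →
                         eval ℝ (enumerateᵀ {σ = σ}) ρ (tabulate f) ≡ tabulate (λ i → toℕ i , f i)
    enumerate-tabulate {Δ} {ρ} σ f = go f
      where
      go : ∀ {n} (f : Fin n → ⟦_⟧ ℝ σ) →
           foldr (λ x r → (0 , x) ∷ foldr (λ (i , x) r → (suc i , x) ∷ r) [] r) [] (tabulate f) ≡ tabulate (λ i → toℕ i , f i)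
      go {zero}  f = refl
      go {suc n} f = cong ((0 , f zero) ∷_)
        (trans (map-map (λ (i , x) → suc i , x) _) (trans (cong (map _) (go (f ∘ suc))) (map-tabulate _ _)))

  positive-part negative-part : ℤ → ℕ
  positive-part (pos n)  = n
  positive-part -[1+ n ] = 0
  negative-part (pos n)  = 0
  negative-part -[1+ n ] = suc n

  sumᴺ : (ℤ → ℕ) → Divisor Γ → ℕ
  sumᴺ φ = foldr (λ (k , _) r → φ k ℕ.+ r) 0

  module _ {Δ} (ρ : All (⟦_⟧ ℝ) Δ) where

    private
      enc : ℤ × Point Γ → ⟦_⟧ ℝ (int ⊗ point)
      enc (k , p) = encodeℤ {ℝ} k , encodePoint Γ p

    opposite-coefficient : ∀ k p → proj₁ (eval ℝ oppositeEntryᵀ ρ (enc (k , p))) ≡ ι (ℤ.- k)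
    opposite-coefficient (pos n)  p = trans (cong -_ (real-ι n)) (sym (ι-neg (pos n)))
    opposite-coefficient -[1+ n ] p = real-ι (suc n)

    opposite-matches : ∀ D y → y ⊨ foldr (λ x r → eval ℝ oppositeEntryᵀ ρ x ∷ r) [] (encodeDivisor Γ D) ∼ chain (negate D)
    opposite-matches []                                      y = []
    opposite-matches ((m , vertex v) ∷ D)                    y = vertexᴹ (opposite-coefficient m (vertex v)) (opposite-matches D y)
    opposite-matches ((m , on e x@(position [ t ] _ _)) ∷ D) y = edgeᴹ (opposite-coefficient m (on e x)) refl (opposite-matches D y)
    opposite-matches ((m , on e x@(position ⊤⁺ _ _)) ∷ D)    y = edgeᴹ (opposite-coefficient m (on e x)) refl (opposite-matches D y)

    Affine-opposite : ∀ D n → AffineEntries n (foldr (λ x r → eval ℝ oppositeEntryᵀ ρ x ∷ r) [] (encodeDivisor Γ D))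
    Affine-opposite ((m , vertex v) ∷ D)                  n _ (here refl) = Affine-const n 0#
    Affine-opposite ((m , on e (position [ t ] _ _)) ∷ D) n _ (here refl) = Affine-const n t
    Affine-opposite ((m , on e (position ⊤⁺ _ _)) ∷ D)    n _ (here refl) = Affine-const n 0#
    Affine-opposite (_ ∷ D)                               n g (there g∈)  = Affine-opposite D n g g∈

  fold-sum : ∀ (step : ⟦_⟧ ℝ (int ⊗ point) → ℕ → ℕ) φ → (∀ k p r → step (encodeℤ {ℝ} k , encodePoint Γ p) r ≡ φ k ℕ.+ r) →
             ∀ D → foldr step 0 (encodeDivisor Γ D) ≡ sumᴺ φ D
  fold-sum step φ h []            = refl
  fold-sum step φ h ((k , p) ∷ D) = trans (h k p _) (cong (φ k ℕ.+_) (fold-sum step φ h D))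

  opaque
    unfolding positiveᵀ negativeᵀ

    positive-eval : ∀ {Δ} {ρ : All (⟦_⟧ ℝ) Δ} → eval ℝ positiveᵀ ρ (encodeDivisor Γ D) ≡ sumᴺ positive-part D
    positive-eval = fold-sum _ positive-part (λ { (pos n) p r → plus-+ n r ; -[1+ n ] p r → refl }) D

    negative-eval : ∀ {Δ} {ρ : All (⟦_⟧ ℝ) Δ} → eval ℝ negativeᵀ ρ (encodeDivisor Γ D) ≡ sumᴺ negative-part D
    negative-eval = fold-sum _ negative-part (λ { (pos n) p r → refl ; -[1+ n ] p r → plus-+ (suc n) r }) D

  opaque
    unfolding oppositeᵀ

    opposite-∼-negate : ∀ {Δ} {ρ : All (⟦_⟧ ℝ) Δ} y → y ⊨ eval ℝ oppositeᵀ ρ (encodeDivisor Γ D) ∼ chain (negate D)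
    opposite-∼-negate = opposite-matches _ D

    opposite-affine : ∀ {Δ} {ρ : All (⟦_⟧ ℝ) Δ} n → AffineEntries n (eval ℝ oppositeᵀ ρ (encodeDivisor Γ D))
    opposite-affine = Affine-opposite _ D

  opaque
    unfolding monusᵀ

    monus-∸ : ∀ {Δ} {ρ : All (⟦_⟧ ℝ) Δ} m n → eval ℝ monusᵀ ρ m n ≡ m ℕ.∸ n
    monus-∸ m zero    = refl
    monus-∸ {ρ = ρ} m (suc n) = trans (predecessor (eval ℝ monusᵀ ρ m n)) (trans (cong ℕ.pred (monus-∸ {ρ = ρ} m n)) (ℕ.pred[m∸n]≡m∸[1+n] m n))
      where
      predecessor : ∀ r → primrec ℝ {ℕ} 0 (λ k _ → k) r ≡ ℕ.pred r
      predecessor zero    = refl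
      predecessor (suc r) = refl

  opaque
    unfolding quadrupleᵀ

    quadruple-+ : ∀ {Δ} {ρ : All (⟦_⟧ ℝ) Δ} w → eval ℝ quadrupleᵀ ρ w ≡ (w ℕ.+ w) ℕ.+ (w ℕ.+ w)
    quadruple-+ w = trans (plus-+ (plusᴴ w w) (plusᴴ w w)) (cong₂ ℕ._+_ (plus-+ w w) (plus-+ w w))

  private
    P N : ℕ
    P = sumᴺ positive-part D
    N = sumᴺ negative-part D

  deg≡P-N : deg Γ D ≡ pos P ℤ.- pos N
  deg≡P-N = go D
    where
    go : ∀ D → deg Γ D ≡ pos (sumᴺ positive-part D) ℤ.- pos (sumᴺ negative-part D)
    go []            = refl
    go ((k , p) ∷ D) = trans (cong₂ ℤ._+_ (split k) (go D))
        (eq (pos (positive-part k)) (pos (negative-part k)) (pos (sumᴺ positive-part D)) (pos (sumᴺ negative-part D)))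
      where
      split : ∀ k → k ≡ pos (positive-part k) ℤ.- pos (negative-part k)
      split (pos n)  = sym (ℤ.+-identityʳ (pos n))
      split -[1+ n ] = refl
      eq : ∀ a b c d → (a ℤ.- b) ℤ.+ (c ℤ.- d) ≡ (a ℤ.+ c) ℤ.- (b ℤ.+ d)
      eq = solve-∀

  mass-++ : ∀ G H → mass (G ++ H) ≡ mass G ℤ.+ mass H
  mass-++ G H = trans (cong (λ K → ⟨ (λ _ → 1ℤ) , K ⟩) (map-++ _ G H)) (⟨⟩-++ (λ _ → 1ℤ) (absolute G) (absolute H))

  mass-points : ∀ qs → mass (chain (points qs)) ≡ pos (length qs)
  mass-points []       = refl
  mass-points (q ∷ qs) = cong (λ u → 1ℤ ℤ.+ u) (mass-points qs)

  mass-negate : mass (chain (negate D)) ≡ pos (P ℕ.+ N)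
  mass-negate = go D
    where
    go : ∀ D → mass (chain (negate D)) ≡ pos (sumᴺ positive-part D ℕ.+ sumᴺ negative-part D)
    go []            = refl
    go ((k , p) ∷ D) = trans (cong₂ ℤ._+_ (trans (ℤ.*-identityʳ _) (cong pos (size k))) (go D))

        (eq (pos (positive-part k)) (pos (negative-part k)) (pos (sumᴺ positive-part D)) (pos (sumᴺ negative-part D)))
      where
      size : ∀ k → ℤ.∣ ℤ.- k ∣ ≡ positive-part k ℕ.+ negative-part k
      size (pos zero)    = refl
      size (pos (suc n)) = sym (ℕ.+-identityʳ (suc n))
      size -[1+ n ]      = refl
      eq : ∀ a b c d → (a ℤ.+ b) ℤ.+ (c ℤ.+ d) ≡ (a ℤ.+ c) ℤ.+ (b ℤ.+ d)
      eq = solve-∀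

  complementary : ℕ → ℕ
  complementary k = P ℕ.∸ (N ℕ.+ k)

  -- The degree of `F` is forced, so trying a single one is enough. Truncated subtraction is safe:
  -- if `deg D` is less than the degree of `E`, there is no solution at all.
  Rational-length : ∀ {qs ps} → Rational D qs ps → length qs ≡ complementary (length ps)
  Rational-length {qs} {ps} R = begin
    length qs  ≡⟨ sym (ℕ.m+n∸n≡m (length qs) (length ps)) ⟩
    (length qs ℕ.+ length ps) ℕ.∸ length ps  ≡⟨ sym (ℕ.[m+n]∸[m+o]≡n∸o N _ (length ps)) ⟩
    (N ℕ.+ (length qs ℕ.+ length ps)) ℕ.∸ (N ℕ.+ length ps)  ≡⟨ cong (ℕ._∸ (N ℕ.+ length ps)) (ℤ.+-injective total≡) ⟩
    P ℕ.∸ (N ℕ.+ length ps)  ∎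
    where
    open ≡-Reasoning
    eq : ∀ p n → n ℤ.+ (p ℤ.- n) ≡ p
    eq = solve-∀
    total≡ : pos (N ℕ.+ (length qs ℕ.+ length ps)) ≡ pos P
    total≡ = trans (cong (λ u → pos N ℤ.+ u) (trans (Rational-degree D {qs} {ps} R) deg≡P-N)) (eq (pos P) (pos N))

  -- Here `w` is the mass of `F + E - D` as a formal sum.
  slopeLimit : ℕ → ℕ
  slopeLimit k = let w = (complementary k ℕ.+ k) ℕ.+ (P ℕ.+ N) in (w ℕ.+ w) ℕ.+ (w ℕ.+ w)

  -- Some effective divisor of degree k certifies that the rank is below k.
  Witness : ℕ → Set
  Witness k = ∃[ ps ] length ps ≡ k × ¬ (∃[ qs ] Rational D qs ps)

  module _ (H : List Entry) (matches : ∀ y → y ⊨ H ∼ chain (negate D)) where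

    private
      DeficientAt : ℕ → Set
      DeficientAt k = Deficient #vertices edgeCodes H k (complementary k) (slopeLimit k)

      chain-difference : ∀ qs ps → chain (points qs) ++ (chain (points ps) ++ chain (negate D)) ≡ chain (difference D qs ps)
      chain-difference qs ps = sym (trans (chain-++ (points qs) _) (cong (chain (points qs) ++_) (chain-++ (points ps) (negate D))))

      subtrahend-match : ∀ {k} Ps ps z xs → length xs ≡ #vertices ℕ.+ complementary k → placedChain Ps 0 z ≡ chain (points ps) →
        (xs ++ z) ⊨ appendᴴ (entriesᴴ (map code Ps) (plusᴴ #vertices (complementary k))) H ∼ (chain (points ps) ++ chain (negate D))
      subtrahend-match {k} Ps ps z xs l Ps≡ = subst (λ C → (xs ++ z) ⊨ _ ∼ (C ++ chain (negate D)))
        (trans (cong (λ n → placedChain Ps n (xs ++ z)) (trans (plus-+ #vertices (complementary k)) (trans (sym l) (sym (ℕ.+-identityʳ _)))))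
          (trans (placedChain-shift Ps xs 0 z) Ps≡))
        (append-matches (entries-match Ps (plusᴴ #vertices (complementary k)) (xs ++ z)) (matches (xs ++ z)))

    Deficient⇒Witness : ∀ k → DeficientAt k → Witness k
    Deficient⇒Witness k (w , w∈ , ts , lt , valid , none) with ∈words⁻ place k places w∈
    ... | lw , hw with decode hw
    ...   | Ps , refl with realise Ps 0 (ts ++ []) (validEntries⇒Valid Ps 0 (ts ++ []) valid)
    ...     | ps , lp , ps≡ = ps , lps , λ (qs , R) → none (solvable⇒solvableAt {complementary k} {slopeLimit k} qs
                (trans (Rational-length {qs} {ps} R) (cong complementary lps))
                (All.++⁺ (points-valid (points ps)) (points-valid (negate D)))
                (limit qs (trans (Rational-length {qs} {ps} R) (cong complementary lps)))
                (λ xs l → subtrahend-match {k} Ps ps (ts ++ []) xs l (sym ps≡))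
                (subst Solvable (sym (chain-difference qs ps)) R))
      where
      lps : length ps ≡ k
      lps = trans lp (trans (sym (length-map code Ps)) lw)
      limit : ∀ qs → length qs ≡ complementary k → mass (chain (points qs) ++ (chain (points ps) ++ chain (negate D))) ℤ.* pos 4 ≡ pos (slopeLimit k)
      limit qs lq = begin
        mass (chain (points qs) ++ (chain (points ps) ++ chain (negate D))) ℤ.* pos 4
          ≡⟨ cong (ℤ._* pos 4) (trans (mass-++ (chain (points qs)) _) (cong₂ ℤ._+_ (mass-points qs)
               (trans (mass-++ (chain (points ps)) _) (cong₂ ℤ._+_ (mass-points ps) mass-negate)))) ⟩
        (pos (length qs) ℤ.+ (pos (length ps) ℤ.+ pos (P ℕ.+ N))) ℤ.* pos 4
          ≡⟨ cong₂ (λ a b → (pos a ℤ.+ (pos b ℤ.+ pos (P ℕ.+ N))) ℤ.* pos 4) lq lps ⟩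
        (pos (complementary k) ℤ.+ (pos k ℤ.+ pos (P ℕ.+ N))) ℤ.* pos 4
          ≡⟨ eq (pos (complementary k)) (pos k) (pos (P ℕ.+ N)) ⟩
        pos (slopeLimit k) ∎
        where
        open ≡-Reasoning
        eq : ∀ a b c → (a ℤ.+ (b ℤ.+ c)) ℤ.* pos 4 ≡ ((a ℤ.+ b ℤ.+ c) ℤ.+ (a ℤ.+ b ℤ.+ c)) ℤ.+ ((a ℤ.+ b ℤ.+ c) ℤ.+ (a ℤ.+ b ℤ.+ c))
        eq = solve-∀

    Witness⇒Deficient : ∀ k → Witness k → DeficientAt k
    Witness⇒Deficient k (ps , refl , none) = map code Ps , code∈words Ps (length-map _ ps) , ts , length-map _ ps ,
        Valid⇒validEntries Ps 0 (ts ++ []) (subst (All (Valid ∘ proj₂)) (sym Ps≡) (points-valid (points ps))) ,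
        λ (xs , l , at) → let (qs , _ , S) = solvableAt⇒solvable {complementary k} {slopeLimit k}
                                               (subtrahend-match {k} Ps ps (ts ++ []) xs (trans l (plus-+ #vertices (complementary k))) Ps≡) at
                          in none (qs , subst Solvable (chain-difference qs ps) S)
      where
      Ps : List Place
      Ps = map (proj₁ ∘ location) ps
      ts : Env
      ts = map (proj₂ ∘ location) ps
      Ps≡ : placedChain Ps 0 (ts ++ []) ≡ chain (points ps)
      Ps≡ = placedChain-points ps []

-- Correctness

module Correctness {ℝ : Reals} (Γ : TropicalCurve ℝ) (D : Divisor Γ) where
  open OrderedField ℝ
  open Decision ℝ
  open Semantics ℝ
  open TropicalCurve Γ
  open Divisors Γ
  open LinearSystems Γ
  open Interpretation Γ
  open RankTest Γ D

  private
    input : ⟦_⟧ ℝ (curve ⊗ divisor)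
    input = encodeCurve Γ , encodeDivisor Γ D

  deficient-Witness : ∀ {Δ} {ρ : All (⟦_⟧ ℝ) Δ} k {E d b} H → (∀ n → AffineEntries n H) → (∀ y → y ⊨ H ∼ chain (negate D)) →
                      E ≡ edgeCodes → d ≡ complementary k → b ≡ slopeLimit k →
                      Reflects (Witness k) (eval ℝ deficientᵀ ρ #vertices E H k d b)
  deficient-Witness k H affine matches refl refl refl =
    reflects-map (Deficient⇒Witness H matches k) (Witness⇒Deficient H matches k)
      (deficient-reflects #vertices edgeCodes H k (complementary k) (slopeLimit k) affine)

  opaque
    unfolding testᵀ

    test-reflects : ∀ {Δ} {ρ : All (⟦_⟧ ℝ) Δ} k → Reflects (Witness k) (eval ℝ testᵀ ρ k input)
    test-reflects k = deficient-Witness k _ opposite-affine opposite-∼-negate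
      (enumerate-tabulate (nat ⊗ nat ⊗ extended) _) d≡
      (slope≡ (w≡ d≡ positive-eval negative-eval))
      where
      d≡ : ∀ {Δ Δ₁ Δ₂} {ρ : All (⟦_⟧ ℝ) Δ} {ρ₁ : All (⟦_⟧ ℝ) Δ₁} {ρ₂ : All (⟦_⟧ ℝ) Δ₂} →
           eval ℝ monusᵀ ρ (eval ℝ positiveᵀ ρ₁ (encodeDivisor Γ D)) (plusᴴ (eval ℝ negativeᵀ ρ₂ (encodeDivisor Γ D)) k) ≡ complementary k
      d≡ = trans (monus-∸ _ _) (cong₂ ℕ._∸_ positive-eval (trans (plus-+ _ k) (cong (ℕ._+ k) negative-eval)))
      w≡ : ∀ {d p n} → d ≡ complementary k → p ≡ sumᴺ positive-part D → n ≡ sumᴺ negative-part D →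
           plusᴴ (plusᴴ d k) (plusᴴ p n) ≡ (complementary k ℕ.+ k) ℕ.+ (sumᴺ positive-part D ℕ.+ sumᴺ negative-part D)
      w≡ {d} {p} {n} refl refl refl = trans (plus-+ (plusᴴ d k) (plusᴴ p n)) (cong₂ ℕ._+_ (plus-+ d k) (plus-+ p n))
      slope≡ : ∀ {Δ} {ρ : All (⟦_⟧ ℝ) Δ} {w} → w ≡ (complementary k ℕ.+ k) ℕ.+ (sumᴺ positive-part D ℕ.+ sumᴺ negative-part D) →
               eval ℝ quadrupleᵀ ρ w ≡ slopeLimit k
      slope≡ {ρ = ρ} {w} refl = quadruple-+ {ρ = ρ} w

  -- The search for the least degree

  rank-below : ℕ → ⟦_⟧ ℝ int
  rank-below m = encodeℤ {ℝ} (pos m ℤ.- 1ℤ)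

  Halts : ℕ → ℕ → Set
  Halts k m = RunsTo ℝ rankAlgorithm (k , input) (rank-below m)

  outcome : ℕ → Bool
  outcome k = eval ℝ {nat ⊗ (curve ⊗ divisor) ∷ []} testᵀ ((k , input) ∷ []) k input

  step-halt : ∀ k → outcome k ≡ inj₁ tt → Halts k k
  step-halt k eq = halt (trans (cong (branch ℝ _ _ _) eq) (cong inj₂ (output k)))
    where
    output : ∀ k → primrec ℝ {⟦_⟧ ℝ int} (inj₂ 0) (λ j _ → inj₁ j) k ≡ rank-below k
    output zero    = refl
    output (suc k) = refl

  step-next : ∀ k m → outcome k ≡ inj₂ tt → Halts (suc k) m → Halts k m
  step-next k m eq = next (cong (branch ℝ _ _ _) eq)

  decide : ∀ k → (Witness k × outcome k ≡ inj₁ tt) ⊎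
                 (¬ Witness k × outcome k ≡ inj₂ tt)
  decide k = cases (test-reflects k)
    where
    cases : ∀ {b} → Reflects (Witness k) b → (Witness k × b ≡ inj₁ tt) ⊎ (¬ Witness k × b ≡ inj₂ tt)
    cases (true p)   = inj₁ (p , refl)
    cases (false ¬p) = inj₂ (¬p , refl)

  -- Matches the iteration of the algorithm by recursion on the distance `n` to a degree known to
  -- have a witness.
  search : ∀ n k → (∀ j → j ℕ.< k → ¬ Witness j) → Witness (n ℕ.+ k) →
           ∃[ m ] Witness m × (∀ j → j ℕ.< m → ¬ Witness j) × Halts k m
  search n k none w with decide k
  ... | inj₁ (wk , eq) = k , wk , none , step-halt k eq
  search zero    k none w | inj₂ (¬wk , eq) = ⊥-elim (¬wk w)
  search (suc n) k none w | inj₂ (¬wk , eq) =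
    let (m , wm , min , halts) = search n (suc k) none′ (subst Witness (sym (ℕ.+-suc n k)) w)
    in m , wm , min , step-next k m eq halts
    where
    none′ : ∀ j → j ℕ.< suc k → ¬ Witness j
    none′ j (ℕ.s≤s j≤k) with j ℕ.≟ k
    ... | yes refl = ¬wk
    ... | no j≢k   = none j (ℕ.≤∧≢⇒< j≤k j≢k)

  -- This degree exceeds that of `D`, so any effective divisor will do; copies of one vertex are
  -- taken.
  large-Witness : Witness (suc (sumᴺ positive-part D))
  large-Witness = ps , length-replicate _ , λ (qs , R) → ℕ.1+n≰n {#positive} (ℕ.≤-trans
      (subst (ℕ._≤ length qs ℕ.+ length ps) (length-replicate (suc #positive)) (ℕ.m≤n+m (length ps) (length qs)))
      (ℤ.drop‿+≤+ (subst (ℤ._≤ pos #positive) (sym (Rational-degree D {qs} {ps} R))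
        (subst (ℤ._≤ pos #positive) (sym deg≡P-N) (ℤ.i≤j⇒i-k≤j (pos (sumᴺ negative-part D)) ℤ.≤-refl)))))
    where
    #positive : ℕ
    #positive = sumᴺ positive-part D
    ps : List (Point Γ)
    ps = replicate (suc #positive) (vertex (somewhere #vertices nonempty))
      where
      somewhere : ∀ n → ℕ.NonZero n → Fin n
      somewhere (suc n) _ = zero

  IsRank-Witness : ∀ m → Witness m → (∀ j → j ℕ.< m → ¬ Witness j) → IsRank Γ D (pos m ℤ.- 1ℤ)
  IsRank-Witness m (ps , refl , none) min = pos m ,
    ((points ps , coeff-points ps , (λ nonempty → none (nonempty⇒Rational D {points ps} {ps} (λ _ → refl) nonempty)) , deg-points ps) ,
     λ k (E , effective , empty , deg≡) → minimal E effective empty deg≡) , refl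
    where
    minimal : ∀ E {k} → Effective Γ E → ¬ ∃ (∣_∣ Γ (_⊟_ Γ D E)) → deg Γ E ≡ k → pos m ℤ.≤ k
    minimal E effective empty refl with effective-points E effective
    ... | ps′ , E≐ , deg≡ rewrite deg≡ = ℤ.+≤+ (ℕ.≮⇒≥ λ l → min (length ps′) l
          (ps′ , refl , λ (qs , R) → empty (Rational⇒nonempty D {E} {qs} {ps′} E≐ R)))

  rank-computed : ∃[ r ] IsRank Γ D r × Computes ℝ rankAlgorithm input (encodeℤ {ℝ} r)
  rank-computed = conclude (search (suc (sumᴺ positive-part D)) 0 (λ _ ()) (subst Witness (sym (ℕ.+-identityʳ _)) large-Witness))
    where
    conclude : (∃[ m ] Witness m × (∀ j → j ℕ.< m → ¬ Witness j) × Halts 0 m) →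
               ∃[ r ] IsRank Γ D r × Computes ℝ rankAlgorithm input (encodeℤ {ℝ} r)
    conclude (m , w , min , halts) = pos m ℤ.- 1ℤ , IsRank-Witness m w min , halts

corollary4p4 : Σ[ A ∈ Algorithm (curve ⊗ divisor) int ]
    ((ℝ : Reals) (Γ : TropicalCurve ℝ) (D : Divisor Γ) →
    ∃[ r ] IsRank Γ D r ×
    Computes ℝ A (encodeCurve Γ , encodeDivisor Γ D) (encodeℤ {ℝ} r))
corollary4p4 = rankAlgorithm , λ ℝ Γ D → Correctness.rank-computed Γ D
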